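{- For every $\epsilon>0$ there exist $\delta>0$ and $p_0$ such that for every prime $p\geq p_0$ and every multiset $A$ of elements of $\mathbb{Z}_p^2$ in which no element has multiplicity $\geq\delta p$, the following hold: (1) if $|A|>(1+\epsilon)p$, then $A$ contains a non-empty sub-multiset of at most $p$ elements whose sum is $0$; (2) if $|A|>(2+\epsilon)p$, then $A$ contains a sub-multiset of exactly $p$ elements whose sum is $0$.
   Context: $\mathbb{Z}_p=\mathbb{Z}/p\mathbb{Z}$; sizes of multisets are counted with multiplicity. -}

module Defs where

open import Data.Nat using (ℕ)
open import Data.Nat.Divisibility using (_∣_)
open import Data.Fin using (Fin; toℕ; _≟_)
open import Data.Product using (_×_; _,_; proj₁; proj₂)
open import Data.Product.Properties using (≡-dec)
open import Data.List using (List; length; filter; map)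
open import Data.Nat.ListAction using (sum)
open import Data.Integer using (+_)
open import Data.Rational using (ℚ; _/_)

Zp² : ℕ → Set
Zp² p = Fin p × Fin p

-- A finite multiset of elements of Z_p^2 is represented by a list
-- (order irrelevant; size = length counts multiplicity).
Multiset : ℕ → Set
Multiset p = List (Zp² p)

mult : ∀ {p} → Zp² p → Multiset p → ℕ
mult x A = length (filter (≡-dec _≟_ _≟_ x) A)

SumZero : ∀ {p} → Multiset p → Set
SumZero {p} B = (p ∣ sum (map (λ x → toℕ (proj₁ x)) B))
              × (p ∣ sum (map (λ x → toℕ (proj₂ x)) B))

ℕ→ℚ : ℕ → ℚ
ℕ→ℚ n = (+ n) / 1

{-# OPTIONS --safe #-}
-- Pad A with p - 1 copies of 0 for the first part; both parts then ask for a zero sum of length exactly p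
-- in U ++ A, where |U| ≤ p, |U ++ A| ≥ (2 + 1/m) p, and only A has small multiplicities.
--
-- Replacing Y ⊆ Z_p² by Y + {a , b} enlarges it by lam Y (a - b), where lam Y g is the number of points of Y
-- that translation by g moves out of Y, and lam Y is a seminorm on Z_p².
-- If the points of A are not concentrated on a line, every element of Z_p² is a sum of at most p/W differences
-- of points of A (W large), so lam Y is large on one of these differences and Y grows quickly.  Hence few
-- disjoint pairs {a , b} from A have sumset Z_p², and p - h arbitrary further elements are completed to a zero
-- sum by one element from each of the h pairs.
--
-- If a line y ≡ v contains many points of A, the one-dimensional version gives h pairs on that line whose sums
-- take all values of x, and it remains to find p - h further elements with prescribed sum of y.  If some line
-- y ≡ const has more than (1 + small) p points, they are found on that line.  Otherwise the remaining elements
-- can be distributed over p - h sets of incongruent y with total size at least 2p - h - 1, and Cauchy–Davenport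
-- shows that sums of one element from each set take all values.
module Submission where

open import Data.Nat using (ℕ)
open import Data.Nat.Primality using (Prime)

-- Why some gain is large: let M be the largest `lam Y` over differences of the remaining points. As
-- `lam Y` is a seminorm, it is at most M times the number of differences needed to write the
-- translation. Averaging over a box with at least 2|Y| points shows that some translation in the
-- box moves at least half of Y out of Y, so M cannot be small.
--
-- A box of side about √|Y| needs of order √|Y| differences, so |Y| grows like the square of the
-- number of steps. This alone would need more than p pairs to fill half of the plane. It is used
-- only up to a small fixed proportion of p²; from there on the bound p/W for all translations gives
-- a gain of about W|Y|/p per step, and W is chosen so large that few further pairs suffice.
--
-- The bound p/W comes from Euclidean division: pigeonhole finds a difference of points that is
-- neither tiny nor of order p, and multiples of it replace long chains of unit steps.
--
-- Order of choice: the plane covering fixes how few points a light line may hold, this threshold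
-- fixes how few pairs a heavy line may spend, and that fixes the admissible multiplicity.

module Prelude where
  open import Data.Bool using (Bool; true; false; _∧_; _∨_; not; if_then_else_) public
  open import Data.Bool.Properties using (∧-comm; ∨-zeroʳ) public
  open import Data.Empty using (⊥-elim) public
  open import Data.Fin using (Fin; zero; suc; toℕ; fromℕ<; combine) public
  open import Data.Fin.Properties using (pigeonhole; combine-injective; fromℕ<-injective; toℕ<n; toℕ-fromℕ<) renaming (any? to anyFin?) public
  open import Data.Integer using (ℤ; +_; -[1+_]; ∣_∣; 0ℤ; 1ℤ) renaming (_+_ to _+'_; _-_ to _-'_; _*_ to _*'_; -_ to -'_) public
  open import Data.Integer.Divisibility.Signed using (_∣?_) renaming (divides to dividesᶻ) public
  open import Data.Integer.DivMod using (_%ℕ_; _/ℕ_; n%ℕd<d; a≡a%ℕn+[a/ℕn]*n) public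
  import Data.Integer.Properties
  module ℤP = Data.Integer.Properties
  open import Data.Integer.Tactic.RingSolver using () renaming (solve-∀ to ℤ-solve) public
  open import Data.List using (List; []; _∷_; _++_; length; concat; map; take; drop) public
  open import Data.List.Membership.Propositional using (_∈_; find; lose) public
  open import Data.List.Membership.Propositional.Properties using (∈-∃++) public
  open import Data.List.Properties using (length-++; length-map; length-take; take++drop≡id) renaming (++-assoc to List-++-assoc) public
  open import Data.List.Relation.Binary.Permutation.Propositional using (_↭_; refl; prep; swap; ↭-sym; ↭-refl; ↭-trans) public
  open import Data.List.Relation.Binary.Permutation.Propositional.Properties using (shift; shifts; ∈-resp-↭; All-resp-↭; ↭-length; ++-comm; ++⁺ʳ; ++⁺ˡ; ++-assoc) public
  open import Data.List.Relation.Binary.Sublist.Propositional using (_⊆_; []; _∷_; _∷ʳ_) public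
  open import Data.List.Relation.Unary.All using (All; []; _∷_) public
  open import Data.List.Relation.Unary.All.Properties using (++⁻ˡ; ++⁻ʳ; ++⁺) public
  open import Data.List.Relation.Unary.Any using (here; there; any?) public
  open import Data.Nat public
  open import Data.Nat.Coprimality using (coprime-Bézout; prime⇒coprime) public
  open import Data.Nat.DivMod public
  open import Data.Nat.GCD using (module Bézout) public
  open import Data.Nat.Primality using (Prime; prime⇒nonZero; prime⇒nonTrivial) public
  open import Data.Nat.Properties public
  open import Data.Nat.Tactic.RingSolver using () renaming (solve-∀ to ℕ-solve) public
  open import Data.Product using (Σ; ∃; ∃₂; _×_; _,_; proj₁; proj₂; map₁; map₂) public
  open import Data.Sum using (_⊎_; inj₁; inj₂) public
  open import Data.Unit using (⊤; tt) public
  open import Function using (_∘_) public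
  open import Relation.Binary.PropositionalEquality public
  open import Relation.Nullary public
  open import Relation.Nullary.Decidable using (map′; dec-true; dec-false; ¬?; _×-dec_) public

-- Finite sums, indicator values and the constants of the growth argument.

module Counting where
  open Prelude public

  -- A linear inequality by certificate: `X ≤ Y` collects the hypotheses with their weights, `s` is
  -- the slack, and the identity can be left to the ring solver.
  by-≤ : ∀ {X Y} L R s → X ≤ Y → L + Y + s ≡ R + X → L ≤ R
  by-≤ {X} {Y} L R s h e = +-cancelʳ-≤ Y L R (begin
    L + Y  ≤⟨ m≤m+n (L + Y) s ⟩
    L + Y + s  ≡⟨ e ⟩
    R + X  ≤⟨ +-monoʳ-≤ R h ⟩
    R + Y  ∎)
    where open ≤-Reasoning

  Σ< : ℕ → (ℕ → ℕ) → ℕ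
  Σ< zero    f = 0
  Σ< (suc n) f = f n + Σ< n f

  Σ<-cong : ∀ n {f g} → (∀ i → i < n → f i ≡ g i) → Σ< n f ≡ Σ< n g
  Σ<-cong zero    h = refl
  Σ<-cong (suc n) h = cong₂ _+_ (h n (n<1+n n)) (Σ<-cong n λ i i<n → h i (m<n⇒m<1+n i<n))

  Σ<-mono : ∀ n {f g} → (∀ i → i < n → f i ≤ g i) → Σ< n f ≤ Σ< n g
  Σ<-mono zero    h = z≤n
  Σ<-mono (suc n) h = +-mono-≤ (h n (n<1+n n)) (Σ<-mono n λ i i<n → h i (m<n⇒m<1+n i<n))

  Σ<-extend : ∀ {m n} f → m ≤ n → Σ< m f ≤ Σ< n f
  Σ<-extend {m} {n} f m≤n with m≤n⇒m<n∨m≡n m≤n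
  ... | inj₂ refl = ≤-refl
  Σ<-extend {m} {suc n} f m≤n | inj₁ (s≤s m≤n') = ≤-trans (Σ<-extend f m≤n') (m≤n+m (Σ< n f) (f n))

  +-interchange : ∀ a b c d → (a + b) + (c + d) ≡ (a + c) + (b + d)
  +-interchange = ℕ-solve

  Σ<-+ : ∀ n f g → Σ< n (λ i → f i + g i) ≡ Σ< n f + Σ< n g
  Σ<-+ zero    f g = refl
  Σ<-+ (suc n) f g = trans (cong (λ t → f n + g n + t) (Σ<-+ n f g)) (+-interchange (f n) (g n) _ _)

  Σ<-* : ∀ n c f → Σ< n (λ i → c * f i) ≡ c * Σ< n f
  Σ<-* zero    c f = sym (*-zeroʳ c)
  Σ<-* (suc n) c f = trans (cong (λ t → c * f n + t) (Σ<-* n c f)) (sym (*-distribˡ-+ c (f n) _))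

  Σ<-const : ∀ n c → Σ< n (λ _ → c) ≡ n * c
  Σ<-const zero    c = refl
  Σ<-const (suc n) c = cong (λ t → c + t) (Σ<-const n c)

  Σ<-head : ∀ n f → Σ< (suc n) f ≡ f 0 + Σ< n (f ∘ suc)
  Σ<-head zero    f = refl
  Σ<-head (suc n) f = trans (cong (λ t → f (suc n) + t) (Σ<-head n f)) (lemma (f (suc n)) (f 0) _)
    where
    lemma : ∀ a b c → a + (b + c) ≡ b + (a + c)
    lemma = ℕ-solve

  -- What an iterated sum must satisfy to be exchanged with `Σ<`; sums over one and over two
  -- residues are the instances.
  record IsSum {X : Set} (T : (X → ℕ) → ℕ) : Set where
    field
      T-cong : ∀ {f g} → (∀ x → f x ≡ g x) → T f ≡ T g
      T-zero : T (λ _ → 0) ≡ 0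
      T-+    : ∀ f g → T (λ x → f x + g x) ≡ T f + T g

    Σ<-swap : ∀ n (F : ℕ → X → ℕ) → Σ< n (λ i → T (F i)) ≡ T (λ x → Σ< n (λ i → F i x))
    Σ<-swap zero    F = sym T-zero
    Σ<-swap (suc n) F = trans (cong (λ t → T (F n) + t) (Σ<-swap n F)) (sym (T-+ (F n) _))

  ⟦_⟧ : Bool → ℕ
  ⟦ false ⟧ = 0
  ⟦ true  ⟧ = 1

  ⟦⟧≤1 : ∀ b → ⟦ b ⟧ ≤ 1
  ⟦⟧≤1 false = z≤n
  ⟦⟧≤1 true  = ≤-refl

  ⟦⟧-mono : ∀ {a b} → (a ≡ true → b ≡ true) → ⟦ a ⟧ ≤ ⟦ b ⟧
  ⟦⟧-mono {false} h = z≤n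
  ⟦⟧-mono {true}  h = ≤-reflexive (cong ⟦_⟧ (sym (h refl)))

  ⟦⟧-positive : ∀ b → 0 < ⟦ b ⟧ → b ≡ true
  ⟦⟧-positive true _ = refl

  ∧-split : ∀ a b → a ∧ b ≡ true → a ≡ true × b ≡ true
  ∧-split true true h = refl , refl

  ⟦∨⟧+⟦∧⟧ : ∀ a b → ⟦ a ∨ b ⟧ + ⟦ a ∧ b ⟧ ≡ ⟦ a ⟧ + ⟦ b ⟧
  ⟦∨⟧+⟦∧⟧ false b = +-identityʳ ⟦ b ⟧
  ⟦∨⟧+⟦∧⟧ true  b = refl

  ⟦∨⟧ : ∀ a b → ⟦ a ∨ b ⟧ ≡ ⟦ b ⟧ + ⟦ a ∧ not b ⟧
  ⟦∨⟧ false b     = sym (+-identityʳ ⟦ b ⟧)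
  ⟦∨⟧ true  false = refl
  ⟦∨⟧ true  true  = refl

  ⟦∧not⟧ : ∀ a b → ⟦ a ∧ not b ⟧ + ⟦ a ∧ b ⟧ ≡ ⟦ a ⟧
  ⟦∧not⟧ false b     = refl
  ⟦∧not⟧ true  false = refl
  ⟦∧not⟧ true  true  = refl

  ⟦∧⟧ : ∀ a b → ⟦ a ∧ b ⟧ ≡ ⟦ a ⟧ * ⟦ b ⟧
  ⟦∧⟧ false b = refl
  ⟦∧⟧ true  b = sym (*-identityˡ ⟦ b ⟧)

  -- a point of Y that leaves Y in the step g + h leaves it in the step g or in the step h
  ⟦∧not⟧-triangle : ∀ a b c → ⟦ a ∧ not c ⟧ ≤ ⟦ a ∧ not b ⟧ + ⟦ b ∧ not c ⟧
  ⟦∧not⟧-triangle false b     c = z≤n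
  ⟦∧not⟧-triangle true  false c = ≤-trans (⟦⟧≤1 (not c)) (s≤s z≤n)
  ⟦∧not⟧-triangle true  true  c = ≤-refl

  -- The invariant t² ≤ H |Y| of the first growth phase is preserved for every H ≥ 200.
  opaque
    H : ℕ
    H = 256
    200≤H : 200 ≤ H
    200≤H = m≤m+n 200 56
    H≢0 : NonZero H
    H≢0 = _

  -- Write Γ = 4 H n² and B = 14 Γ n. A set of size c ≥ p²/Γ whose best gain is at least B c / (14
  -- p) gains at least n p.
  growth-constant : ℕ → ℕ
  growth-constant n = 14 * (4 * H * n * n) * n

  -- The number Q² R of pigeonhole keys in `spread`, for Q = (2B + 1) B and R = (2B + 1) B².
  key-count : ℕ → ℕ
  key-count B = (suc (2 * B) * B) * (suc (2 * B) * B) * (suc (2 * B) * B * B)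

-- Counting, pairs and choices in lists that stand for multisets.

module Lists where
  open Counting public

  private variable
    E : Set

  count : (E → Bool) → List E → ℕ
  count f []       = 0
  count f (e ∷ es) = ⟦ f e ⟧ + count f es

  count-++ : ∀ (f : E → Bool) xs ys → count f (xs ++ ys) ≡ count f xs + count f ys
  count-++ f []       ys = refl
  count-++ f (x ∷ xs) ys = trans (cong (λ t → ⟦ f x ⟧ + t) (count-++ f xs ys)) (sym (+-assoc ⟦ f x ⟧ _ _))

  count-↭ : ∀ (f : E → Bool) {xs ys} → xs ↭ ys → count f xs ≡ count f ys
  count-↭ f refl          = refl
  count-↭ f (prep x p)    = cong (λ t → ⟦ f x ⟧ + t) (count-↭ f p)
  count-↭ f (swap x y p)  = trans (cong (λ t → ⟦ f x ⟧ + (⟦ f y ⟧ + t)) (count-↭ f p)) (exchange ⟦ f x ⟧ ⟦ f y ⟧ _)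
    where
    exchange : ∀ a b c → a + (b + c) ≡ b + (a + c)
    exchange a b c = trans (sym (+-assoc a b c)) (trans (cong (_+ c) (+-comm a b)) (+-assoc b a c))
  count-↭ f (_↭_.trans p q) = trans (count-↭ f p) (count-↭ f q)

  count-mono : ∀ {f g : E → Bool} xs → (∀ e → f e ≡ true → g e ≡ true) → count f xs ≤ count g xs
  count-mono []       h = z≤n
  count-mono (x ∷ xs) h = +-mono-≤ (⟦⟧-mono (h x)) (count-mono xs h)

  count-++ʳ : ∀ (f : E → Bool) {xs ys zs} → xs ↭ ys ++ zs → count f zs ≤ count f xs
  count-++ʳ f {xs} {ys} {zs} p = ≤-trans (m≤n+m (count f zs) (count f ys)) (≤-reflexive (sym (trans (count-↭ f p) (count-++ f ys zs))))

  select : (E → Bool) → List E → List E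
  select f []       = []
  select f (e ∷ es) = if f e then e ∷ select f es else select f es

  length-select : ∀ (f : E → Bool) es → length (select f es) ≡ count f es
  length-select f []       = refl
  length-select f (e ∷ es) with f e
  ... | true  = cong suc (length-select f es)
  ... | false = length-select f es

  length-count : ∀ (f : E → Bool) es → count (not ∘ f) es + count f es ≡ length es
  length-count f []       = refl
  length-count f (e ∷ es) with f e
  ... | true  = trans (+-suc _ _) (cong suc (length-count f es))
  ... | false = cong suc (length-count f es)

  select-↭ : ∀ (f : E → Bool) es → es ↭ select f es ++ select (not ∘ f) es
  select-↭ f []       = refl
  select-↭ f (e ∷ es) with f e
  ... | true  = prep e (select-↭ f es)
  ... | false = _↭_.trans (prep e (select-↭ f es)) (↭-sym (shift e (select f es) (select (not ∘ f) es)))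

  ∈-select : ∀ (f : E → Bool) es {e} → e ∈ select f es → f e ≡ true × e ∈ es
  ∈-select f (x ∷ es) e∈ with f x in eq
  ∈-select f (x ∷ es) (here refl) | true  = eq , here refl
  ∈-select f (x ∷ es) (there e∈)  | true  = map₂ there (∈-select f es e∈)
  ∈-select f (x ∷ es) e∈          | false = map₂ there (∈-select f es e∈)

  count-select : ∀ (f g : E → Bool) es → count g (select f es) ≤ count g es
  count-select f g es = ≤-trans (m≤m+n _ _) (≤-reflexive (sym (trans (count-↭ g (select-↭ f es)) (count-++ g (select f es) _))))

  not-true : ∀ {b} → not b ≡ true → b ≡ false
  not-true {false} _ = refl

  ∃-false : ∀ (f : E → Bool) es → count f es < length es → ∃ λ e → e ∈ es × f e ≡ false
  ∃-false f (e ∷ es) h with f e in eq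
  ... | false = e , here refl , eq
  ... | true  = map₂ (map₁ there) (∃-false f es (≤-pred h))

  ∃-true : ∀ (f : E → Bool) es → 1 ≤ count f es → ∃ λ e → e ∈ es × f e ≡ true
  ∃-true f (e ∷ es) h with f e in eq
  ... | true  = e , here refl , eq
  ... | false = map₂ (map₁ there) (∃-true f es h)

  -- Greedy choice: each chosen element rules out at most `β` entries, so more than `N * β` entries
  -- leave room for `suc N` choices.
  independent : ∀ (bad : E → E → Bool) → (∀ a b → bad a b ≡ bad b a) → ∀ β N es → (∀ e → count (bad e) es ≤ β) → N * β < length es →
                Σ (Fin (suc N) → E) λ f → (∀ i → f i ∈ es) × (∀ i j → i ≢ j → bad (f i) (f j) ≡ false)
  independent bad bad-sym β zero    (e ∷ es) h l = (λ _ → e) , (λ _ → here refl) , λ { zero zero i≢j → ⊥-elim (i≢j refl) }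
  independent bad bad-sym β (suc N) es@(e ∷ _) h l
    with independent bad bad-sym β N (select (not ∘ bad e) es) (λ e' → ≤-trans (count-select (not ∘ bad e) (bad e') es) (h e')) long
    where
    long : N * β < length (select (not ∘ bad e) es)
    long = +-cancelˡ-< β (N * β) _ (<-≤-trans l (≤-trans (≤-reflexive (sym (length-count (bad e) es)))
      (≤-trans (≤-reflexive (+-comm (count (not ∘ bad e) es) (count (bad e) es))) (+-mono-≤ (h e) (≤-reflexive (sym (length-select (not ∘ bad e) es)))))))
  ... | f , f∈ , f-good = g , g∈ , g-good
    where
    g : Fin (suc (suc N)) → _
    g zero    = e
    g (suc i) = f i
    g∈ : ∀ i → g i ∈ es
    g∈ zero    = here refl
    g∈ (suc i) = proj₂ (∈-select (not ∘ bad e) es (f∈ i))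
    good-e : ∀ i → bad e (f i) ≡ false
    good-e i = not-true (proj₁ (∈-select (not ∘ bad e) es (f∈ i)))
    g-good : ∀ i j → i ≢ j → bad (g i) (g j) ≡ false
    g-good zero    zero    i≢j = ⊥-elim (i≢j refl)
    g-good zero    (suc j) i≢j = good-e j
    g-good (suc i) zero    i≢j = trans (bad-sym (f i) e) (good-e i)
    g-good (suc i) (suc j) i≢j = f-good i j (i≢j ∘ cong suc)

  ∈⇒↭ : ∀ {e : E} {es} → e ∈ es → ∃ λ es' → es ↭ e ∷ es'
  ∈⇒↭ {e = e} e∈ with ∈-∃++ e∈
  ... | xs , ys , refl = xs ++ ys , shift e xs ys

  ∈²⇒↭ : ∀ {a b : E} {es} → a ∈ es → b ∈ es → a ≢ b → ∃ λ es' → es ↭ a ∷ b ∷ es'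
  ∈²⇒↭ a∈ b∈ a≢b with ∈⇒↭ a∈
  ... | es₁ , p with ∈-resp-↭ p b∈
  ... | here b≡a = ⊥-elim (a≢b (sym b≡a))
  ... | there b∈' with ∈⇒↭ b∈'
  ... | es₂ , q = es₂ , _↭_.trans p (prep _ q)

  -- The maximum is sought downwards from the a priori bound `U`. A positive value forces `a ≢ b`,
  -- since `f` vanishes on the diagonal, so both can be removed from the list as separate entries.
  best-pair : ∀ (f : E → E → ℕ) → (∀ e → f e e ≡ 0) → ∀ U es → (∀ a b → a ∈ es → b ∈ es → f a b ≤ U) →
              (∃ λ a → ∃ λ b → ∃ λ es' → es ↭ a ∷ b ∷ es' × (∀ c d → c ∈ es → d ∈ es → f c d ≤ f a b)) ⊎ (∀ a b → a ∈ es → b ∈ es → f a b ≤ 0)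
  best-pair f f≡0 zero    es h = inj₂ h
  best-pair f f≡0 (suc U) es h with any? (λ a → any? (λ b → suc U ≤? f a b) es) es
  ... | no  none = best-pair f f≡0 U es λ a b a∈ b∈ → ≤-pred (≰⇒> λ le → none (lose a∈ (lose b∈ le)))
  ... | yes some with find some
  ... | a , a∈ , some' with find some'
  ... | b , b∈ , big with ∈²⇒↭ a∈ b∈ (λ { refl → <⇒≢ (≤-trans (s≤s z≤n) big) (sym (f≡0 a)) })
  ... | es' , p = inj₁ (a , b , es' , p , λ c d c∈ d∈ → ≤-trans (h c d c∈ d∈) big)

  flat : List (E × E) → List E
  flat []             = []
  flat ((a , b) ∷ ps) = a ∷ b ∷ flat ps

  flat-++ : ∀ (ps qs : List (E × E)) → flat (ps ++ qs) ≡ flat ps ++ flat qs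
  flat-++ []             qs = refl
  flat-++ ((a , b) ∷ ps) qs = cong (λ t → a ∷ b ∷ t) (flat-++ ps qs)

  length-flat : ∀ (ps : List (E × E)) → length (flat ps) ≡ 2 * length ps
  length-flat []       = refl
  length-flat (_ ∷ ps) = trans (cong (λ t → 2 + t) (length-flat ps)) (sym (*-suc 2 (length ps)))

  data Choice {E : Set} : List (E × E) → List E → Set where
    []    : Choice [] []
    left  : ∀ {a b ps c} → Choice ps c → Choice ((a , b) ∷ ps) (a ∷ c)
    right : ∀ {a b ps c} → Choice ps c → Choice ((a , b) ∷ ps) (b ∷ c)

  length-choice : ∀ {ps : List (E × E)} {c} → Choice ps c → length c ≡ length ps
  length-choice []        = refl
  length-choice (left h)  = cong suc (length-choice h)
  length-choice (right h) = cong suc (length-choice h)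

  choice-++ : ∀ {ps qs : List (E × E)} {c d} → Choice ps c → Choice qs d → Choice (ps ++ qs) (c ++ d)
  choice-++ []        k = k
  choice-++ (left h)  k = left (choice-++ h k)
  choice-++ (right h) k = right (choice-++ h k)

  choice-↭ : ∀ {ps : List (E × E)} {c} → Choice ps c → ∃ λ c' → flat ps ↭ c ++ c'
  choice-↭ []  = [] , refl
  choice-↭ {ps = (a , b) ∷ ps} {c = _ ∷ c} (left h) with choice-↭ h
  ... | c' , p = b ∷ c' , prep a (_↭_.trans (prep b p) (↭-sym (shift b c c')))
  choice-↭ {ps = (a , b) ∷ ps} {c = _ ∷ c} (right h) with choice-↭ h
  ... | c' , p = a ∷ c' , _↭_.trans (swap a b p) (prep b (↭-sym (shift a c c')))

  -- The theorem asks for a sublist, which depends on the order of `A`, while the argument works up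
  -- to permutation; this carries the result back.
  ⊆-resp-↭ : ∀ {xs ys zs : List E} → xs ↭ ys → zs ⊆ ys → ∃ λ ws → ws ⊆ xs × ws ↭ zs
  ⊆-resp-↭ refl h = _ , h , refl
  ⊆-resp-↭ (prep x p) (_ ∷ʳ h) with ⊆-resp-↭ p h
  ... | ws , k , q = ws , x ∷ʳ k , q
  ⊆-resp-↭ (prep x p) (refl ∷ h) with ⊆-resp-↭ p h
  ... | ws , k , q = x ∷ ws , refl ∷ k , prep x q
  ⊆-resp-↭ (swap x y p) (_ ∷ʳ (_ ∷ʳ h)) with ⊆-resp-↭ p h
  ... | ws , k , q = ws , x ∷ʳ (y ∷ʳ k) , q
  ⊆-resp-↭ (swap x y p) (_ ∷ʳ (refl ∷ h)) with ⊆-resp-↭ p h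
  ... | ws , k , q = x ∷ ws , refl ∷ (y ∷ʳ k) , prep x q
  ⊆-resp-↭ (swap x y p) (refl ∷ (_ ∷ʳ h)) with ⊆-resp-↭ p h
  ... | ws , k , q = y ∷ ws , x ∷ʳ (refl ∷ k) , prep y q
  ⊆-resp-↭ (swap x y p) (refl ∷ (refl ∷ h)) with ⊆-resp-↭ p h
  ... | ws , k , q = x ∷ y ∷ ws , refl ∷ (refl ∷ k) , swap x y q
  ⊆-resp-↭ (_↭_.trans p q) h with ⊆-resp-↭ q h
  ... | ws , k , r with ⊆-resp-↭ p k
  ... | vs , k' , r' = vs , k' , _↭_.trans r' r

  prefix-⊆ : ∀ (xs ys : List E) → xs ⊆ xs ++ ys
  prefix-⊆ []       []       = []
  prefix-⊆ []       (y ∷ ys) = y ∷ʳ prefix-⊆ [] ys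
  prefix-⊆ (x ∷ xs) ys       = refl ∷ prefix-⊆ xs ys

  split-⊆ : ∀ {zs : List E} xs {ys} → zs ⊆ xs ++ ys → ∃₂ λ us vs → zs ≡ us ++ vs × us ⊆ xs × vs ⊆ ys
  split-⊆ []       h = [] , _ , refl , [] , h
  split-⊆ (x ∷ xs) (_ ∷ʳ h) with split-⊆ xs h
  ... | us , vs , refl , k , l = us , vs , refl , x ∷ʳ k , l
  split-⊆ (x ∷ xs) (refl ∷ h) with split-⊆ xs h
  ... | us , vs , refl , k , l = x ∷ us , vs , refl , refl ∷ k , l

-- Congruence modulo p, and sums over one or two residues.

module Residues (p : ℕ) (pr : Prime p) where
  open Lists

  instance
    p-nonZero : NonZero p
    p-nonZero = prime⇒nonZero pr

  infix 4 _≋_ _≋?_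

  record _≋_ (x y : ℤ) : Set where
    constructor mk≋
    field
      quot : ℤ
      diff : x -' y ≡ quot *' + p

  private
    ring-diff : ∀ q x P → (x +' q *' P) -' x ≡ q *' P
    ring-diff = ℤ-solve

  -- The standard way to derive a congruence here: the difference is written as an integer
  -- combination of differences already known to be multiples of p, an identity for the ring solver.
  lin₁ : ∀ {x y u v} c → u ≋ v → x -' y ≡ c *' (u -' v) → x ≋ y
  lin₁ c (mk≋ k e) h = mk≋ (c *' k) (trans h (trans (cong (c *'_) e) (sym (ℤP.*-assoc c k (+ p)))))

  lin₂ : ∀ {x y u v u' v'} c c' → u ≋ v → u' ≋ v' →
         x -' y ≡ c *' (u -' v) +' c' *' (u' -' v') → x ≋ y
  lin₂ c c' (mk≋ k e) (mk≋ k' e') h = mk≋ (c *' k +' c' *' k')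
    (trans h (trans (cong₂ (λ a b → c *' a +' c' *' b) e e') (ring c c' k k' (+ p))))
    where
    ring : ∀ c c' k k' P → c *' (k *' P) +' c' *' (k' *' P) ≡ (c *' k +' c' *' k') *' P
    ring = ℤ-solve

  ≋-refl : ∀ {x} → x ≋ x
  ≋-refl {x} = mk≋ 0ℤ (trans (ℤP.+-inverseʳ x) (sym (ℤP.*-zeroˡ (+ p))))

  ≋-reflexive : ∀ {x y} → x ≡ y → x ≋ y
  ≋-reflexive refl = ≋-refl

  ≋-sym : ∀ {x y} → x ≋ y → y ≋ x
  ≋-sym {x} {y} h = lin₁ (-' 1ℤ) h (ring x y)
    where
    ring : ∀ x y → y -' x ≡ (-' 1ℤ) *' (x -' y)
    ring = ℤ-solve

  ≋-trans : ∀ {x y z} → x ≋ y → y ≋ z → x ≋ z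
  ≋-trans {x} {y} {z} h k = lin₂ 1ℤ 1ℤ h k (ring x y z)
    where
    ring : ∀ x y z → x -' z ≡ 1ℤ *' (x -' y) +' 1ℤ *' (y -' z)
    ring = ℤ-solve

  +-≋ : ∀ {x x' y y'} → x ≋ x' → y ≋ y' → x +' y ≋ x' +' y'
  +-≋ {x} {x'} {y} {y'} h k = lin₂ 1ℤ 1ℤ h k (ring x x' y y')
    where
    ring : ∀ x x' y y' → (x +' y) -' (x' +' y') ≡ 1ℤ *' (x -' x') +' 1ℤ *' (y -' y')
    ring = ℤ-solve

  *-≋ˡ : ∀ c {x x'} → x ≋ x' → c *' x ≋ c *' x'
  *-≋ˡ c {x} {x'} h = lin₁ c h (ring c x x')
    where
    ring : ∀ c x x' → c *' x -' c *' x' ≡ c *' (x -' x')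
    ring = ℤ-solve

  neg-≋ : ∀ {x x'} → x ≋ x' → -' x ≋ -' x'
  neg-≋ {x} {x'} h = lin₁ (-' 1ℤ) h (ring x x')
    where
    ring : ∀ x x' → (-' x) -' (-' x') ≡ (-' 1ℤ) *' (x -' x')
    ring = ℤ-solve

  sub-≋ : ∀ {x x' y y'} → x ≋ x' → y ≋ y' → x -' y ≋ x' -' y'
  sub-≋ h k = +-≋ h (neg-≋ k)

  abstract
    _≋?_ : ∀ x y → Dec (x ≋ y)
    x ≋? y = map′ (λ { (dividesᶻ q e) → mk≋ q e }) (λ { (mk≋ q e) → dividesᶻ q e }) (+ p ∣? (x -' y))

  ≋⇒≡ : ∀ {i j} → i < p → j < p → + i ≋ + j → i ≡ j
  ≋⇒≡ {i} {j} i<p j<p (mk≋ k e) = ℤP.+-injective (ℤP.i-j≡0⇒i≡j (+ i) (+ j) (ℤP.∣i∣≡0⇒i≡0 (zero-of ∣ k ∣ eq)))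
    where
    eq : ∣ + i -' + j ∣ ≡ ∣ k ∣ * p
    eq = trans (cong ∣_∣ e) (ℤP.abs-* k (+ p))
    small : ∣ + i -' + j ∣ < p
    small = ≤-<-trans (≤-trans (≤-reflexive (cong ∣_∣ (ℤP.m-n≡m⊖n i j))) (ℤP.∣m⊝n∣≤m⊔n i j)) (⊔-lub-< i<p j<p)
      where
      ⊔-lub-< : ∀ {a b c} → a < c → b < c → a ⊔ b < c
      ⊔-lub-< = ⊔-pres-<m
    zero-of : ∀ q → ∣ + i -' + j ∣ ≡ q * p → ∣ + i -' + j ∣ ≡ 0
    zero-of zero    h = h
    zero-of (suc q) h = ⊥-elim (<⇒≱ small (≤-trans (m≤m+n p (q * p)) (≤-reflexive (sym h))))

  pos-euclid : ∀ {n} q r d → n ≡ r + q * d → + n ≡ + r +' + q *' + d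
  pos-euclid q r d e = trans (cong +_ e) (trans (ℤP.pos-+ r (q * d)) (cong (+ r +'_) (ℤP.pos-* q d)))

  abstract
    rep : ℤ → ℕ
    rep x = x %ℕ p

    rep<p : ∀ x → rep x < p
    rep<p x = n%ℕd<d x p

    rep≋ : ∀ x → + rep x ≋ x
    rep≋ x = ≋-sym (mk≋ (x /ℕ p) (trans (cong (_-' + rep x) (a≡a%ℕn+[a/ℕn]*n x p)) (ring-diff (x /ℕ p) (+ rep x) (+ p))))

  1<p : 1 < p
  1<p = nonTrivial⇒n>1 p {{prime⇒nonTrivial pr}}

  p≋0 : + p ≋ 0ℤ
  p≋0 = mk≋ 1ℤ (ring (+ p))
    where
    ring : ∀ P → P -' 0ℤ ≡ 1ℤ *' P
    ring = ℤ-solve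

  pos-1+* : ∀ {a b c d} → 1 + a * b ≡ c * d → 1ℤ +' + a *' + b ≡ + c *' + d
  pos-1+* {a} {b} {c} {d} eq = trans (cong (1ℤ +'_) (sym (ℤP.pos-* a b))) (trans (cong +_ eq) (ℤP.pos-* c d))

  ≋-inverse : ∀ a → ¬ (a ≋ 0ℤ) → ∃ λ i → i *' a ≋ 1ℤ
  ≋-inverse a a≢0 with rep a | rep≋ a | rep<p a
  ... | zero      | r≋ | _   = ⊥-elim (a≢0 (≋-sym r≋))
  ... | r@(suc _) | r≋ | r<p with coprime-Bézout (prime⇒coprime pr r<p)
  ... | Bézout.+- x y eq = -' (+ y) , lin₂ (-' (+ y)) (-' (+ x)) (≋-sym r≋) p≋0
    (trans (ring₁ a (+ r) (+ y)) (trans (cong (λ t → (-' (+ y)) *' (a -' + r) -' t) (pos-1+* {y} {r} {x} {p} eq))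
      (ring₂ a (+ r) (+ y) (+ x) (+ p))))
    where
    ring₁ : ∀ a r y → (-' y) *' a -' 1ℤ ≡ (-' y) *' (a -' r) -' (1ℤ +' y *' r)
    ring₁ = ℤ-solve
    ring₂ : ∀ a r y x P → (-' y) *' (a -' r) -' x *' P ≡ (-' y) *' (a -' r) +' (-' x) *' (P -' 0ℤ)
    ring₂ = ℤ-solve
  ... | Bézout.-+ x y eq = + y , lin₂ (+ y) (+ x) (≋-sym r≋) p≋0
    (trans (ring₁ a (+ r) (+ y)) (trans (cong (λ t → + y *' (a -' + r) +' (t -' 1ℤ)) (sym (pos-1+* {x} {p} {y} {r} eq)))
      (ring₂ a (+ r) (+ y) (+ x) (+ p))))
    where
    ring₁ : ∀ a r y → y *' a -' 1ℤ ≡ y *' (a -' r) +' (y *' r -' 1ℤ)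
    ring₁ = ℤ-solve
    ring₂ : ∀ a r y x P → y *' (a -' r) +' ((1ℤ +' x *' P) -' 1ℤ) ≡ y *' (a -' r) +' x *' (P -' 0ℤ)
    ring₂ = ℤ-solve

  ≋-cancel : ∀ {a b} → ¬ (a ≋ 0ℤ) → a *' b ≋ 0ℤ → b ≋ 0ℤ
  ≋-cancel {a} {b} a≢0 ab≋0 with ≋-inverse a a≢0
  ... | i , ia≋1 = lin₂ (-' b) i ia≋1 ab≋0 (ring a b i)
    where
    ring : ∀ a b i → b -' 0ℤ ≡ (-' b) *' (i *' a -' 1ℤ) +' i *' (a *' b -' 0ℤ)
    ring = ℤ-solve

  Periodic : (ℤ → ℕ) → Set
  Periodic f = ∀ {x y} → x ≋ y → f x ≡ f y

  S₁ : (ℤ → ℕ) → ℕ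
  S₁ f = Σ< p (λ i → f (+ i))

  S₁-isSum : IsSum S₁
  S₁-isSum = record
    { T-cong = λ h → Σ<-cong p (λ i _ → h (+ i))
    ; T-zero = trans (Σ<-const p 0) (*-zeroʳ p)
    ; T-+    = λ f g → Σ<-+ p (λ i → f (+ i)) (λ i → g (+ i)) }

  S₁-mono : ∀ {f g} → (∀ x → f x ≤ g x) → S₁ f ≤ S₁ g
  S₁-mono h = Σ<-mono p (λ i _ → h (+ i))

  S₁-cong : ∀ {f g} → (∀ x → f x ≡ g x) → S₁ f ≡ S₁ g
  S₁-cong = IsSum.T-cong S₁-isSum

  private
    shift-1 : ∀ {f} → Periodic f → S₁ (λ x → f (x +' 1ℤ)) ≡ S₁ f
    shift-1 {f} per = +-cancelˡ-≡ (f 0ℤ) _ _ (begin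
      f 0ℤ + Σ< p (λ i → f (+ i +' 1ℤ))  ≡⟨ cong (λ t → f 0ℤ + t) (Σ<-cong p (λ i _ → cong (λ t → f (+ t)) (+-comm i 1))) ⟩
      f 0ℤ + Σ< p (λ i → f (+ suc i))  ≡⟨ sym (Σ<-head p (λ i → f (+ i))) ⟩
      f (+ p) + S₁ f  ≡⟨ cong (_+ S₁ f) (per p≋0) ⟩
      f 0ℤ + S₁ f ∎)
      where open ≡-Reasoning

    shift-+ : ∀ n {f} → Periodic f → S₁ (λ x → f (x +' + n)) ≡ S₁ f
    shift-+ zero    {f} per = S₁-cong λ x → cong f (ℤP.+-identityʳ x)
    shift-+ (suc n) {f} per = trans (S₁-cong λ x → cong f (trans (cong (x +'_) (ℤP.pos-+ 1 n)) (sym (ℤP.+-assoc x 1ℤ (+ n)))))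
      (trans (shift-1 {λ x → f (x +' + n)} (λ h → per (+-≋ h ≋-refl))) (shift-+ n per))

  S₁-shift : ∀ c {f} → Periodic f → S₁ (λ x → f (x +' c)) ≡ S₁ f
  S₁-shift c {f} per = trans (S₁-cong λ x → per (+-≋ (≋-refl {x}) (≋-sym (rep≋ c)))) (shift-+ (rep c) per)

  δ : ℤ → ℤ → Bool
  δ x y = does (x ≋? y)

  δ-⇔ : ∀ {x y x' y'} → (x ≋ y → x' ≋ y') → (x' ≋ y' → x ≋ y) → δ x y ≡ δ x' y'
  δ-⇔ {x} {y} {x'} {y'} f g with x ≋? y
  ... | yes h = sym (dec-true (x' ≋? y') (f h))
  ... | no  h = sym (dec-false (x' ≋? y') (h ∘ g))

  δ∧δ-⇔ : ∀ {x y z w x' y' z' w'} → (x ≋ y → z ≋ w → x' ≋ y' × z' ≋ w') → (x' ≋ y' → z' ≋ w' → x ≋ y × z ≋ w) →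
          δ x y ∧ δ z w ≡ δ x' y' ∧ δ z' w'
  δ∧δ-⇔ {x} {y} {z} {w} {x'} {y'} {z'} {w'} f g with x ≋? y | z ≋? w | x' ≋? y' | z' ≋? w'
  ... | yes h | yes k | no ¬h | _     = ⊥-elim (¬h (proj₁ (f h k)))
  ... | yes h | yes k | yes _ | no ¬k = ⊥-elim (¬k (proj₂ (f h k)))
  ... | yes _ | yes _ | yes _ | yes _ = refl
  ... | no ¬h | _     | yes h | yes k = ⊥-elim (¬h (proj₁ (g h k)))
  ... | yes _ | no ¬k | yes h | yes k = ⊥-elim (¬k (proj₂ (g h k)))
  ... | no _  | _     | no _  | _     = refl
  ... | no _  | _     | yes _ | no _  = refl
  ... | yes _ | no _  | no _  | _     = refl
  ... | yes _ | no _  | yes _ | no _  = refl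

  δ-≋ˡ : ∀ {x y c} → x ≋ y → δ x c ≡ δ y c
  δ-≋ˡ h = δ-⇔ (≋-trans (≋-sym h)) (≋-trans h)

  δ-sound : ∀ {x y} → δ x y ≡ true → x ≋ y
  δ-sound {x} {y} h with yes k ← x ≋? y = k

  δ-true : ∀ {x y} → x ≋ y → δ x y ≡ true
  δ-true {x} {y} h = dec-true (x ≋? y) h

  δ-false : ∀ {x y} → ¬ x ≋ y → δ x y ≡ false
  δ-false {x} {y} h = dec-false (x ≋? y) h

  -- `c` need not be one of the representatives over which `S₁` runs, so a translation first moves
  -- the only nonzero term to index 0.
  S₁-δ : ∀ c {f} → Periodic f → S₁ (λ x → ⟦ δ x c ⟧ * f x) ≡ f c
  S₁-δ c {f} per = begin
    S₁ g  ≡⟨ sym (S₁-shift c g-per) ⟩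
    S₁ (λ x → g (x +' c))  ≡⟨ at-zero p (λ i i<p → vanish i i<p) ⟩
    g (0ℤ +' c)  ≡⟨ cong (λ b → ⟦ b ⟧ * f (0ℤ +' c)) (δ-true (≋-reflexive (ℤP.+-identityˡ c))) ⟩
    1 * f (0ℤ +' c)  ≡⟨ *-identityˡ _ ⟩
    f (0ℤ +' c)  ≡⟨ cong f (ℤP.+-identityˡ c) ⟩
    f c ∎
    where
    open ≡-Reasoning
    g : ℤ → ℕ
    g x = ⟦ δ x c ⟧ * f x
    g-per : Periodic g
    g-per h = cong₂ (λ b t → ⟦ b ⟧ * t) (δ-≋ˡ h) (per h)
    vanish : ∀ i → i < p → i ≢ 0 → g (+ i +' c) ≡ 0
    vanish i i<p i≢0 = cong (λ b → ⟦ b ⟧ * f (+ i +' c)) (δ-false λ h →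
      i≢0 (≋⇒≡ i<p (>-nonZero⁻¹ p) (lin₁ 1ℤ h (ring (+ i) c))))
      where
      ring : ∀ i c → i -' 0ℤ ≡ 1ℤ *' ((i +' c) -' c)
      ring = ℤ-solve
    at-zero : ∀ n .{{_ : NonZero n}} {g : ℕ → ℕ} → (∀ i → i < n → i ≢ 0 → g i ≡ 0) → Σ< n g ≡ g 0
    at-zero (suc zero)        {g} h = +-identityʳ (g 0)
    at-zero (suc n@(suc _)) {g} h = trans (cong (λ t → t + Σ< n g) (h n (n<1+n n) (λ ()))) (at-zero n {g} λ i i<n → h i (m<n⇒m<1+n i<n))

  Periodic₂ : (ℤ → ℤ → ℕ) → Set
  Periodic₂ F = ∀ {x y x' y'} → x ≋ x' → y ≋ y' → F x y ≡ F x' y'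

  opaque
    S₂ : (ℤ → ℤ → ℕ) → ℕ
    S₂ F = S₁ λ x → S₁ λ y → F x y

    S₂-cong : ∀ {F G} → (∀ x y → F x y ≡ G x y) → S₂ F ≡ S₂ G
    S₂-cong h = S₁-cong λ x → S₁-cong (h x)

    S₂-mono : ∀ {F G} → (∀ x y → F x y ≤ G x y) → S₂ F ≤ S₂ G
    S₂-mono h = S₁-mono λ x → S₁-mono (h x)

    S₂-+ : ∀ F G → S₂ (λ x y → F x y + G x y) ≡ S₂ F + S₂ G
    S₂-+ F G = trans (S₁-cong λ x → IsSum.T-+ S₁-isSum (F x) (G x)) (IsSum.T-+ S₁-isSum (λ x → S₁ (F x)) (λ x → S₁ (G x)))

    S₂-isSum : IsSum {ℤ × ℤ} (λ F → S₂ (λ x y → F (x , y)))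
    S₂-isSum = record
      { T-cong = λ h → S₂-cong (λ x y → h (x , y))
      ; T-zero = trans (S₁-cong λ _ → IsSum.T-zero S₁-isSum) (IsSum.T-zero S₁-isSum)
      ; T-+    = λ F G → S₂-+ (λ x y → F (x , y)) (λ x y → G (x , y)) }

    S₂-* : ∀ c F → S₂ (λ x y → c * F x y) ≡ c * S₂ F
    S₂-* c F = trans (S₁-cong λ x → Σ<-* p c (λ i → F x (+ i))) (Σ<-* p c (λ i → S₁ (F (+ i))))

    S₂-shift : ∀ c d {F} → Periodic₂ F → S₂ (λ x y → F (x +' c) (y +' d)) ≡ S₂ F
    S₂-shift c d {F} per = trans (S₁-cong λ x → S₁-shift d {F (x +' c)} (per ≋-refl))
      (S₁-shift c {λ x → S₁ (F x)} (λ h → S₁-cong λ y → per h (≋-refl {y})))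

    S₂-box : ∀ {n} F → n ≤ p → Σ< n (λ i → Σ< n λ j → F (+ i) (+ j)) ≤ S₂ F
    S₂-box {n} F n≤p = ≤-trans (Σ<-mono n (λ i _ → Σ<-extend (λ j → F (+ i) (+ j)) n≤p)) (Σ<-extend (λ i → S₁ (F (+ i))) n≤p)

    S₂-product : ∀ f g → S₂ (λ x y → f x * g y) ≡ S₁ f * S₁ g
    S₂-product f g = trans (S₁-cong λ x → Σ<-* p (f x) (λ j → g (+ j)))
      (trans (S₁-cong λ x → *-comm (f x) (S₁ g)) (trans (Σ<-* p (S₁ g) (λ i → f (+ i))) (*-comm (S₁ g) (S₁ f))))

    -- `F` at the image point is a sum over (u , v) weighted by the kernel `K`. After the sums are
    -- exchanged, the inverse matrix turns `K` into the indicator of a single (x , y).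
    S₂-linear : ∀ {a b c d} → ¬ (a *' d -' b *' c ≋ 0ℤ) → ∀ {F} → Periodic₂ F →
                S₂ (λ x y → F (a *' x +' b *' y) (c *' x +' d *' y)) ≡ S₂ F
    S₂-linear {a} {b} {c} {d} det≢0 {F} per with ≋-inverse _ det≢0
    ... | i , iD≋1 = begin
      S₂ (λ x y → F (a *' x +' b *' y) (c *' x +' d *' y))
        ≡⟨ S₂-cong (λ x y → sym (point (a *' x +' b *' y) (c *' x +' d *' y))) ⟩
      S₂ (λ x y → S₂ λ u v → K x y u v * F u v)
        ≡⟨ swap₂ (λ x y u v → K x y u v * F u v) ⟩
      S₂ (λ u v → S₂ λ x y → K x y u v * F u v)
        ≡⟨ S₂-cong (λ u v → trans (S₂-cong λ x y → trans (cong (_* F u v) (K-inv x y u v)) (*-assoc ⟦ δ x (X u v) ⟧ _ _))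
            (trans (S₁-cong λ x → Σ<-* p ⟦ δ x (X u v) ⟧ (λ j → ⟦ δ (+ j) (Y u v) ⟧ * F u v))
            (trans (S₁-cong λ x → cong (⟦ δ x (X u v) ⟧ *_) (S₁-δ (Y u v) {λ _ → F u v} (λ _ → refl)))
              (S₁-δ (X u v) {λ _ → F u v} (λ _ → refl))))) ⟩
      S₂ F ∎
      where
      open ≡-Reasoning
      X Y : ℤ → ℤ → ℤ
      X u v = i *' (d *' u -' b *' v)
      Y u v = i *' (a *' v -' c *' u)
      K : ℤ → ℤ → ℤ → ℤ → ℕ
      K x y u v = ⟦ δ u (a *' x +' b *' y) ⟧ * ⟦ δ v (c *' x +' d *' y) ⟧
      point : ∀ s t → S₂ (λ u v → (⟦ δ u s ⟧ * ⟦ δ v t ⟧) * F u v) ≡ F s t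
      point s t = trans (S₁-cong λ u → trans (S₁-cong λ v → *-assoc ⟦ δ u s ⟧ ⟦ δ v t ⟧ (F u v))
          (trans (Σ<-* p ⟦ δ u s ⟧ (λ j → ⟦ δ (+ j) t ⟧ * F u (+ j))) (cong (⟦ δ u s ⟧ *_) (S₁-δ t {F u} (per ≋-refl)))))
        (S₁-δ s {λ u → F u t} (λ h → per h ≋-refl))
      swap₂ : ∀ (H : ℤ → ℤ → ℤ → ℤ → ℕ) → S₂ (λ x y → S₂ λ u v → H x y u v) ≡ S₂ (λ u v → S₂ λ x y → H x y u v)
      swap₂ H = trans (S₁-cong λ x → IsSum.Σ<-swap S₂-isSum p (λ j → λ { (u , v) → H x (+ j) u v }))
        (IsSum.Σ<-swap S₂-isSum p (λ j → λ { (u , v) → S₁ λ y → H (+ j) y u v }))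
      K-inv : ∀ x y u v → K x y u v ≡ ⟦ δ x (X u v) ⟧ * ⟦ δ y (Y u v) ⟧
      K-inv x y u v = trans (sym (⟦∧⟧ (δ u _) (δ v _))) (trans (cong ⟦_⟧ both) (⟦∧⟧ (δ x _) (δ y _)))
        where
        expand : ∀ t → t ≋ i *' (a *' d -' b *' c) *' t
        expand t = lin₁ (-' t) iD≋1 (ring a b c d i t)
          where
          ring : ∀ a b c d i t → t -' i *' (a *' d -' b *' c) *' t ≡ (-' t) *' (i *' (a *' d -' b *' c) -' 1ℤ)
          ring = ℤ-solve
        to : u ≋ a *' x +' b *' y → v ≋ c *' x +' d *' y → x ≋ X u v × y ≋ Y u v
        to h k = ≋-trans (expand x) (≋-sym (lin₂ (i *' d) (-' (i *' b)) h k (ring₁ a b c d i x y u v))) ,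
                 ≋-trans (expand y) (≋-sym (lin₂ (-' (i *' c)) (i *' a) h k (ring₂ a b c d i x y u v)))
          where
          ring₁ : ∀ a b c d i x y u v → i *' (d *' u -' b *' v) -' i *' (a *' d -' b *' c) *' x
                  ≡ (i *' d) *' (u -' (a *' x +' b *' y)) +' (-' (i *' b)) *' (v -' (c *' x +' d *' y))
          ring₁ = ℤ-solve
          ring₂ : ∀ a b c d i x y u v → i *' (a *' v -' c *' u) -' i *' (a *' d -' b *' c) *' y
                  ≡ (-' (i *' c)) *' (u -' (a *' x +' b *' y)) +' (i *' a) *' (v -' (c *' x +' d *' y))
          ring₂ = ℤ-solve
        from : x ≋ X u v → y ≋ Y u v → u ≋ a *' x +' b *' y × v ≋ c *' x +' d *' y
        from h k = ≋-trans (expand u) (≋-sym (lin₂ a b h k (ring₁ a b c d i x y u v))) ,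
                   ≋-trans (expand v) (≋-sym (lin₂ c d h k (ring₂ a b c d i x y u v)))
          where
          ring₁ : ∀ a b c d i x y u v → (a *' x +' b *' y) -' i *' (a *' d -' b *' c) *' u
                  ≡ a *' (x -' i *' (d *' u -' b *' v)) +' b *' (y -' i *' (a *' v -' c *' u))
          ring₁ = ℤ-solve
          ring₂ : ∀ a b c d i x y u v → (c *' x +' d *' y) -' i *' (a *' d -' b *' c) *' v
                  ≡ c *' (x -' i *' (d *' u -' b *' v)) +' d *' (y -' i *' (a *' v -' c *' u))
          ring₂ = ℤ-solve
        both : δ u (a *' x +' b *' y) ∧ δ v (c *' x +' d *' y) ≡ δ x (X u v) ∧ δ y (Y u v)
        both = δ∧δ-⇔ to from

-- How much of a set a translation moves out of it.

module Translates (p : ℕ) (pr : Prime p) where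
  open Lists
  open Residues p pr public

  PeriodicSet : (ℤ → ℤ → Bool) → Set
  PeriodicSet Y = ∀ {x y x' y'} → x ≋ x' → y ≋ y' → Y x y ≡ Y x' y'

  card : (ℤ → ℤ → Bool) → ℕ
  card Y = S₂ λ x y → ⟦ Y x y ⟧

  lam : (ℤ → ℤ → Bool) → ℤ → ℤ → ℕ
  lam Y a b = S₂ λ x y → ⟦ Y x y ∧ not (Y (x +' a) (y +' b)) ⟧

  record Seminorm (Λ : ℤ → ℤ → ℕ) : Set where
    field
      per≋ : Periodic₂ Λ
      null : Λ 0ℤ 0ℤ ≡ 0
      sub  : ∀ a b c d → Λ (a +' c) (b +' d) ≤ Λ a b + Λ c d
      neg  : ∀ a b → Λ (-' a) (-' b) ≤ Λ a b

    multipleℕ : ∀ n a b → Λ (+ n *' a) (+ n *' b) ≤ n * Λ a b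
    multipleℕ zero    a b = ≤-reflexive (trans (cong₂ Λ (ℤP.*-zeroˡ a) (ℤP.*-zeroˡ b)) null)
    multipleℕ (suc n) a b = ≤-trans (≤-reflexive (cong₂ Λ (step a) (step b)))
      (≤-trans (sub a b (+ n *' a) (+ n *' b)) (+-monoʳ-≤ (Λ a b) (multipleℕ n a b)))
      where
      ring : ∀ m c → (1ℤ +' m) *' c ≡ c +' m *' c
      ring = ℤ-solve
      step : ∀ c → + suc n *' c ≡ c +' + n *' c
      step c = trans (cong (_*' c) (ℤP.pos-+ 1 n)) (ring (+ n) c)

    multiple : ∀ z a b → Λ (z *' a) (z *' b) ≤ ∣ z ∣ * Λ a b
    multiple (+ n)      a b = multipleℕ n a b
    multiple (-[1+ n ]) a b = ≤-trans (≤-reflexive (cong₂ Λ (sym (ℤP.neg-distribˡ-* (+ suc n) a)) (sym (ℤP.neg-distribˡ-* (+ suc n) b))))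
      (≤-trans (neg _ _) (multipleℕ (suc n) a b))

  module _ {Y : ℤ → ℤ → Bool} (per : PeriodicSet Y) where

    private
      Y+ : ∀ a b {x y x' y'} → x ≋ x' → y ≋ y' → Y (x +' a) (y +' b) ≡ Y (x' +' a) (y' +' b)
      Y+ a b h k = per (+-≋ h ≋-refl) (+-≋ k ≋-refl)

      card-per : Periodic₂ λ x y → ⟦ Y x y ⟧
      card-per h k = cong ⟦_⟧ (per h k)

      lam-per : ∀ a b → Periodic₂ λ x y → ⟦ Y x y ∧ not (Y (x +' a) (y +' b)) ⟧
      lam-per a b h k = cong₂ (λ s t → ⟦ s ∧ not t ⟧) (per h k) (Y+ a b h k)

    card-shift : ∀ a b → S₂ (λ x y → ⟦ Y (x +' a) (y +' b) ⟧) ≡ card Y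
    card-shift a b = S₂-shift a b card-per

    lam+overlap : ∀ a b → lam Y a b + S₂ (λ x y → ⟦ Y x y ∧ Y (x +' a) (y +' b) ⟧) ≡ card Y
    lam+overlap a b = trans (sym (S₂-+ _ _)) (S₂-cong λ x y → ⟦∧not⟧ (Y x y) (Y (x +' a) (y +' b)))

    private
      -- Translation preserves the size, so as many points enter `Y` as leave it: both numbers
      -- complete the same overlap to `card Y`.
      entering : ∀ a b → S₂ (λ x y → ⟦ Y (x +' a) (y +' b) ∧ not (Y x y) ⟧) ≡ lam Y a b
      entering a b = +-cancelʳ-≡ _ _ (lam Y a b) (begin
        S₂ (λ x y → ⟦ Y (x +' a) (y +' b) ∧ not (Y x y) ⟧) + S₂ (λ x y → ⟦ Y x y ∧ Y (x +' a) (y +' b) ⟧)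
          ≡⟨ cong (λ t → S₂ (λ x y → ⟦ Y (x +' a) (y +' b) ∧ not (Y x y) ⟧) + t) (S₂-cong λ x y → cong ⟦_⟧ (∧-comm (Y x y) _)) ⟩
        S₂ (λ x y → ⟦ Y (x +' a) (y +' b) ∧ not (Y x y) ⟧) + S₂ (λ x y → ⟦ Y (x +' a) (y +' b) ∧ Y x y ⟧)
          ≡⟨ sym (S₂-+ _ _) ⟩
        S₂ (λ x y → ⟦ Y (x +' a) (y +' b) ∧ not (Y x y) ⟧ + ⟦ Y (x +' a) (y +' b) ∧ Y x y ⟧)
          ≡⟨ S₂-cong (λ x y → ⟦∧not⟧ (Y (x +' a) (y +' b)) (Y x y)) ⟩
        S₂ (λ x y → ⟦ Y (x +' a) (y +' b) ⟧)
          ≡⟨ card-shift a b ⟩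
        card Y
          ≡⟨ sym (lam+overlap a b) ⟩
        lam Y a b + S₂ (λ x y → ⟦ Y x y ∧ Y (x +' a) (y +' b) ⟧) ∎)
        where open ≡-Reasoning

    lam-neg : ∀ a b → lam Y (-' a) (-' b) ≡ lam Y a b
    lam-neg a b = begin
      lam Y (-' a) (-' b)
        ≡⟨ sym (S₂-shift a b (lam-per (-' a) (-' b))) ⟩
      S₂ (λ x y → ⟦ Y (x +' a) (y +' b) ∧ not (Y ((x +' a) +' (-' a)) ((y +' b) +' (-' b))) ⟧)
        ≡⟨ S₂-cong (λ x y → cong₂ (λ s t → ⟦ Y (x +' a) (y +' b) ∧ not (Y s t) ⟧) (ring x a) (ring y b)) ⟩
      S₂ (λ x y → ⟦ Y (x +' a) (y +' b) ∧ not (Y x y) ⟧)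
        ≡⟨ entering a b ⟩
      lam Y a b ∎
      where
      open ≡-Reasoning
      ring : ∀ x a → (x +' a) +' (-' a) ≡ x
      ring = ℤ-solve

    lam-sub : ∀ a b c d → lam Y (a +' c) (b +' d) ≤ lam Y a b + lam Y c d
    lam-sub a b c d = begin
      lam Y (a +' c) (b +' d)
        ≤⟨ S₂-mono (λ x y → ⟦∧not⟧-triangle (Y x y) (Y (x +' a) (y +' b)) _) ⟩
      S₂ (λ x y → ⟦ Y x y ∧ not (Y (x +' a) (y +' b)) ⟧ + ⟦ Y (x +' a) (y +' b) ∧ not (Y (x +' (a +' c)) (y +' (b +' d))) ⟧)
        ≡⟨ S₂-+ _ _ ⟩
      lam Y a b + S₂ (λ x y → ⟦ Y (x +' a) (y +' b) ∧ not (Y (x +' (a +' c)) (y +' (b +' d))) ⟧)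
        ≡⟨ cong (λ t → lam Y a b + t) (trans
             (S₂-cong λ x y → cong₂ (λ s t → ⟦ Y (x +' a) (y +' b) ∧ not (Y s t) ⟧) (sym (ℤP.+-assoc x a c)) (sym (ℤP.+-assoc y b d)))
             (S₂-shift a b (lam-per c d))) ⟩
      lam Y a b + lam Y c d ∎
      where open ≤-Reasoning

    lam-seminorm : Seminorm (lam Y)
    lam-seminorm = record
      { per≋ = λ {a} {b} {a'} {b'} h k → S₂-cong λ x y → cong (λ t → ⟦ Y x y ∧ not t ⟧) (per (+-≋ (≋-refl {x}) h) (+-≋ (≋-refl {y}) k))
      ; null = trans (S₂-cong λ x y → trans (cong₂ (λ s t → ⟦ Y x y ∧ not (Y s t) ⟧) (ℤP.+-identityʳ x) (ℤP.+-identityʳ y)) (contra (Y x y)))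
          (IsSum.T-zero S₂-isSum)
      ; sub  = lam-sub
      ; neg  = λ a b → ≤-reflexive (lam-neg a b) }
      where
      contra : ∀ b → ⟦ b ∧ not b ⟧ ≡ 0
      contra false = refl
      contra true  = refl

    -- The translate by (c , d) contributes `card Y`. A point of the other translate lies outside it
    -- exactly when the corresponding point of `Y` leaves `Y` under the difference of the two
    -- translations.
    card-∪ : ∀ a b c d → S₂ (λ x y → ⟦ Y (x -' a) (y -' b) ∨ Y (x -' c) (y -' d) ⟧) ≡ card Y + lam Y (a -' c) (b -' d)
    card-∪ a b c d = begin
      S₂ (λ x y → ⟦ Y (x -' a) (y -' b) ∨ Y (x -' c) (y -' d) ⟧)
        ≡⟨ S₂-cong (λ x y → ⟦∨⟧ (Y (x -' a) (y -' b)) (Y (x -' c) (y -' d))) ⟩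
      S₂ (λ x y → ⟦ Y (x -' c) (y -' d) ⟧ + ⟦ Y (x -' a) (y -' b) ∧ not (Y (x -' c) (y -' d)) ⟧)
        ≡⟨ S₂-+ _ _ ⟩
      S₂ (λ x y → ⟦ Y (x -' c) (y -' d) ⟧) + S₂ (λ x y → ⟦ Y (x -' a) (y -' b) ∧ not (Y (x -' c) (y -' d)) ⟧)
        ≡⟨ cong₂ _+_ (card-shift (-' c) (-' d)) (trans
             (S₂-cong λ x y → cong₂ (λ s t → ⟦ Y (x -' a) (y -' b) ∧ not (Y s t) ⟧) (ring x a c) (ring y b d))
             (S₂-shift (-' a) (-' b) (lam-per (a -' c) (b -' d)))) ⟩
      card Y + lam Y (a -' c) (b -' d) ∎
      where
      open ≡-Reasoning
      ring : ∀ x a c → x -' c ≡ (x -' a) +' (a -' c)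
      ring = ℤ-solve

    -- Averaging over the n² translations of the box: at most |Y|² pairs of points of Y differ by one of them.
    box : ∀ n τ → n ≤ p → 2 * card Y ≤ n * n → (∀ i j → i < n → j < n → lam Y (+ i) (+ j) ≤ τ) → card Y ≤ 2 * τ
    box zero      τ n≤p big small = ≤-trans (m≤m+n (card Y) _) (≤-trans big z≤n)
    box n@(suc _) τ n≤p big small = *-cancelˡ-≤ (n * n) (arith (n * n) (card Y) τ total big)
      where
      open ≤-Reasoning
      c = card Y
      B : (ℕ → ℕ → ℕ) → ℕ
      B f = Σ< n λ i → Σ< n λ j → f i j
      B-const : ∀ t → B (λ _ _ → t) ≡ n * n * t
      B-const t = trans (Σ<-cong n λ i _ → Σ<-const n t) (trans (Σ<-const n (n * t)) (sym (*-assoc n n t)))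
      ov : ℕ → ℕ → ℕ
      ov i j = S₂ (λ x y → ⟦ Y x y ∧ Y (x +' + i) (y +' + j) ⟧)
      overlaps : B ov ≤ c * c
      overlaps = begin
        B ov
          ≡⟨ Σ<-cong n (λ i _ → Σ<-cong n λ j _ → S₂-cong λ x y → ⟦∧⟧ (Y x y) (Y (x +' + i) (y +' + j))) ⟩
        B (λ i j → S₂ (λ x y → ⟦ Y x y ⟧ * ⟦ Y (x +' + i) (y +' + j) ⟧))
          ≡⟨ Σ<-cong n (λ i _ → IsSum.Σ<-swap S₂-isSum n (λ j → λ { (x , y) → ⟦ Y x y ⟧ * ⟦ Y (x +' + i) (y +' + j) ⟧ })) ⟩
        Σ< n (λ i → S₂ (λ x y → Σ< n λ j → ⟦ Y x y ⟧ * ⟦ Y (x +' + i) (y +' + j) ⟧))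
          ≡⟨ IsSum.Σ<-swap S₂-isSum n (λ i → λ { (x , y) → Σ< n λ j → ⟦ Y x y ⟧ * ⟦ Y (x +' + i) (y +' + j) ⟧ }) ⟩
        S₂ (λ x y → B λ i j → ⟦ Y x y ⟧ * ⟦ Y (x +' + i) (y +' + j) ⟧)
          ≡⟨ S₂-cong (λ x y → trans (Σ<-cong n λ i _ → Σ<-* n ⟦ Y x y ⟧ (λ j → ⟦ Y (x +' + i) (y +' + j) ⟧)) (Σ<-* n ⟦ Y x y ⟧ (λ i → Σ< n λ j → ⟦ Y (x +' + i) (y +' + j) ⟧))) ⟩
        S₂ (λ x y → ⟦ Y x y ⟧ * B λ i j → ⟦ Y (x +' + i) (y +' + j) ⟧)
          ≤⟨ S₂-mono (λ x y → *-monoʳ-≤ ⟦ Y x y ⟧ (in-box x y)) ⟩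
        S₂ (λ x y → ⟦ Y x y ⟧ * c)
          ≡⟨ trans (S₂-cong λ x y → *-comm ⟦ Y x y ⟧ c) (S₂-* c (λ x y → ⟦ Y x y ⟧)) ⟩
        c * c ∎
        where
        in-box : ∀ x y → (B λ i j → ⟦ Y (x +' + i) (y +' + j) ⟧) ≤ c
        in-box x y = begin
          (B λ i j → ⟦ Y (x +' + i) (y +' + j) ⟧)
            ≤⟨ S₂-box (λ u v → ⟦ Y (x +' u) (y +' v) ⟧) n≤p ⟩
          S₂ (λ u v → ⟦ Y (x +' u) (y +' v) ⟧)
            ≡⟨ S₂-cong (λ u v → cong₂ (λ s t → ⟦ Y s t ⟧) (ℤP.+-comm x u) (ℤP.+-comm y v)) ⟩
          S₂ (λ u v → ⟦ Y (u +' x) (v +' y) ⟧)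
            ≡⟨ card-shift x y ⟩
          c ∎
      total : n * n * c ≤ n * n * τ + c * c
      total = begin
        n * n * c
          ≡⟨ sym (B-const c) ⟩
        B (λ _ _ → c)
          ≡⟨ Σ<-cong n (λ i _ → Σ<-cong n λ j _ → sym (lam+overlap (+ i) (+ j))) ⟩
        B (λ i j → lam Y (+ i) (+ j) + ov i j)
          ≡⟨ trans (Σ<-cong n λ i _ → Σ<-+ n (λ j → lam Y (+ i) (+ j)) (ov i)) (Σ<-+ n (λ i → Σ< n λ j → lam Y (+ i) (+ j)) (λ i → Σ< n (ov i))) ⟩
        B (λ i j → lam Y (+ i) (+ j)) + B ov
          ≤⟨ +-mono-≤ (Σ<-mono n λ i i<n → Σ<-mono n λ j j<n → small i j i<n j<n) overlaps ⟩
        B (λ _ _ → τ) + c * c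
          ≡⟨ cong (_+ c * c) (B-const τ) ⟩
        n * n * τ + c * c ∎
      -- Since 2c ≤ N, the term c² is at most half of the left-hand side N c.
      arith : ∀ N c τ → N * c ≤ N * τ + c * c → 2 * c ≤ N → N * c ≤ N * (2 * τ)
      arith N c τ h k = by-≤ (N * c) (N * (2 * τ)) 0 (+-mono-≤ (*-monoʳ-≤ 2 h) (*-monoˡ-≤ c k)) (ring N c τ)
        where
        ring : ∀ N c τ → N * c + (2 * (N * τ + c * c) + N * c) + 0 ≡ N * (2 * τ) + (2 * (N * c) + 2 * c * c)
        ring = ℕ-solve

-- Pigeonhole and Dirichlet approximation.

module Approximation (p : ℕ) (pr : Prime p) where
  open Lists
  open Translates p pr public

  /-≡⇒near : ∀ m n d .{{_ : NonZero d}} → m / d ≡ n / d → ∣ + m -' + n ∣ < d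
  /-≡⇒near m n d h = ≤-<-trans (≤-trans (≤-reflexive (cong ∣_∣ (trans eq (ℤP.m-n≡m⊖n (m % d) (n % d))))) (ℤP.∣m⊝n∣≤m⊔n (m % d) (n % d)))
    (⊔-pres-<m (m%n<n m d) (m%n<n n d))
    where
    split : ∀ k → + k ≡ + (k % d) +' + (k / d) *' + d
    split k = pos-euclid (k / d) (k % d) d (m≡m%n+[m/n]*n k d)
    ring : ∀ a b c → (a +' c) -' (b +' c) ≡ a -' b
    ring = ℤ-solve
    eq : + m -' + n ≡ + (m % d) -' + (n % d)
    eq = trans (cong₂ _-'_ (split m) (trans (split n) (cong (λ k → + (n % d) +' + k *' + d) (sym h)))) (ring (+ (m % d)) (+ (n % d)) (+ (m / d) *' + d))

  %-≡⇒multiple : ∀ m n d .{{_ : NonZero d}} → m % d ≡ n % d → m ≢ n → d ≤ ∣ + m -' + n ∣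
  %-≡⇒multiple m n d h m≢n = lower ∣ k ∣ (trans (cong ∣_∣ eq) (ℤP.abs-* k (+ d)))
    where
    k = + (m / d) -' + (n / d)
    split : ∀ k → + k ≡ + (k % d) +' + (k / d) *' + d
    split k = pos-euclid (k / d) (k % d) d (m≡m%n+[m/n]*n k d)
    ring : ∀ r a b d → (r +' a *' d) -' (r +' b *' d) ≡ (a -' b) *' d
    ring = ℤ-solve
    eq : + m -' + n ≡ k *' + d
    eq = trans (cong₂ _-'_ (split m) (trans (split n) (cong (λ r → + r +' + (n / d) *' + d) (sym h)))) (ring (+ (m % d)) (+ (m / d)) (+ (n / d)) (+ d))
    lower : ∀ q → ∣ + m -' + n ∣ ≡ q * d → d ≤ ∣ + m -' + n ∣
    lower zero    e = ⊥-elim (m≢n (ℤP.+-injective (ℤP.i-j≡0⇒i≡j (+ m) (+ n) (ℤP.∣i∣≡0⇒i≡0 e))))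
    lower (suc q) e = ≤-trans (m≤m+n d (q * d)) (≤-reflexive (sym e))

  -- In the later Euclidean divisions the lower bound `R` keeps the cost of the quotients small, and
  -- the upper bound p/Q that of the remainders.
  Close : ∀ {n} → ℕ → ℕ → (Fin n → ℕ) → (Fin n → ℕ) → Set
  Close Q R x y = ∃₂ λ i j → Σ ℕ λ z → + x i -' + x j ≡ + z × R ≤ z × z * Q ≤ p × ∣ + y i -' + y j ∣ * Q ≤ p

  -- Pigeonhole for ⌊x/m⌋, ⌊y/m⌋ and x mod R; the last makes the difference a nonzero multiple of R.
  spread : ∀ Q R .{{_ : NonZero Q}} .{{_ : NonZero R}} (x y : Fin (suc (Q * Q * R)) → ℕ) →
           (∀ i → x i < p) → (∀ i → y i < p) → (∀ i j → i ≢ j → x i ≢ x j) → Close Q R x y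
  spread Q R x y x<p y<p x-inj = conclude (pigeonhole (n<1+n (Q * Q * R)) λ i → combine (combine (kx i) (ky i)) (kr i))
    where
    -- With intervals of length ⌊p/Q⌋ + 1, `Q` of them cover all residues, and two values in the
    -- same interval differ by at most p/Q.
    m = suc (p / Q)
    p<Qm : p < Q * m
    p<Qm = begin-strict
      p  ≡⟨ m≡m%n+[m/n]*n p Q ⟩
      p % Q + p / Q * Q  <⟨ +-monoˡ-< (p / Q * Q) (m%n<n p Q) ⟩
      Q + p / Q * Q  ≡⟨ *-comm m Q ⟩
      Q * m  ∎
      where open ≤-Reasoning
    kx ky : Fin (suc (Q * Q * R)) → Fin Q
    kx i = fromℕ< {x i / m} (m<n*o⇒m/o<n {x i} {Q} {m} (<-trans (x<p i) p<Qm))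
    ky i = fromℕ< {y i / m} (m<n*o⇒m/o<n {y i} {Q} {m} (<-trans (y<p i) p<Qm))
    kr : Fin (suc (Q * Q * R)) → Fin R
    kr i = fromℕ< (m%n<n (x i) R)
    scale : ∀ {z} → z < m → z * Q ≤ p
    scale (s≤s h) = ≤-trans (*-monoˡ-≤ Q h) (m/n*n≤m p Q)
    flip : ∀ a b → b -' a ≡ -' (a -' b)
    flip = ℤ-solve
    conclude : (∃₂ λ i j → toℕ i < toℕ j × combine (combine (kx i) (ky i)) (kr i) ≡ combine (combine (kx j) (ky j)) (kr j)) → Close Q R x y
    conclude (i , j , i<j , same) = orient (+ x i -' + x j) refl
      where
      same₁ = combine-injective (combine (kx i) (ky i)) (kr i) (combine (kx j) (ky j)) (kr j) same
      same₂ = combine-injective (kx i) (ky i) (kx j) (ky j) (proj₁ same₁)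
      i≢j : i ≢ j
      i≢j refl = <-irrefl refl i<j
      x-near : ∣ + x i -' + x j ∣ < m
      x-near = /-≡⇒near (x i) (x j) m (fromℕ<-injective (x i / m) (x j / m) _ _ (proj₁ same₂))
      y-near : ∣ + y i -' + y j ∣ < m
      y-near = /-≡⇒near (y i) (y j) m (fromℕ<-injective (y i / m) (y j / m) _ _ (proj₂ same₂))
      x-far : R ≤ ∣ + x i -' + x j ∣
      x-far = %-≡⇒multiple (x i) (x j) R (fromℕ<-injective (x i % R) (x j % R) _ _ (proj₂ same₁)) (x-inj i j i≢j)
      orient : ∀ d → + x i -' + x j ≡ d → Close Q R x y
      orient (+ z)      e = i , j , z , e , ≤-trans x-far (≤-reflexive (cong ∣_∣ e)) , scale (≤-<-trans (≤-reflexive (cong ∣_∣ (sym e))) x-near) , scale y-near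
      orient (-[1+ n ]) e = j , i , suc n , trans (flip (+ x i) (+ x j)) (cong -'_ e) ,
        ≤-trans x-far (≤-reflexive (cong ∣_∣ e)) , scale (≤-<-trans (≤-reflexive (cong ∣_∣ (sym e))) x-near) ,
        ≤-trans (≤-reflexive (cong (_* Q) (trans (cong ∣_∣ (flip (+ y i) (+ y j))) (ℤP.∣-i∣≡∣i∣ (+ y i -' + y j))))) (scale y-near)

  Approximated : ℕ → ℕ → ℤ → Set
  Approximated B x y = Σ ℕ λ a → Σ ℤ λ b → 1 ≤ a × a ≤ B × B * ∣ + a *' y -' b *' + x ∣ ≤ x

  -- Of the multiples 0, y, ..., B y reduced modulo x, two fall into the same one of B intervals of
  -- length x/B.
  dirichlet : ∀ B x y .{{_ : NonZero B}} .{{_ : NonZero x}} → Approximated B x y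
  dirichlet B x y with pigeonhole (n<1+n B) (λ i → fromℕ< {(+ toℕ i *' y) %ℕ x * B / x} (m<n*o⇒m/o<n {(+ toℕ i *' y) %ℕ x * B} {B} {x}
      (<-≤-trans (*-monoˡ-< B (n%ℕd<d (+ toℕ i *' y) x)) (≤-reflexive (*-comm x B)))))
  ... | i , j , i<j , same = toℕ j ∸ toℕ i , q j -' q i , m<n⇒0<n∸m i<j , ≤-trans (m∸n≤m (toℕ j) (toℕ i)) (≤-pred (toℕ<n j)) , bound
    where
    r : Fin (suc B) → ℕ
    r k = (+ toℕ k *' y) %ℕ x
    q : Fin (suc B) → ℤ
    q k = (+ toℕ k *' y) /ℕ x
    div : ∀ k → + toℕ k *' y ≡ + r k +' q k *' + x
    div k = a≡a%ℕn+[a/ℕn]*n (+ toℕ k *' y) x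
    ring₁ : ∀ s t y qs qt x → (s -' t) *' y -' (qs -' qt) *' x ≡ (s *' y -' qs *' x) -' (t *' y -' qt *' x)
    ring₁ = ℤ-solve
    ring₂ : ∀ a b → (a +' b) -' b ≡ a
    ring₂ = ℤ-solve
    ring₃ : ∀ B a b → B *' (a -' b) ≡ a *' B -' b *' B
    ring₃ = ℤ-solve
    j-i : + (toℕ j ∸ toℕ i) ≡ + toℕ j -' + toℕ i
    j-i = sym (trans (ℤP.m-n≡m⊖n (toℕ j) (toℕ i)) (ℤP.⊖-≥ (<⇒≤ i<j)))
    remainder : ∀ k → + toℕ k *' y -' q k *' + x ≡ + r k
    remainder k = trans (cong (_-' q k *' + x) (div k)) (ring₂ (+ r k) (q k *' + x))
    eq : + (toℕ j ∸ toℕ i) *' y -' (q j -' q i) *' + x ≡ + r j -' + r i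
    eq = trans (cong (λ t → t *' y -' (q j -' q i) *' + x) j-i)
      (trans (ring₁ (+ toℕ j) (+ toℕ i) y (q j) (q i) (+ x)) (cong₂ _-'_ (remainder j) (remainder i)))
    bound : B * ∣ + (toℕ j ∸ toℕ i) *' y -' (q j -' q i) *' + x ∣ ≤ x
    bound = begin
      B * ∣ + (toℕ j ∸ toℕ i) *' y -' (q j -' q i) *' + x ∣ ≡⟨ cong (λ t → B * ∣ t ∣) eq ⟩
      B * ∣ + r j -' + r i ∣  ≡⟨ sym (ℤP.abs-* (+ B) (+ r j -' + r i)) ⟩
      ∣ + B *' (+ r j -' + r i) ∣  ≡⟨ cong ∣_∣ (trans (ring₃ (+ B) (+ r j) (+ r i)) (cong₂ _-'_ (sym (ℤP.pos-* (r j) B)) (sym (ℤP.pos-* (r i) B)))) ⟩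
      ∣ + (r j * B) -' + (r i * B) ∣  ≤⟨ <⇒≤ (/-≡⇒near (r j * B) (r i * B) x (sym (fromℕ<-injective _ _ _ _ same))) ⟩
      x  ∎
      where open ≤-Reasoning

-- Seminorm bounds by Euclidean division, first along a line and then across it.

module CheapVectors (p : ℕ) (pr : Prime p) where
  open Lists
  open Approximation p pr public

  private
    -- For v = (a , b) one has t·v = (x , y) - (ρ , w): one available difference and ρ + |w| unit
    -- steps, hence the cost 1 + ρ + w. Multiplied by a B it is at most 2x, because the terms
    -- depending on B alone add up to (2B + 1) B² ≤ x; and x ≤ 2 t a.
    step-cost : ∀ {a B ρ t x w e b} → 1 ≤ a → a ≤ B → ρ < a → x ≡ ρ + t * a → a * w ≤ e + ρ * b → b ≤ suc a →
                B * e ≤ x → suc (2 * B) * B * B ≤ x → B * (1 + ρ + w) ≤ 4 * t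
    step-cost {a@(suc _)} {B} {ρ} {t} {x} {w} {e} {b} 1≤a a≤B ρ<a x≡ aw≤ b≤ Be≤x large =
      *-cancelˡ-≤ a (begin
        a * (B * (1 + ρ + w))  ≡⟨ ring₁ a B ρ w ⟩
        B * (a * (1 + ρ)) + B * (a * w)  ≤⟨ +-mono-≤ (*-monoʳ-≤ B (*-mono-≤ a≤B (≤-trans ρ<a a≤B))) (*-monoʳ-≤ B aw≤) ⟩
        B * (B * B) + B * (e + ρ * b)  ≤⟨ +-monoʳ-≤ (B * (B * B)) (*-monoʳ-≤ B (+-monoʳ-≤ e (*-mono-≤ (≤-trans (<⇒≤ ρ<a) a≤B) (≤-trans b≤ (s≤s a≤B))))) ⟩
        B * (B * B) + B * (e + B * suc B)  ≡⟨ ring₂ B e ⟩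
        suc (2 * B) * B * B + B * e  ≤⟨ +-mono-≤ large Be≤x ⟩
        x + x  ≤⟨ +-mono-≤ x≤2ta x≤2ta ⟩
        2 * (t * a) + 2 * (t * a)  ≡⟨ ring₃ a t ⟩
        a * (4 * t)  ∎)
      where
      open ≤-Reasoning
      ring₁ : ∀ a B ρ w → a * (B * (1 + ρ + w)) ≡ B * (a * (1 + ρ)) + B * (a * w)
      ring₁ = ℕ-solve
      ring₂ : ∀ B e → B * (B * B) + B * (e + B * (1 + B)) ≡ (1 + 2 * B) * B * B + B * e
      ring₂ = ℕ-solve
      ring₃ : ∀ a t → 2 * (t * a) + 2 * (t * a) ≡ a * (4 * t)
      ring₃ = ℕ-solve
      B≥1 : 1 ≤ B
      B≥1 = ≤-trans 1≤a a≤B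
      B≤x : B ≤ x
      B≤x = ≤-trans (m≤n*m B (suc (2 * B) * B) {{>-nonZero (*-mono-≤ (s≤s (z≤n {2 * B})) B≥1)}}) large
      x≤2ta : x ≤ 2 * (t * a)
      x≤2ta = bound t x≡
        where
        bound : ∀ t → x ≡ ρ + t * a → x ≤ 2 * (t * a)
        bound zero    x≡ = ⊥-elim (<⇒≱ ρ<a (≤-trans a≤B (≤-trans B≤x (≤-reflexive (trans x≡ (+-identityʳ ρ))))))
        bound (suc t) x≡ = ≤-trans (≤-reflexive x≡) (≤-trans (+-monoˡ-≤ (suc t * a) (≤-trans (<⇒≤ ρ<a) (m≤m+n a (t * a))))
          (≤-reflexive (cong (λ s → suc t * a + s) (sym (+-identityʳ _)))))

    -- A multiple of v is `q` steps t·v of cost `c * M` and `r` steps v of cost at most (2B + 1) M.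
    -- After multiplication by B they contribute 4 p M and p M.
    line-cost : ∀ {B c t q r x v} M → B * c ≤ 4 * t → q * t ≤ p → r ≤ t → t ≤ x → v ≤ suc (2 * B) → x * (suc (2 * B) * B) ≤ p →
                B * (q * (c * M) + r * (v * M)) ≤ 5 * p * M
    line-cost {B} {c} {t} {q} {r} {x} {v} M h qt≤p r≤t t≤x v≤ x≤ = begin
      B * (q * (c * M) + r * (v * M))  ≡⟨ ring₁ B c q r v M ⟩
      (q * (B * c) + r * (v * B)) * M  ≤⟨ *-monoˡ-≤ M (+-mono-≤ (*-monoʳ-≤ q h) (*-mono-≤ (≤-trans r≤t t≤x) (*-monoˡ-≤ B v≤))) ⟩
      (q * (4 * t) + x * (suc (2 * B) * B)) * M  ≡⟨ cong (λ s → (s + x * (suc (2 * B) * B)) * M) (ring₂ q t) ⟩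
      (4 * (q * t) + x * (suc (2 * B) * B)) * M  ≤⟨ *-monoˡ-≤ M (+-mono-≤ (*-monoʳ-≤ 4 qt≤p) x≤) ⟩
      (4 * p + p) * M  ≡⟨ cong (_* M) (+-comm (4 * p) p) ⟩
      5 * p * M  ∎
      where
      open ≤-Reasoning
      ring₁ : ∀ B c q r v M → B * (q * (c * M) + r * (v * M)) ≡ (q * (B * c) + r * (v * B)) * M
      ring₁ = ℕ-solve
      ring₂ : ∀ q t → q * (4 * t) ≡ 4 * (q * t)
      ring₂ = ℕ-solve

  -- The bounds on `a` make it invertible modulo p once B < p, so that the multiples of (a , b) form
  -- a genuine line.
  CheapLine : (ℤ → ℤ → ℕ) → ℕ → ℕ → Set
  CheapLine Λ B M = Σ ℕ λ a → Σ ℤ λ b → 1 ≤ a × a ≤ B × (∀ j → B * Λ (j *' + a) (j *' b) ≤ 5 * p * M)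

  module _ {Λ : ℤ → ℤ → ℕ} (sn : Seminorm Λ) where
    open Seminorm sn

    axis-bound : ∀ {M} → Λ 1ℤ 0ℤ ≤ M → Λ 0ℤ 1ℤ ≤ M → ∀ x y → Λ x y ≤ (∣ x ∣ + ∣ y ∣) * M
    axis-bound {M} h k x y = begin
      Λ x y  ≡⟨ cong₂ Λ (ring₁ x y) (ring₂ x y) ⟩
      Λ (x *' 1ℤ +' y *' 0ℤ) (x *' 0ℤ +' y *' 1ℤ)  ≤⟨ sub _ _ _ _ ⟩
      Λ (x *' 1ℤ) (x *' 0ℤ) + Λ (y *' 0ℤ) (y *' 1ℤ)  ≤⟨ +-mono-≤ (multiple x 1ℤ 0ℤ) (multiple y 0ℤ 1ℤ) ⟩
      ∣ x ∣ * Λ 1ℤ 0ℤ + ∣ y ∣ * Λ 0ℤ 1ℤ  ≤⟨ +-mono-≤ (*-monoʳ-≤ ∣ x ∣ h) (*-monoʳ-≤ ∣ y ∣ k) ⟩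
      ∣ x ∣ * M + ∣ y ∣ * M  ≡⟨ sym (*-distribʳ-+ M ∣ x ∣ ∣ y ∣) ⟩
      (∣ x ∣ + ∣ y ∣) * M  ∎
      where
      open ≤-Reasoning
      ring₁ : ∀ x y → x ≡ x *' 1ℤ +' y *' 0ℤ
      ring₁ = ℤ-solve
      ring₂ : ∀ x y → y ≡ x *' 0ℤ +' y *' 1ℤ
      ring₂ = ℤ-solve

    -- By Dirichlet (x , y) is close to a large multiple t·v of a short vector v = (a , b), so that t·v costs
    -- little compared with t; Euclidean division by t then reaches every multiple of v.
    line-cheap : ∀ B M x y → .{{_ : NonZero B}} → Λ 1ℤ 0ℤ ≤ M → Λ 0ℤ 1ℤ ≤ M → Λ (+ x) y ≤ M → ∣ y ∣ ≤ x →
                 suc (2 * B) * B * B ≤ x → x * (suc (2 * B) * B) ≤ p → CheapLine Λ B M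
    line-cheap B M x y h₁ h₂ h₃ y≤x large small = from-dirichlet (dirichlet B x y)
      where
      x≥1 : 1 ≤ x
      x≥1 = ≤-trans (>-nonZero⁻¹ _ {{m*n≢0 (suc (2 * B) * B) B {{m*n≢0 (suc (2 * B)) B}}}}) large
      instance
        x-nonZero : NonZero x
        x-nonZero = >-nonZero x≥1
      module Step (a : ℕ) (b : ℤ) (1≤a : 1 ≤ a) (a≤B : a ≤ B) (Be≤x : B * ∣ + a *' y -' b *' + x ∣ ≤ x)
                  (t ρ : ℕ) (x≡ : x ≡ ρ + t * a) (ρ<a : ρ < a) (t≤x : t ≤ x) where
        open ≤-Reasoning
        e w : ℤ
        e = + a *' y -' b *' + x
        w = y -' + t *' b
        +x≡ : + x ≡ + ρ +' + t *' + a
        +x≡ = pos-euclid t ρ a x≡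
        e≤x : ∣ e ∣ ≤ x
        e≤x = ≤-trans (m≤n*m ∣ e ∣ B) Be≤x
        b≤ : ∣ b ∣ ≤ suc a
        b≤ = *-cancelʳ-≤ ∣ b ∣ (suc a) x (begin
          ∣ b ∣ * x  ≡⟨ sym (ℤP.abs-* b (+ x)) ⟩
          ∣ b *' + x ∣  ≡⟨ cong ∣_∣ (ring (+ a) b (+ x) y) ⟩
          ∣ + a *' y -' e ∣  ≤⟨ ℤP.∣i-j∣≤∣i∣+∣j∣ (+ a *' y) e ⟩
          ∣ + a *' y ∣ + ∣ e ∣  ≡⟨ cong (_+ ∣ e ∣) (ℤP.abs-* (+ a) y) ⟩
          a * ∣ y ∣ + ∣ e ∣  ≤⟨ +-mono-≤ (*-monoʳ-≤ a y≤x) e≤x ⟩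
          a * x + x  ≡⟨ +-comm (a * x) x ⟩
          suc a * x  ∎)
          where
          ring : ∀ a b x y → b *' x ≡ a *' y -' (a *' y -' b *' x)
          ring = ℤ-solve
        aw≤ : a * ∣ w ∣ ≤ ∣ e ∣ + ρ * ∣ b ∣
        aw≤ = begin
          a * ∣ w ∣  ≡⟨ sym (ℤP.abs-* (+ a) w) ⟩
          ∣ + a *' w ∣  ≡⟨ cong ∣_∣ (trans (ring (+ a) b (+ ρ) (+ t) y) (cong (λ s → (+ a *' y -' b *' s) +' + ρ *' b) (sym +x≡))) ⟩
          ∣ e +' + ρ *' b ∣  ≤⟨ ℤP.∣i+j∣≤∣i∣+∣j∣ e (+ ρ *' b) ⟩
          ∣ e ∣ + ∣ + ρ *' b ∣  ≡⟨ cong (λ s → ∣ e ∣ + s) (ℤP.abs-* (+ ρ) b) ⟩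
          ∣ e ∣ + ρ * ∣ b ∣  ∎
          where
          ring : ∀ a b ρ t y → a *' (y -' t *' b) ≡ (a *' y -' b *' (ρ +' t *' a)) +' ρ *' b
          ring = ℤ-solve
        c = 1 + ρ + ∣ w ∣
        Bc≤4t : B * c ≤ 4 * t
        Bc≤4t = step-cost {a} {B} {ρ} {t} {x} {∣ w ∣} {∣ e ∣} {∣ b ∣} 1≤a a≤B ρ<a x≡ aw≤ b≤ Be≤x large
        instance
          t-nonZero : NonZero t
          t-nonZero = >-nonZero (n≢0⇒n>0 λ t≡0 → <⇒≱ (*-mono-≤ (>-nonZero⁻¹ B) (s≤s (z≤n {ρ + ∣ w ∣}))) (≤-trans Bc≤4t (≤-reflexive (cong (4 *_) t≡0))))
        tv : Λ (+ t *' + a) (+ t *' b) ≤ c * M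
        tv = begin
          Λ (+ t *' + a) (+ t *' b)  ≡⟨ cong₂ Λ (trans (ring₁ (+ ρ) (+ t *' + a)) (cong (_+' (-' (+ ρ))) (sym +x≡))) (ring₂ y (+ t *' b)) ⟩
          Λ (+ x +' (-' (+ ρ))) (y +' (-' w))  ≤⟨ sub _ _ _ _ ⟩
          Λ (+ x) y + Λ (-' (+ ρ)) (-' w)  ≤⟨ +-mono-≤ h₃ (≤-trans (neg _ _) (axis-bound h₁ h₂ (+ ρ) w)) ⟩
          M + (ρ + ∣ w ∣) * M  ∎
          where
          ring₁ : ∀ ρ s → s ≡ (ρ +' s) +' (-' ρ)
          ring₁ = ℤ-solve
          ring₂ : ∀ y s → s ≡ y +' (-' (y -' s))
          ring₂ = ℤ-solve
        euclid-cheap : ∀ n q r → n ≡ r + q * t → n < p → r < t → B * Λ (+ n *' + a) (+ n *' b) ≤ 5 * p * M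
        euclid-cheap n q r n≡ n<p r<t = begin
          B * Λ (+ n *' + a) (+ n *' b)  ≡⟨ cong (B *_) (cong₂ Λ (split (+ a)) (split b)) ⟩
          B * Λ (+ q *' (+ t *' + a) +' + r *' + a) (+ q *' (+ t *' b) +' + r *' b)  ≤⟨ *-monoʳ-≤ B (sub (+ q *' (+ t *' + a)) (+ q *' (+ t *' b)) (+ r *' + a) (+ r *' b)) ⟩
          B * (Λ (+ q *' (+ t *' + a)) (+ q *' (+ t *' b)) + Λ (+ r *' + a) (+ r *' b))  ≤⟨ *-monoʳ-≤ B (+-mono-≤ (multipleℕ q (+ t *' + a) (+ t *' b)) (multipleℕ r (+ a) b)) ⟩
          B * (q * Λ (+ t *' + a) (+ t *' b) + r * Λ (+ a) b)  ≤⟨ *-monoʳ-≤ B (+-mono-≤ (*-monoʳ-≤ q tv) (*-monoʳ-≤ r (axis-bound h₁ h₂ (+ a) b))) ⟩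
          B * (q * (c * M) + r * ((a + ∣ b ∣) * M))  ≤⟨ line-cost {B} {c} {t} {q} {r} {x} {a + ∣ b ∣} M Bc≤4t qt≤p (<⇒≤ r<t) t≤x v≤ small ⟩
          5 * p * M  ∎
          where
          qt≤p : q * t ≤ p
          qt≤p = ≤-trans (m≤n+m (q * t) r) (≤-trans (≤-reflexive (sym n≡)) (<⇒≤ n<p))
          v≤ : a + ∣ b ∣ ≤ suc (2 * B)
          v≤ = ≤-trans (+-mono-≤ a≤B (≤-trans b≤ (s≤s a≤B))) (≤-reflexive (trans (+-suc B B) (cong (λ s → suc (B + s)) (sym (+-identityʳ B)))))
          ring : ∀ q t r s → (r +' q *' t) *' s ≡ q *' (t *' s) +' r *' s
          ring = ℤ-solve
          split : ∀ s → + n *' s ≡ + q *' (+ t *' s) +' + r *' s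
          split s = trans (cong (_*' s) (pos-euclid q r t n≡)) (ring (+ q) (+ t) (+ r) s)
        cheap : ∀ j → B * Λ (j *' + a) (j *' b) ≤ 5 * p * M
        cheap j = ≤-trans (≤-reflexive (cong (B *_) (per≋ (to-rep (+ a)) (to-rep b))))
          (euclid-cheap (rep j) (rep j / t) (rep j % t) (m≡m%n+[m/n]*n (rep j) t) (rep<p j) (m%n<n (rep j) t))
          where
          ring : ∀ a b s → b *' s -' a *' s ≡ s *' (b -' a)
          ring = ℤ-solve
          to-rep : ∀ s → j *' s ≋ + rep j *' s
          to-rep s = lin₁ s (≋-sym (rep≋ j)) (ring (+ rep j) j s)
      from-dirichlet : Approximated B x y → CheapLine Λ B M
      from-dirichlet (a , b , 1≤a , a≤B , Be≤x) = a , b , 1≤a , a≤B ,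
        Step.cheap a b 1≤a a≤B Be≤x (_/_ x a {{a≢0}}) (_%_ x a {{a≢0}}) (m≡m%n+[m/n]*n x a {{a≢0}}) (m%n<n x a {{a≢0}}) (m/n≤m x a {{a≢0}})
        where
        a≢0 : NonZero a
        a≢0 = >-nonZero 1≤a

    -- Euclidean division by z reaches every class modulo the line spanned by (a , b).
    quotient-cheap : ∀ B M C a b a* b* → a* *' a +' b* *' b ≋ 1ℤ → (∀ j → B * Λ (j *' a) (j *' b) ≤ C) →
                     ∀ f₁ f₂ g₁ g₂ z → Λ f₁ f₂ ≤ M → Λ g₁ g₂ ≤ M → ¬ (a *' f₂ -' b *' f₁ ≋ 0ℤ) →
                     a *' g₂ -' b *' g₁ ≋ + z *' (a *' f₂ -' b *' f₁) → .{{_ : NonZero z}} → B ≤ z → z * B ≤ p →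
                     ∀ x y → B * Λ x y ≤ C + 2 * p * M
    quotient-cheap B M C a b a* b* unit line f₁ f₂ g₁ g₂ z hf hg c≢0 φg B≤z zB≤p x y with ≋-inverse _ c≢0
    ... | i , ic≋1 = Step.cheap (rep (i *' (a *' y -' b *' x))) (rep (i *' (a *' y -' b *' x)) / z) (rep (i *' (a *' y -' b *' x)) % z) (m≡m%n+[m/n]*n _ z) (m%n<n _ z) (rep<p (i *' (a *' y -' b *' x))) (rep≋ _)
      where
      module Step (n q r : ℕ) (n≡ : n ≡ r + q * z) (r<z : r < z) (n<p : n < p) (n≋ : + n ≋ i *' (a *' y -' b *' x)) where
        open ≤-Reasoning
        -- The form a y - b x vanishes on the line, takes the value c at `f` and z c at `g`.
        -- Subtracting `q` copies of `g` and `r` copies of `f` therefore brings (x , y) onto the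
        -- line.
        c = a *' f₂ -' b *' f₁
        φ = a *' y -' b *' x
        qz≤p : q * z ≤ p
        qz≤p = ≤-trans (m≤n+m (q * z) r) (≤-trans (≤-reflexive (sym n≡)) (<⇒≤ n<p))
        u = x -' (+ q *' g₁ +' + r *' f₁)
        v = y -' (+ q *' g₂ +' + r *' f₂)
        -- The coordinate on the line: a v ≋ b u and a* a + b* b ≋ 1 make (u , v) congruent to j (a
        -- , b).
        j = a* *' u +' b* *' v
        ringℕ : ∀ B L q r M → B * (L + (q * M + r * M)) ≡ B * L + (q * B + r * B) * M
        ringℕ = ℕ-solve
        nc≋φ : + r *' c +' + q *' (+ z *' c) ≋ φ
        nc≋φ = ≋-trans (≋-reflexive (trans (ring₀ (+ r) (+ q) (+ z) c) (cong (_*' c) (sym (pos-euclid q r z n≡)))))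
          (lin₂ c φ n≋ ic≋1 (ring₁ (+ n) c φ i))
          where
          ring₀ : ∀ r q z c → r *' c +' q *' (z *' c) ≡ (r +' q *' z) *' c
          ring₀ = ℤ-solve
          ring₁ : ∀ n c φ i → n *' c -' φ ≡ c *' (n -' i *' φ) +' φ *' (i *' c -' 1ℤ)
          ring₁ = ℤ-solve
        kernel : a *' v ≋ b *' u
        kernel = ≋-sym (lin₂ 1ℤ (+ q) nc≋φ φg (ring a b x y f₁ f₂ g₁ g₂ (+ q) (+ r) (+ z)))
          where
          ring : ∀ a b x y f₁ f₂ g₁ g₂ q r z →
            b *' (x -' (q *' g₁ +' r *' f₁)) -' a *' (y -' (q *' g₂ +' r *' f₂)) ≡
            1ℤ *' ((r *' (a *' f₂ -' b *' f₁) +' q *' (z *' (a *' f₂ -' b *' f₁))) -' (a *' y -' b *' x)) +' q *' ((a *' g₂ -' b *' g₁) -' z *' (a *' f₂ -' b *' f₁))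
          ring = ℤ-solve
        x≋ : x ≋ j *' a +' (+ q *' g₁ +' + r *' f₁)
        x≋ = ≋-sym (lin₂ u b* unit kernel (ring a b a* b* x v (+ q *' g₁ +' + r *' f₁)))
          where
          ring : ∀ a b a* b* x v s → ((a* *' (x -' s) +' b* *' v) *' a +' s) -' x ≡
                 (x -' s) *' ((a* *' a +' b* *' b) -' 1ℤ) +' b* *' (a *' v -' b *' (x -' s))
          ring = ℤ-solve
        y≋ : y ≋ j *' b +' (+ q *' g₂ +' + r *' f₂)
        y≋ = ≋-sym (lin₂ v (-' a*) unit kernel (ring a b a* b* y u (+ q *' g₂ +' + r *' f₂)))
          where
          ring : ∀ a b a* b* y u s → ((a* *' u +' b* *' (y -' s)) *' b +' s) -' y ≡
                 (y -' s) *' ((a* *' a +' b* *' b) -' 1ℤ) +' (-' a*) *' (a *' (y -' s) -' b *' u)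
          ring = ℤ-solve
        cheap : B * Λ x y ≤ C + 2 * p * M
        cheap = begin
          B * Λ x y  ≡⟨ cong (B *_) (per≋ x≋ y≋) ⟩
          B * Λ (j *' a +' (+ q *' g₁ +' + r *' f₁)) (j *' b +' (+ q *' g₂ +' + r *' f₂))
            ≤⟨ *-monoʳ-≤ B (≤-trans (sub _ _ _ _) (+-monoʳ-≤ (Λ (j *' a) (j *' b)) (≤-trans (sub _ _ _ _) (+-mono-≤ (multipleℕ q _ _) (multipleℕ r _ _))))) ⟩
          B * (Λ (j *' a) (j *' b) + (q * Λ g₁ g₂ + r * Λ f₁ f₂))
            ≤⟨ *-monoʳ-≤ B (+-monoʳ-≤ (Λ (j *' a) (j *' b)) (+-mono-≤ (*-monoʳ-≤ q hg) (*-monoʳ-≤ r hf))) ⟩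
          B * (Λ (j *' a) (j *' b) + (q * M + r * M))
            ≡⟨ ringℕ B (Λ (j *' a) (j *' b)) q r M ⟩
          B * Λ (j *' a) (j *' b) + (q * B + r * B) * M
            ≤⟨ +-mono-≤ (line j) (*-monoˡ-≤ M (+-mono-≤ (≤-trans (*-monoʳ-≤ q B≤z) qz≤p) (≤-trans (*-monoˡ-≤ B (<⇒≤ r<z)) zB≤p))) ⟩
          C + (p + p) * M  ≡⟨ cong (λ s → C + (p + s) * M) (sym (+-identityʳ p)) ⟩
          C + 2 * p * M  ∎

-- Bounding a seminorm on the whole plane from its values on differences of a list.

module Diameters (p : ℕ) (pr : Prime p) where
  open Lists
  open CheapVectors p pr public

  private variable
    E : Set

  δ-sym : ∀ x y → δ x y ≡ δ y x
  δ-sym x y = δ-⇔ ≋-sym ≋-sym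

  δ-false⁻¹ : ∀ {x y} → δ x y ≡ false → ¬ x ≋ y
  δ-false⁻¹ {x} {y} h k with trans (sym h) (δ-true k)
  ... | ()

  rep-injective : ∀ {x y} → rep x ≡ rep y → x ≋ y
  rep-injective {x} {y} h = ≋-trans (≋-sym (rep≋ x)) (≋-trans (≋-reflexive (cong +_ h)) (rep≋ y))

  -- Stated for every nonzero linear form and not only for the coordinates, because it must survive
  -- a change of basis.
  Light : (E → ℤ) → (E → ℤ) → ℕ → List E → Set
  Light x y β ℓ = ∀ α γ → ¬ (α ≋ 0ℤ × γ ≋ 0ℤ) → ∀ e → count (λ e' → δ (α *' x e +' γ *' y e) (α *' x e' +' γ *' y e')) ℓ ≤ β

  light-x : ∀ (x y : E → ℤ) {β} ℓ → Light x y β ℓ → ∀ e → count (λ e' → δ (x e) (x e')) ℓ ≤ β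
  light-x x y ℓ light e = ≤-trans (count-mono ℓ λ e' h → δ-true (lin₁ 1ℤ (δ-sound h) (ring (x e) (y e) (x e') (y e'))))
      (light 1ℤ 0ℤ (λ (h , _) → <⇒≢ (s≤s z≤n) (sym (≋⇒≡ 1<p (>-nonZero⁻¹ p) h))) e)
    where
    ring : ∀ x y x' y' → (1ℤ *' x +' 0ℤ *' y) -' (1ℤ *' x' +' 0ℤ *' y') ≡ 1ℤ *' (x -' x')
    ring = ℤ-solve

  module Diameter (B : ℕ) .{{B≢0 : NonZero B}} (B<p : B < p) where

    -- x ≥ R absorbs the error terms of `step-cost`, and x ≤ p/Q bounds the remainders in
    -- `line-cost`.
    Q R N : ℕ
    Q = suc (2 * B) * B
    R = suc (2 * B) * B * B
    N = Q * Q * R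

    instance
      Q-nonZero : NonZero Q
      Q-nonZero = m*n≢0 (suc (2 * B)) B
      R-nonZero : NonZero R
      R-nonZero = m*n≢0 (suc (2 * B) * B) B
      N-nonZero : NonZero N
      N-nonZero = m*n≢0 (Q * Q) R {{m*n≢0 Q Q}}

    B≤Q : B ≤ Q
    B≤Q = m≤n*m B (suc (2 * B))

    B≤R : B ≤ R
    B≤R = m≤n*m B Q

    β≤Nβ : ∀ β → 1 * β ≤ N * β
    β≤Nβ β = *-monoˡ-≤ β (>-nonZero⁻¹ N)

    a≢0 : ∀ a → 1 ≤ a → a ≤ B → ¬ (+ a ≋ 0ℤ)
    a≢0 a 1≤a a≤B h = <⇒≢ 1≤a (sym (≋⇒≡ (≤-<-trans a≤B B<p) (>-nonZero⁻¹ p) h))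

    module _ {Λ : ℤ → ℤ → ℕ} (sn : Seminorm Λ) (ℓ : List E) (x y : E → ℤ) (β M : ℕ) (long : N * β < length ℓ)
             (near : ∀ e e' → e ∈ ℓ → e' ∈ ℓ → Λ (x e -' x e') (y e -' y e') ≤ M) where
      open Seminorm sn

      -- One nonzero value `c` of φ serves as unit: after multiplication by its inverse, `spread`
      -- finds two elements whose φ-values differ by z c with z of moderate size. The constant
      -- second coordinate makes `spread` one-dimensional.
      quotient-diameter : ∀ C a b a* b* → a* *' a +' b* *' b ≋ 1ℤ → (∀ j → B * Λ (j *' a) (j *' b) ≤ C) →
        (∀ e → count (λ e' → δ (a *' y e -' b *' x e) (a *' y e' -' b *' x e')) ℓ ≤ β) →
        ∀ u v → B * Λ u v ≤ C + 2 * p * M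
      quotient-diameter C a b a* b* unit line light
        with independent (λ e e' → δ (a *' y e -' b *' x e) (a *' y e' -' b *' x e')) (λ e e' → δ-sym _ _) β 1 ℓ light (≤-<-trans (β≤Nβ β) long)
           | independent (λ e e' → δ (a *' y e -' b *' x e) (a *' y e' -' b *' x e')) (λ e e' → δ-sym _ _) β N ℓ light long
      ... | g , g∈ , g-good | f , f∈ , f-good = from-inverse (≋-inverse c c≢0)
        where
        φ : E → ℤ
        φ e = a *' y e -' b *' x e
        e₀ = g zero
        e₁ = g (suc zero)
        c = a *' (y e₁ -' y e₀) -' b *' (x e₁ -' x e₀)
        φ-diff : ∀ e e' → a *' (y e -' y e') -' b *' (x e -' x e') ≡ φ e -' φ e'
        φ-diff e e' = ring a b (x e) (y e) (x e') (y e')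
          where
          ring : ∀ a b x y x' y' → a *' (y -' y') -' b *' (x -' x') ≡ (a *' y -' b *' x) -' (a *' y' -' b *' x')
          ring = ℤ-solve
        c≢0 : ¬ c ≋ 0ℤ
        c≢0 h = δ-false⁻¹ (g-good zero (suc zero) λ ()) (lin₁ (-' 1ℤ) h (trans (ring (φ e₀) (φ e₁)) (cong (λ s → (-' 1ℤ) *' (s -' 0ℤ)) (sym (φ-diff e₁ e₀)))))
          where
          ring : ∀ s t → s -' t ≡ (-' 1ℤ) *' ((t -' s) -' 0ℤ)
          ring = ℤ-solve
        from-inverse : (∃ λ i → i *' c ≋ 1ℤ) → ∀ u v → B * Λ u v ≤ C + 2 * p * M
        from-inverse (i , ic≋1) = from-spread (spread Q R (λ k → rep (i *' φ (f k))) (λ _ → 0) (λ k → rep<p _) (λ _ → >-nonZero⁻¹ p) distinct)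
          where
          distinct : ∀ k l → k ≢ l → rep (i *' φ (f k)) ≢ rep (i *' φ (f l))
          distinct k l k≢l h = δ-false⁻¹ (f-good k l k≢l) (lin₂ c (φ (f l) -' φ (f k)) (rep-injective {i *' φ (f k)} {i *' φ (f l)} h) ic≋1 (ring c i (φ (f k)) (φ (f l))))
            where
            ring : ∀ c i s t → s -' t ≡ c *' (i *' s -' i *' t) +' (t -' s) *' (i *' c -' 1ℤ)
            ring = ℤ-solve
          from-spread : Close Q R (λ k → rep (i *' φ (f k))) (λ _ → 0) → ∀ u v → B * Λ u v ≤ C + 2 * p * M
          from-spread (k , l , z , z≡ , R≤z , zQ≤p , _) =
            quotient-cheap sn B M C a b a* b* unit line (x e₁ -' x e₀) (y e₁ -' y e₀) (x (f k) -' x (f l)) (y (f k) -' y (f l)) z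
              (near e₁ e₀ (g∈ _) (g∈ _)) (near (f k) (f l) (f∈ k) (f∈ l)) c≢0 ratio {{>-nonZero (≤-trans (>-nonZero⁻¹ R) R≤z)}}
              (≤-trans B≤R R≤z) (≤-trans (*-monoʳ-≤ z B≤Q) zQ≤p)
            where
            z≋ : + z ≋ i *' φ (f k) -' i *' φ (f l)
            z≋ = ≋-trans (≋-reflexive (sym z≡)) (sub-≋ (rep≋ (i *' φ (f k))) (rep≋ (i *' φ (f l))))
            ratio : a *' (y (f k) -' y (f l)) -' b *' (x (f k) -' x (f l)) ≋ + z *' c
            ratio = ≋-trans (≋-reflexive (φ-diff (f k) (f l))) (lin₂ (-' c) (φ (f l) -' φ (f k)) z≋ ic≋1 (ring c i (+ z) (φ (f k)) (φ (f l))))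
              where
              ring : ∀ c i z s t → (s -' t) -' z *' c ≡ (-' c) *' (z -' (i *' s -' i *' t)) +' (t -' s) *' (i *' c -' 1ℤ)
              ring = ℤ-solve

      -- `spread` yields an available difference (z , d). Its larger coordinate is the one to be
      -- divided in `line-cheap`, after exchanging the axes if that is d. The resulting line costs 5
      -- p M, and `quotient-diameter` adds 2 p M for the directions across it.
      plane-diameter : Λ 1ℤ 0ℤ ≤ M → Λ 0ℤ 1ℤ ≤ M → Light x y β ℓ → ∀ u v → B * Λ u v ≤ 7 * p * M
      plane-diameter h₁ h₂ light with independent (λ e e' → δ (x e) (x e')) (λ e e' → δ-sym _ _) β N ℓ (light-x x y ℓ light) long
      ... | f , f∈ , f-good = from-spread (spread Q R (λ k → rep (x (f k))) (λ k → rep (y (f k))) (λ k → rep<p _) (λ k → rep<p _)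
                                (λ k l k≢l h → δ-false⁻¹ (f-good k l k≢l) (rep-injective h)))
        where
        finish : ∀ a b a* b* → a* *' a +' b* *' b ≋ 1ℤ → ¬ (a ≋ 0ℤ × b ≋ 0ℤ) → (∀ j → B * Λ (j *' a) (j *' b) ≤ 5 * p * M) → ∀ u v → B * Λ u v ≤ 7 * p * M
        finish a b a* b* unit ab≢0 line u v = ≤-trans (quotient-diameter (5 * p * M) a b a* b* unit line light-φ u v) (≤-reflexive (ringℕ p M))
          where
          ringℕ : ∀ p M → 5 * p * M + 2 * p * M ≡ 7 * p * M
          ringℕ = ℕ-solve
          light-φ : ∀ e → count (λ e' → δ (a *' y e -' b *' x e) (a *' y e' -' b *' x e')) ℓ ≤ β
          light-φ e = ≤-trans (count-mono ℓ λ e' h → δ-true (lin₁ 1ℤ (δ-sound h) (ring a b (x e) (y e) (x e') (y e'))))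
              (light (-' b) a (λ (h , k) → ab≢0 (k , lin₁ (-' 1ℤ) h (ring-neg b))) e)
            where
            ring : ∀ a b x y x' y' → ((-' b) *' x +' a *' y) -' ((-' b) *' x' +' a *' y') ≡ 1ℤ *' ((a *' y -' b *' x) -' (a *' y' -' b *' x'))
            ring = ℤ-solve
            ring-neg : ∀ b → b -' 0ℤ ≡ (-' 1ℤ) *' ((-' b) -' 0ℤ)
            ring-neg = ℤ-solve
        transposed : Seminorm (λ u v → Λ v u)
        transposed = record { per≋ = λ h k → per≋ k h ; null = null ; sub = λ a b c d → sub b a d c ; neg = λ a b → neg b a }
        from-line : CheapLine Λ B M → ∀ u v → B * Λ u v ≤ 7 * p * M
        from-line (a , b , 1≤a , a≤B , line) with ≋-inverse (+ a) (a≢0 a 1≤a a≤B)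
        ... | i , ia≋1 = finish (+ a) b i 0ℤ (≋-trans (≋-reflexive (ring i (+ a) b)) ia≋1) (λ (h , _) → a≢0 a 1≤a a≤B h) line
          where
          ring : ∀ i a b → i *' a +' 0ℤ *' b ≡ i *' a
          ring = ℤ-solve
        from-lineᵀ : CheapLine (λ u v → Λ v u) B M → ∀ u v → B * Λ u v ≤ 7 * p * M
        from-lineᵀ (a , b , 1≤a , a≤B , line) with ≋-inverse (+ a) (a≢0 a 1≤a a≤B)
        ... | i , ia≋1 = finish b (+ a) 0ℤ i (≋-trans (≋-reflexive (ring i (+ a) b)) ia≋1) (λ (_ , h) → a≢0 a 1≤a a≤B h) line
          where
          ring : ∀ i a b → 0ℤ *' b +' i *' a ≡ i *' a
          ring = ℤ-solve
        by-size : ∀ z d → Λ (+ z) d ≤ M → R ≤ z → z * Q ≤ p → ∣ d ∣ * Q ≤ p → ∀ u v → B * Λ u v ≤ 7 * p * M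
        by-size z d h R≤z zQ dQ with ∣ d ∣ ≤? z
        ... | yes d≤z = from-line (line-cheap sn B M z d h₁ h₂ h d≤z R≤z zQ)
        by-size z (+ n) h R≤z zQ dQ | no d≰z = from-lineᵀ (line-cheap transposed B M n (+ z) h₂ h₁ h (<⇒≤ (≰⇒> d≰z)) (≤-trans R≤z (<⇒≤ (≰⇒> d≰z))) dQ)
        by-size z (-[1+ n ]) h R≤z zQ dQ | no d≰z = from-lineᵀ (line-cheap transposed B M (suc n) (-' (+ z)) h₂ h₁ (≤-trans (neg (+ z) -[1+ n ]) h)
          (≤-trans (≤-reflexive (ℤP.∣-i∣≡∣i∣ (+ z))) (<⇒≤ (≰⇒> d≰z))) (≤-trans R≤z (<⇒≤ (≰⇒> d≰z))) dQ)
        from-spread : Close Q R (λ k → rep (x (f k))) (λ k → rep (y (f k))) → ∀ u v → B * Λ u v ≤ 7 * p * M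
        from-spread (k , l , z , z≡ , R≤z , zQ , dQ) = by-size z (+ rep (y (f k)) -' + rep (y (f l)))
          (≤-trans (≤-reflexive (per≋ (≋-trans (≋-reflexive (sym z≡)) (sub-≋ (rep≋ (x (f k))) (rep≋ (x (f l))))) (sub-≋ (rep≋ (y (f k))) (rep≋ (y (f l))))))
            (near (f k) (f l) (f∈ k) (f∈ l))) R≤z zQ dQ

-- From gains bounded by M to bounds on the size of the set.

module Directions (p : ℕ) (pr : Prime p) where
  open Lists
  open Diameters p pr public

  private variable
    E : Set

  -- M bounds the growth of Y in all available directions; start serves while |Y| grows from 1 to a fixed
  -- proportion of p², main from there to p² / 2.
  record Rich (B : ℕ) (Y : ℤ → ℤ → Bool) (M : ℕ) : Set where
    field
      start : ∀ k → k < p → 2 * card Y ≤ suc k * suc k → card Y ≤ 4 * k * M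
      main  : 2 * card Y ≤ p * p → B * card Y ≤ 14 * p * M

  -- Turns two independent differences of points into the unit vectors, whose cost `axis-bound`
  -- takes as given.
  module Basis {Y : ℤ → ℤ → Bool} (per : PeriodicSet Y) (p₁ q₁ p₂ q₂ : ℤ) (det≢0 : ¬ (p₁ *' q₂ -' p₂ *' q₁ ≋ 0ℤ)) where

    Y' : ℤ → ℤ → Bool
    Y' u v = Y (p₁ *' u +' p₂ *' v) (q₁ *' u +' q₂ *' v)

    Y'-per : PeriodicSet Y'
    Y'-per h k = per (+-≋ (*-≋ˡ p₁ h) (*-≋ˡ p₂ k)) (+-≋ (*-≋ˡ q₁ h) (*-≋ˡ q₂ k))

    card-Y' : card Y' ≡ card Y
    card-Y' = S₂-linear {p₁} {p₂} {q₁} {q₂} det≢0 λ h k → cong ⟦_⟧ (per h k)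

    lam-Y' : ∀ u v → lam Y' u v ≡ lam Y (p₁ *' u +' p₂ *' v) (q₁ *' u +' q₂ *' v)
    lam-Y' u v = trans (S₂-cong λ x y → cong₂ (λ s t → ⟦ Y' x y ∧ not (Y s t) ⟧) (ring p₁ p₂ x y u v) (ring q₁ q₂ x y u v))
      (S₂-linear {p₁} {p₂} {q₁} {q₂} det≢0 {λ x y → ⟦ Y x y ∧ not (Y (x +' (p₁ *' u +' p₂ *' v)) (y +' (q₁ *' u +' q₂ *' v))) ⟧}
        λ h k → cong₂ (λ s t → ⟦ s ∧ not t ⟧) (per h k) (per (+-≋ h ≋-refl) (+-≋ k ≋-refl)))
      where
      ring : ∀ a b x y u v → a *' (x +' u) +' b *' (y +' v) ≡ (a *' x +' b *' y) +' (a *' u +' b *' v)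
      ring = ℤ-solve

    -- Both bounds come from `box`. With side k + 1 the entries are at most k, so every translation
    -- costs at most 2 k M; with side p the cost is the diameter bound 7 p M / B.
    rich : ∀ B .{{_ : NonZero B}} M → lam Y' 1ℤ 0ℤ ≤ M → lam Y' 0ℤ 1ℤ ≤ M → (∀ u v → B * lam Y' u v ≤ 7 * p * M) → Rich B Y M
    rich B M h₁ h₂ diam = record { start = small-case ; main = large-case }
      where
      open ≤-Reasoning
      small-case : ∀ k → k < p → 2 * card Y ≤ suc k * suc k → card Y ≤ 4 * k * M
      small-case k k<p big = begin
        card Y  ≡⟨ sym card-Y' ⟩
        card Y'  ≤⟨ box Y'-per (suc k) ((k + k) * M) k<p (subst (λ c → 2 * c ≤ suc k * suc k) (sym card-Y') big)
                                (λ i j i<n j<n → ≤-trans (axis-bound (lam-seminorm Y'-per) h₁ h₂ (+ i) (+ j)) (*-monoˡ-≤ M (+-mono-≤ (≤-pred i<n) (≤-pred j<n)))) ⟩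
        2 * ((k + k) * M)  ≡⟨ ring k M ⟩
        4 * k * M  ∎
        where
        ring : ∀ k M → 2 * ((k + k) * M) ≡ 4 * k * M
        ring = ℕ-solve
      large-case : 2 * card Y ≤ p * p → B * card Y ≤ 14 * p * M
      large-case half = begin
        B * card Y  ≡⟨ cong (B *_) (sym card-Y') ⟩
        B * card Y'  ≤⟨ *-monoʳ-≤ B (box Y'-per p (7 * p * M / B) ≤-refl (subst (λ c → 2 * c ≤ p * p) (sym card-Y') half)
                                    (λ i j _ _ → ≤-trans (≤-reflexive (sym (m*n/n≡m (lam Y' (+ i) (+ j)) B))) (/-monoˡ-≤ B (≤-trans (≤-reflexive (*-comm _ B)) (diam (+ i) (+ j)))))) ⟩
        B * (2 * (7 * p * M / B))  ≡⟨ ring B (7 * p * M / B) ⟩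
        2 * (7 * p * M / B * B)  ≤⟨ *-monoʳ-≤ 2 (m/n*n≤m (7 * p * M) B) ⟩
        2 * (7 * p * M)  ≡⟨ ring' p M ⟩
        14 * p * M  ∎
        where
        ring : ∀ B q → B * (2 * q) ≡ 2 * (q * B)
        ring = ℕ-solve
        ring' : ∀ p M → 2 * (7 * p * M) ≡ 14 * p * M
        ring' = ℕ-solve

  module Providers (B : ℕ) .{{B≢0 : NonZero B}} (B<p : B < p) where
    open Diameter B B<p

    module _ {Y : ℤ → ℤ → Bool} (per : PeriodicSet Y) (ℓ : List E) (x y : E → ℤ) (β M : ℕ) (long : N * β < length ℓ)
             (near : ∀ e e' → e ∈ ℓ → e' ∈ ℓ → lam Y (x e -' x e') (y e -' y e') ≤ M) where
      open Seminorm (lam-seminorm per)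

      private
        β<length : 1 * β < length ℓ
        β<length = ≤-<-trans (β≤Nβ β) long

      -- A union of vertical lines is unchanged by vertical translations. Hence one nonzero
      -- horizontal difference suffices for a basis, and the vertical axis is a line of cost 0 for
      -- `quotient-diameter`.
      rich-line : (∀ u v v' → Y u v ≡ Y u v') → (∀ e → count (λ e' → δ (x e) (x e')) ℓ ≤ β) → Rich B Y M
      rich-line vertical light with independent (λ e e' → δ (x e) (x e')) (λ e e' → δ-sym _ _) β 1 ℓ light β<length
      ... | g , g∈ , g-good = rich B M (≤-trans (≤-reflexive (trans (lam-Y' 1ℤ 0ℤ) (trans (cong₂ (lam Y) (ring₁ d 0ℤ) refl) (lam-vertical d _ _)))) (near e₁ e₀ (g∈ _) (g∈ _)))
            (≤-trans (≤-reflexive (trans (lam-Y' 0ℤ 1ℤ) (trans (cong₂ (lam Y) (ring₂ d 0ℤ) refl) (trans (lam-vertical 0ℤ _ 0ℤ) null)))) z≤n)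
            (λ u v → ≤-trans (≤-reflexive (cong (B *_) (lam-Y' u v))) (≤-trans (diam _ _) (*-monoˡ-≤ M (*-monoˡ-≤ p (s≤s (s≤s (z≤n {5})))))))
        where
        e₀ = g zero
        e₁ = g (suc zero)
        d = x e₁ -' x e₀
        lam-vertical : ∀ a b b' → lam Y a b ≡ lam Y a b'
        lam-vertical a b b' = S₂-cong λ u v → cong (λ t → ⟦ Y u v ∧ not t ⟧) (vertical (u +' a) (v +' b) (v +' b'))
        ring₁ : ∀ d s → d *' 1ℤ +' 0ℤ *' s ≡ d
        ring₁ = ℤ-solve
        ring₂ : ∀ d s → d *' 0ℤ +' 0ℤ *' 1ℤ ≡ 0ℤ
        ring₂ = ℤ-solve
        ring₃ : ∀ d → d -' 0ℤ ≡ 1ℤ *' ((d *' 1ℤ -' 0ℤ *' 0ℤ) -' 0ℤ)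
        ring₃ = ℤ-solve
        ring₄ : ∀ s t → t -' s ≡ (-' 1ℤ) *' ((s -' t) -' 0ℤ)
        ring₄ = ℤ-solve
        d≢0 : ¬ (d *' 1ℤ -' 0ℤ *' 0ℤ ≋ 0ℤ)
        d≢0 h = δ-false⁻¹ (g-good zero (suc zero) λ ()) (lin₁ (-' 1ℤ) (lin₁ {d} {0ℤ} 1ℤ h (ring₃ d)) (ring₄ (x e₁) (x e₀)))
        open Basis per d 0ℤ 0ℤ 1ℤ d≢0
        diam : ∀ u v → B * lam Y u v ≤ 2 * p * M
        diam = quotient-diameter (lam-seminorm per) ℓ x (λ _ → 0ℤ) β M long
          (λ e e' e∈ e'∈ → ≤-trans (≤-reflexive (lam-vertical _ _ _)) (near e e' e∈ e'∈))
          0 0ℤ 1ℤ 0ℤ 1ℤ ≋-refl (λ j → ≤-reflexive (trans (cong (B *_) (trans (cong₂ (lam Y) (ℤP.*-zeroʳ j) refl) (trans (lam-vertical 0ℤ _ 0ℤ) null))) (*-zeroʳ B)))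
          (λ e → ≤-trans (count-mono ℓ λ e' h → δ-true (lin₁ (-' 1ℤ) (δ-sound h) (ring₅ (x e) (x e')))) (light e))
          where
          ring₅ : ∀ s t → s -' t ≡ (-' 1ℤ) *' ((0ℤ *' 0ℤ -' 1ℤ *' s) -' (0ℤ *' 0ℤ -' 1ℤ *' t))
          ring₅ = ℤ-solve

      -- Three elements not on a line give the basis: two differ in x, and the line through them is
      -- too light to hold the whole list. Lightness passes to the new coordinates because each
      -- nonzero form in them is a nonzero form in the old ones.
      rich-plane : Light x y β ℓ → Rich B Y M
      rich-plane light with independent (λ e e' → δ (x e) (x e')) (λ e e' → δ-sym _ _) β 1 ℓ (light-x x y ℓ light) β<length
      ... | g , g∈ , g-good = from-third (∃-false (λ e → δ (α *' x e₀ +' γ *' y e₀) (α *' x e +' γ *' y e)) ℓ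
              (≤-<-trans (≤-trans (light α γ (λ (_ , h) → γ≢0 h) e₀) (≤-reflexive (sym (*-identityˡ β)))) β<length))
        where
        e₀ = g zero
        e₁ = g (suc zero)
        α = y e₁ -' y e₀
        γ = x e₀ -' x e₁
        γ≢0 : ¬ γ ≋ 0ℤ
        γ≢0 h = δ-false⁻¹ (g-good zero (suc zero) λ ()) (lin₁ 1ℤ h (ring (x e₀) (x e₁)))
          where
          ring : ∀ s t → s -' t ≡ 1ℤ *' ((s -' t) -' 0ℤ)
          ring = ℤ-solve
        from-third : (∃ λ e₂ → e₂ ∈ ℓ × δ (α *' x e₀ +' γ *' y e₀) (α *' x e₂ +' γ *' y e₂) ≡ false) → Rich B Y M
        from-third (e₂ , e₂∈ , off) = from-inverse (≋-inverse _ det≢0)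
          where
          p₁ = x e₁ -' x e₀
          q₁ = y e₁ -' y e₀
          p₂ = x e₂ -' x e₀
          q₂ = y e₂ -' y e₀
          det≢0 : ¬ (p₁ *' q₂ -' p₂ *' q₁ ≋ 0ℤ)
          det≢0 h = δ-false⁻¹ off (lin₁ 1ℤ h (ring (x e₀) (x e₁) (x e₂) (y e₀) (y e₁) (y e₂)))
            where
            ring : ∀ x₀ x₁ x₂ y₀ y₁ y₂ → ((y₁ -' y₀) *' x₀ +' (x₀ -' x₁) *' y₀) -' ((y₁ -' y₀) *' x₂ +' (x₀ -' x₁) *' y₂) ≡
                   1ℤ *' (((x₁ -' x₀) *' (y₂ -' y₀) -' (x₂ -' x₀) *' (y₁ -' y₀)) -' 0ℤ)
            ring = ℤ-solve
          open Basis per p₁ q₁ p₂ q₂ det≢0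
          from-inverse : (∃ λ i → i *' (p₁ *' q₂ -' p₂ *' q₁) ≋ 1ℤ) → Rich B Y M
          from-inverse (i , iD≋1) = rich B M h₁ h₂ (plane-diameter (lam-seminorm Y'-per) ℓ x' y' β M long near' h₁ h₂ light')
            where
            x' y' : _ → ℤ
            x' e = i *' (q₂ *' x e -' p₂ *' y e)
            y' e = i *' (p₁ *' y e -' q₁ *' x e)
            h₁ : lam Y' 1ℤ 0ℤ ≤ M
            h₁ = ≤-trans (≤-reflexive (trans (lam-Y' 1ℤ 0ℤ) (cong₂ (lam Y) (ring p₁ p₂) (ring q₁ q₂)))) (near e₁ e₀ (g∈ _) (g∈ _))
              where
              ring : ∀ s t → s *' 1ℤ +' t *' 0ℤ ≡ s
              ring = ℤ-solve
            h₂ : lam Y' 0ℤ 1ℤ ≤ M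
            h₂ = ≤-trans (≤-reflexive (trans (lam-Y' 0ℤ 1ℤ) (cong₂ (lam Y) (ring p₁ p₂) (ring q₁ q₂)))) (near e₂ e₀ e₂∈ (g∈ _))
              where
              ring : ∀ s t → s *' 0ℤ +' t *' 1ℤ ≡ t
              ring = ℤ-solve
            near' : ∀ e e' → e ∈ ℓ → e' ∈ ℓ → lam Y' (x' e -' x' e') (y' e -' y' e') ≤ M
            near' e e' e∈ e'∈ = ≤-trans (≤-reflexive (trans (lam-Y' _ _) (per≋
                (lin₁ (x e -' x e') iD≋1 (ring₁ i p₁ q₁ p₂ q₂ (x e) (y e) (x e') (y e')))
                (lin₁ (y e -' y e') iD≋1 (ring₂ i p₁ q₁ p₂ q₂ (x e) (y e) (x e') (y e')))))) (near e e' e∈ e'∈)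
              where
              ring₁ : ∀ i p₁ q₁ p₂ q₂ x y x' y' → (p₁ *' (i *' (q₂ *' x -' p₂ *' y) -' i *' (q₂ *' x' -' p₂ *' y')) +' p₂ *' (i *' (p₁ *' y -' q₁ *' x) -' i *' (p₁ *' y' -' q₁ *' x'))) -' (x -' x') ≡
                      (x -' x') *' (i *' (p₁ *' q₂ -' p₂ *' q₁) -' 1ℤ)
              ring₁ = ℤ-solve
              ring₂ : ∀ i p₁ q₁ p₂ q₂ x y x' y' → (q₁ *' (i *' (q₂ *' x -' p₂ *' y) -' i *' (q₂ *' x' -' p₂ *' y')) +' q₂ *' (i *' (p₁ *' y -' q₁ *' x) -' i *' (p₁ *' y' -' q₁ *' x'))) -' (y -' y') ≡
                      (y -' y') *' (i *' (p₁ *' q₂ -' p₂ *' q₁) -' 1ℤ)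
              ring₂ = ℤ-solve
            light' : Light x' y' β ℓ
            light' a c ac≢0 e = ≤-trans (count-mono ℓ λ e' h → δ-true (lin₁ 1ℤ (δ-sound h) (ring₁ a c i p₁ q₁ p₂ q₂ (x e) (y e) (x e') (y e'))))
                (light (i *' (a *' q₂ -' c *' q₁)) (i *' (c *' p₁ -' a *' p₂)) (λ (h , k) → ac≢0 (back h k)) e)
              where
              ring₁ : ∀ a c i p₁ q₁ p₂ q₂ x y x' y' →
                      (i *' (a *' q₂ -' c *' q₁) *' x +' i *' (c *' p₁ -' a *' p₂) *' y) -' (i *' (a *' q₂ -' c *' q₁) *' x' +' i *' (c *' p₁ -' a *' p₂) *' y') ≡
                      1ℤ *' ((a *' (i *' (q₂ *' x -' p₂ *' y)) +' c *' (i *' (p₁ *' y -' q₁ *' x))) -' (a *' (i *' (q₂ *' x' -' p₂ *' y')) +' c *' (i *' (p₁ *' y' -' q₁ *' x'))))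
              ring₁ = ℤ-solve
              back : i *' (a *' q₂ -' c *' q₁) ≋ 0ℤ → i *' (c *' p₁ -' a *' p₂) ≋ 0ℤ → a ≋ 0ℤ × c ≋ 0ℤ
              back h k = ≋-trans (lin₁ (-' a) iD≋1 (ring₀ a (i *' (p₁ *' q₂ -' p₂ *' q₁)))) (lin₂ p₁ q₁ h k (ring₂ a c i p₁ q₁ p₂ q₂)) ,
                         ≋-trans (lin₁ (-' c) iD≋1 (ring₀ c (i *' (p₁ *' q₂ -' p₂ *' q₁)))) (lin₂ p₂ q₂ h k (ring₃ a c i p₁ q₁ p₂ q₂))
                where
                ring₀ : ∀ a D → a -' a *' D ≡ (-' a) *' (D -' 1ℤ)
                ring₀ = ℤ-solve
                ring₂ : ∀ a c i p₁ q₁ p₂ q₂ → a *' (i *' (p₁ *' q₂ -' p₂ *' q₁)) -' 0ℤ ≡ p₁ *' (i *' (a *' q₂ -' c *' q₁) -' 0ℤ) +' q₁ *' (i *' (c *' p₁ -' a *' p₂) -' 0ℤ)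
                ring₂ = ℤ-solve
                ring₃ : ∀ a c i p₁ q₁ p₂ q₂ → c *' (i *' (p₁ *' q₂ -' p₂ *' q₁)) -' 0ℤ ≡ p₂ *' (i *' (a *' q₂ -' c *' q₁) -' 0ℤ) +' q₂ *' (i *' (c *' p₁ -' a *' p₂) -' 0ℤ)
                ring₃ = ℤ-solve

-- Growing sums of two-element sets until they fill the plane.

module Sumsets (p : ℕ) (pr : Prime p) where
  open Lists
  open Directions p pr public

  S₂-one : S₂ (λ _ _ → 1) ≡ p * p
  S₂-one = trans (S₂-product (λ _ → 1) (λ _ → 1)) (cong₂ _*_ one one)
    where
    one : S₁ (λ _ → 1) ≡ p
    one = trans (Σ<-const p 1) (*-identityʳ p)

  Σ<-positive : ∀ n f → 0 < Σ< n f → ∃ λ i → 0 < f i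
  Σ<-positive (suc n) f h with f n in eq
  ... | suc _ = n , subst (0 <_) (sym eq) (s≤s z≤n)
  ... | zero  = Σ<-positive n f h

  opaque
    unfolding S₂
    S₂-positive : ∀ F → 0 < S₂ F → ∃₂ λ u v → 0 < F u v
    S₂-positive F h with Σ<-positive p _ h
    ... | i , h' with Σ<-positive p _ h'
    ... | j , h″ = + i , + j , h″

  -- `Y` and the reflected set (u , v) - `Z` have together more than p² points, so they meet.
  sum-of-large : ∀ {Y Z} → PeriodicSet Y → PeriodicSet Z → p * p < card Y + card Z →
                 ∀ u v → ∃₂ λ u' v' → Y u' v' ≡ true × Z (u -' u') (v -' v') ≡ true
  sum-of-large {Y} {Z} perY perZ large u v with S₂-positive (λ x y → ⟦ Y x y ∧ Z (u -' x) (v -' y) ⟧) positive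
    where
    open ≤-Reasoning
    reflected : S₂ (λ x y → ⟦ Z (u -' x) (v -' y) ⟧) ≡ card Z
    reflected = trans (S₂-cong λ x y → cong₂ (λ s t → ⟦ Z s t ⟧) (ring₁ u x y) (ring₂ v x y))
      (trans (S₂-linear { -' 1ℤ} {0ℤ} {0ℤ} { -' 1ℤ} det≢0 {λ x y → ⟦ Z (x +' u) (y +' v) ⟧} (λ h k → cong ⟦_⟧ (perZ (+-≋ h ≋-refl) (+-≋ k ≋-refl))))
        (card-shift perZ u v))
      where
      det≢0 : ¬ (1ℤ ≋ 0ℤ)
      det≢0 h = <⇒≢ (s≤s z≤n) (sym (≋⇒≡ 1<p (>-nonZero⁻¹ p) h))
      ring₁ : ∀ u x y → u -' x ≡ ((-' 1ℤ) *' x +' 0ℤ *' y) +' u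
      ring₁ = ℤ-solve
      ring₂ : ∀ v x y → v -' y ≡ (0ℤ *' x +' (-' 1ℤ) *' y) +' v
      ring₂ = ℤ-solve
    positive : 0 < S₂ (λ x y → ⟦ Y x y ∧ Z (u -' x) (v -' y) ⟧)
    positive = +-cancelˡ-< (p * p) 0 _ (begin-strict
      p * p + 0  ≡⟨ +-identityʳ _ ⟩
      p * p  <⟨ large ⟩
      card Y + card Z  ≡⟨ cong (λ t → card Y + t) (sym reflected) ⟩
      card Y + S₂ (λ x y → ⟦ Z (u -' x) (v -' y) ⟧)  ≡⟨ sym (S₂-+ _ _) ⟩
      S₂ (λ x y → ⟦ Y x y ⟧ + ⟦ Z (u -' x) (v -' y) ⟧)  ≡⟨ S₂-cong (λ x y → sym (⟦∨⟧+⟦∧⟧ (Y x y) (Z (u -' x) (v -' y)))) ⟩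
      S₂ (λ x y → ⟦ Y x y ∨ Z (u -' x) (v -' y) ⟧ + ⟦ Y x y ∧ Z (u -' x) (v -' y) ⟧) ≡⟨ S₂-+ _ _ ⟩
      S₂ (λ x y → ⟦ Y x y ∨ Z (u -' x) (v -' y) ⟧) + S₂ (λ x y → ⟦ Y x y ∧ Z (u -' x) (v -' y) ⟧)
        ≤⟨ +-monoˡ-≤ _ (≤-trans (S₂-mono λ x y → ⟦⟧≤1 (Y x y ∨ Z (u -' x) (v -' y))) (≤-reflexive S₂-one)) ⟩
      p * p + S₂ (λ x y → ⟦ Y x y ∧ Z (u -' x) (v -' y) ⟧) ∎)
  ... | u' , v' , h with Y u' v' in eq
  ... | true = u' , v' , eq , ⟦⟧-positive _ h

  Σᶻ : {E : Set} → (E → ℤ) → List E → ℤ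
  Σᶻ f []       = 0ℤ
  Σᶻ f (e ∷ es) = f e +' Σᶻ f es

  Σᶻ-++ : ∀ {E : Set} (f : E → ℤ) xs ys → Σᶻ f (xs ++ ys) ≡ Σᶻ f xs +' Σᶻ f ys
  Σᶻ-++ f []       ys = sym (ℤP.+-identityˡ _)
  Σᶻ-++ f (x ∷ xs) ys = trans (cong (f x +'_) (Σᶻ-++ f xs ys)) (sym (ℤP.+-assoc (f x) _ _))

  Σᶻ-↭ : ∀ {E : Set} (f : E → ℤ) {xs ys} → xs ↭ ys → Σᶻ f xs ≡ Σᶻ f ys
  Σᶻ-↭ f refl         = refl
  Σᶻ-↭ f (prep x h)   = cong (f x +'_) (Σᶻ-↭ f h)
  Σᶻ-↭ f (swap x y h) = trans (cong (λ t → f x +' (f y +' t)) (Σᶻ-↭ f h)) (exchange (f x) (f y) _)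
    where
    exchange : ∀ a b c → a +' (b +' c) ≡ b +' (a +' c)
    exchange = ℤ-solve
  Σᶻ-↭ f (_↭_.trans h k) = trans (Σᶻ-↭ f h) (Σᶻ-↭ f k)

  private
    -- Unless H c already reaches (t + 1)², take k = ⌊t/10⌋. Then 200 c ≤ H c < (t + 1)² ≤ 100 (k +
    -- 1)² admits the box of side k + 1. From c ≤ 4 k G follows 10 t ≤ 4 H G, and t ≥ 10 turns this
    -- into 2 t + 1 ≤ H G.
    start-arith : ∀ c G t → 1 ≤ c → t * t ≤ H * c → t < p → (∀ k → k < p → 2 * c ≤ suc k * suc k → c ≤ 4 * k * G) → suc t * suc t ≤ H * (c + G)
    start-arith c G t 1≤c tt≤ t<p rich with suc t * suc t ≤? H * c
    ... | yes h = ≤-trans h (*-monoʳ-≤ H (m≤m+n c G))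
    ... | no  h = main t t<p tt≤ (≰⇒> h)
      where
      open ≤-Reasoning
      main : ∀ t → t < p → t * t ≤ H * c → H * c < suc t * suc t → suc t * suc t ≤ H * (c + G)
      main t t<p tt≤ small = final t k≤ (rich k (≤-<-trans (m/n≤m t 10) t<p) (*-cancelˡ-≤ 100 (begin
          100 * (2 * c)  ≤⟨ ≤-trans (≤-reflexive (sym (*-assoc 100 2 c))) (*-monoˡ-≤ c 200≤H) ⟩
          H * c  ≤⟨ <⇒≤ small ⟩
          suc t * suc t  ≤⟨ *-mono-≤ t<10k t<10k ⟩
          10 * suc k * (10 * suc k)  ≡⟨ ring (suc k) ⟩
          100 * (suc k * suc k)  ∎))) tt≤
        where
        k = t / 10
        k≤ : 10 * k ≤ t
        k≤ = ≤-trans (≤-reflexive (*-comm 10 k)) (m/n*n≤m t 10)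
        t<10k : suc t ≤ 10 * suc k
        t<10k = begin-strict
          t  ≡⟨ m≡m%n+[m/n]*n t 10 ⟩
          t % 10 + k * 10  <⟨ +-monoˡ-< (k * 10) (m%n<n t 10) ⟩
          suc k * 10  ≡⟨ *-comm (suc k) 10 ⟩
          10 * suc k  ∎
        ring : ∀ s → 10 * s * (10 * s) ≡ 100 * (s * s)
        ring = ℕ-solve
        final : ∀ t → 10 * k ≤ t → c ≤ 4 * k * G → t * t ≤ H * c → suc t * suc t ≤ H * (c + G)
        final t 10k≤t c≤ tt≤ = by-≤ (suc t * suc t) (H * (c + G)) 0 (+-mono-≤ tt≤ (linear t 10k≤t c≤ tt≤)) (ring₁ H t c G)
          where
          ring₁ : ∀ H t c G → suc t * suc t + (H * c + H * G) + 0 ≡ H * (c + G) + (t * t + (2 * t + 1))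
          ring₁ = ℕ-solve
          k≥1 : ∀ {k} → c ≤ 4 * k * G → 1 ≤ k
          k≥1 {zero}  h = ⊥-elim (<⇒≱ 1≤c h)
          k≥1 {suc _} h = s≤s z≤n
          linear : ∀ t → 10 * k ≤ t → c ≤ 4 * k * G → t * t ≤ H * c → 2 * t + 1 ≤ H * G
          linear t@(suc _) 10k≤t c≤ tt≤ = *-cancelˡ-≤ 4 (begin
            4 * (2 * t + 1)  ≡⟨ ring₂ t ⟩
            8 * t + 4  ≤⟨ +-monoʳ-≤ (8 * t) (≤-trans (m≤m+n 4 16) (*-monoʳ-≤ 2 (≤-trans (*-monoʳ-≤ 10 (k≥1 {k} c≤)) 10k≤t))) ⟩
            8 * t + 2 * t  ≡⟨ ring₃ t ⟩
            10 * t  ≤⟨ *-cancelˡ-≤ t (begin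
                t * (10 * t)  ≡⟨ ring₄ t ⟩
                10 * (t * t)  ≤⟨ *-monoʳ-≤ 10 (≤-trans tt≤ (*-monoʳ-≤ H c≤)) ⟩
                10 * (H * (4 * k * G))  ≡⟨ ring₅ H k G ⟩
                10 * k * (4 * (H * G))  ≤⟨ *-monoˡ-≤ _ 10k≤t ⟩
                t * (4 * (H * G))  ∎) ⟩
            4 * (H * G)  ∎)
            where
            ring₂ : ∀ t → 4 * (2 * t + 1) ≡ 8 * t + 4
            ring₂ = ℕ-solve
            ring₃ : ∀ t → 8 * t + 2 * t ≡ 10 * t
            ring₃ = ℕ-solve
            ring₄ : ∀ t → t * (10 * t) ≡ 10 * (t * t)
            ring₄ = ℕ-solve
            ring₅ : ∀ H k G → 10 * (H * (4 * k * G)) ≡ 10 * k * (4 * (H * G))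
            ring₅ = ℕ-solve
          linear zero 10k≤t c≤ tt≤ = ⊥-elim (<⇒≱ (k≥1 {k} c≤) (*-cancelˡ-≤ 10 10k≤t))

  private
    regroup : ∀ u s t → u -' (s +' t) ≋ (u -' s) -' t
    regroup u s t = ≋-reflexive (ring u s t)
      where
      ring : ∀ u s t → u -' (s +' t) ≡ (u -' s) -' t
      ring = ℤ-solve

  module _ {E : Set} (x y : E → ℤ) (I : ℤ → ℤ → Bool) where

    -- The set `I` plus the sum of the two-element sets. `I` will be the origin for sums in the
    -- plane, and the axis x ≡ 0 when only the sum of x matters.
    grown : List (E × E) → ℤ → ℤ → Bool
    grown []             u v = I u v
    grown ((a , b) ∷ ps) u v = grown ps (u -' x a) (v -' y a) ∨ grown ps (u -' x b) (v -' y b)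

    grown-per : PeriodicSet I → ∀ ps → PeriodicSet (grown ps)
    grown-per per []             h k = per h k
    grown-per per ((a , b) ∷ ps) h k = cong₂ _∨_ (grown-per per ps (sub-≋ h ≋-refl) (sub-≋ k ≋-refl)) (grown-per per ps (sub-≋ h ≋-refl) (sub-≋ k ≋-refl))

    grown-vertical : (∀ u v v' → I u v ≡ I u v') → ∀ ps u v v' → grown ps u v ≡ grown ps u v'
    grown-vertical vert []             u v v' = vert u v v'
    grown-vertical vert ((a , b) ∷ ps) u v v' = cong₂ _∨_ (grown-vertical vert ps _ _ _) (grown-vertical vert ps _ _ _)

    grown-sound : PeriodicSet I → ∀ ps u v → grown ps u v ≡ true → ∃ λ c → Choice ps c × I (u -' Σᶻ x c) (v -' Σᶻ y c) ≡ true
    grown-sound per []             u v h = [] , [] , trans (per (≋-reflexive (ℤP.+-identityʳ u)) (≋-reflexive (ℤP.+-identityʳ v))) h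
    grown-sound per ((a , b) ∷ ps) u v h with grown ps (u -' x a) (v -' y a) in eq
    ... | true with grown-sound per ps _ _ eq
    ... | c , ch , i = a ∷ c , left ch , trans (per (regroup u (x a) (Σᶻ x c)) (regroup v (y a) (Σᶻ y c))) i
    grown-sound per ((a , b) ∷ ps) u v h | false with grown-sound per ps _ _ h
    ... | c , ch , i = b ∷ c , right ch , trans (per (regroup u (x b) (Σᶻ x c)) (regroup v (y b) (Σᶻ y c))) i

  module Constants (n₁ : ℕ) .{{n₁≢0 : NonZero n₁}} (n₁≤p : n₁ ≤ p) where

    Γ B T : ℕ
    Γ = 4 * H * n₁ * n₁
    B = growth-constant n₁
    T = p / n₁

    private
      Γ≢0 : NonZero Γ
      Γ≢0 = m*n≢0 (4 * H * n₁) n₁ {{m*n≢0 (4 * H) n₁ {{m*n≢0 4 H {{_}} {{H≢0}}}}}}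
      14Γ≢0 : NonZero (14 * Γ)
      14Γ≢0 = m*n≢0 14 Γ {{_}} {{Γ≢0}}

    B-nonZero : NonZero B
    B-nonZero = m*n≢0 (14 * Γ) n₁ {{14Γ≢0}}

    p<2Tn : p < 2 * (T * n₁)
    p<2Tn = begin-strict
      p  ≡⟨ m≡m%n+[m/n]*n p n₁ ⟩
      p % n₁ + T * n₁  <⟨ +-monoˡ-< (T * n₁) (m%n<n p n₁) ⟩
      n₁ + T * n₁  ≤⟨ +-monoˡ-≤ (T * n₁) (m≤n*m n₁ T {{T≢0}}) ⟩
      T * n₁ + T * n₁  ≡⟨ cong (λ t → T * n₁ + t) (sym (+-identityʳ _)) ⟩
      2 * (T * n₁)  ∎
      where
      open ≤-Reasoning
      T≢0 : NonZero T
      T≢0 = >-nonZero (m≥n⇒m/n>0 n₁≤p)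

    -- T² ≤ H c makes c a fixed proportion of p², since p < 2 T n₁; `B` is chosen so that the gain
    -- is then at least n₁ p.
    linear : ∀ c G → T * T ≤ H * c → B * c ≤ 14 * p * G → n₁ * p ≤ G
    linear c G TT≤ Bc≤ = *-cancelˡ-≤ (14 * Γ * p) {{m*n≢0 (14 * Γ) p {{14Γ≢0}}}} (begin
      14 * Γ * p * (n₁ * p)  ≡⟨ ring₁ Γ n₁ p ⟩
      14 * Γ * n₁ * (p * p)  ≤⟨ *-monoʳ-≤ B (*-mono-≤ (<⇒≤ p<2Tn) (<⇒≤ p<2Tn)) ⟩
      14 * Γ * n₁ * (2 * (T * n₁) * (2 * (T * n₁)))  ≡⟨ ring₂ B T n₁ ⟩
      B * (4 * n₁ * n₁ * (T * T))  ≤⟨ *-monoʳ-≤ B (*-monoʳ-≤ (4 * n₁ * n₁) TT≤) ⟩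
      B * (4 * n₁ * n₁ * (H * c))  ≡⟨ ring₃ H B n₁ c ⟩
      4 * H * n₁ * n₁ * (B * c)  ≤⟨ *-monoʳ-≤ Γ Bc≤ ⟩
      Γ * (14 * p * G)  ≡⟨ ring₄ Γ p G ⟩
      14 * Γ * p * G  ∎)
      where
      open ≤-Reasoning
      ring₁ : ∀ Γ n p → 14 * Γ * p * (n * p) ≡ 14 * Γ * n * (p * p)
      ring₁ = ℕ-solve
      ring₂ : ∀ B T n → B * (2 * (T * n) * (2 * (T * n))) ≡ B * (4 * n * n * (T * T))
      ring₂ = ℕ-solve
      ring₃ : ∀ H B n c → B * (4 * n * n * (H * c)) ≡ 4 * H * n * n * (B * c)
      ring₃ = ℕ-solve
      ring₄ : ∀ Γ p G → Γ * (14 * p * G) ≡ 14 * Γ * p * G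
      ring₄ = ℕ-solve

  -- `Good` bounds the concentration of a list and passes to what is left after removing pairs. `s`
  -- elements must still be left at every step for `provide` to apply.
  module Growth (B T n₁ : ℕ) .{{B≢0 : NonZero B}} (T≤p : T ≤ p) (p<2Tn : p < 2 * (T * n₁))
                (linear : ∀ c G → T * T ≤ H * c → B * c ≤ 14 * p * G → n₁ * p ≤ G) {E : Set} (x y : E → ℤ) (I : ℤ → ℤ → Bool)
                (I-per : PeriodicSet I) (I-inhabited : 1 ≤ card I)
                (Good : List E → Set) (Good-++ : ∀ {ℓ xs ys} → ℓ ↭ xs ++ ys → Good ℓ → Good ys) (s : ℕ) where

    Y : List (E × E) → ℤ → ℤ → Bool
    Y = grown x y I

    Y-per : ∀ ps → PeriodicSet (Y ps)
    Y-per = grown-per x y I I-per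

    module _ (provide : ∀ ℓ → Good ℓ → s ≤ length ℓ → ∀ ps M →
                        (∀ e e' → e ∈ ℓ → e' ∈ ℓ → lam (Y ps) (x e -' x e') (y e -' y e') ≤ M) → Rich B (Y ps) M) where

      Round : List E → Set
      Round ℓ = ∃₂ λ ps rest → ℓ ↭ flat ps ++ rest × length ps ≤ 2 * T × p * p < 2 * card (Y ps)

      -- The gain of the best pair bounds `lam` on all differences of the remaining elements, so it
      -- can serve as the M of `Rich`. If every gain were 0, `main` with M = 0 would make the set
      -- empty.
      grow-step : ∀ ps ℓ → Good ℓ → s ≤ length ℓ → 1 ≤ card (Y ps) → 2 * card (Y ps) ≤ p * p →
                  ∃ λ a → ∃ λ b → ∃ λ ℓ' → ℓ ↭ a ∷ b ∷ ℓ' × Rich B (Y ps) (lam (Y ps) (x a -' x b) (y a -' y b))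
      grow-step ps ℓ good long 1≤c half
        with best-pair (λ a b → lam (Y ps) (x a -' x b) (y a -' y b)) (λ e → trans (cong₂ (lam (Y ps)) (ℤP.+-inverseʳ (x e)) (ℤP.+-inverseʳ (y e))) (Seminorm.null (lam-seminorm (Y-per ps))))
               (card (Y ps)) ℓ (λ a b _ _ → ≤-trans (m≤m+n _ _) (≤-reflexive (lam+overlap (Y-per ps) _ _)))
      ... | inj₁ (a , b , ℓ' , perm , best) = a , b , ℓ' , perm , provide ℓ good long ps _ best
      ... | inj₂ none = ⊥-elim (<⇒≱ 1≤c (*-cancelˡ-≤ B
              (≤-trans (Rich.main (provide ℓ good long ps 0 none) half) (≤-reflexive (trans (*-zeroʳ (14 * p)) (sym (*-zeroʳ B)))))))

      module _ (ℓ₀ : List E) (good₀ : Good ℓ₀) (long₀ : s + 4 * T ≤ length ℓ₀) where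

        -- A set that has passed p²/2 is kept unchanged; hence the alternative in `size` and the
        -- inequality in `bound`.
        record Stage (t : ℕ) (P : ℕ → Set) : Set where
          constructor stage
          field
            ps    : List (E × E)
            rest  : List E
            perm  : ℓ₀ ↭ flat ps ++ rest
            bound : length ps ≤ t
            size  : P (card (Y ps)) ⊎ p * p < 2 * card (Y ps)

        private
          advance : ∀ {t P P'} → t ≤ 2 * T → (∀ {c} → P c → 1 ≤ c) →
                    (∀ c G → P c → 2 * c ≤ p * p → (∀ k → k < p → 2 * c ≤ suc k * suc k → c ≤ 4 * k * G) → (2 * c ≤ p * p → B * c ≤ 14 * p * G) → P' (c + G)) →
                    Stage t P → Stage (suc t) P'
          advance t≤2T pos next (stage ps rest perm bound (inj₂ full)) = stage ps rest perm (m≤n⇒m≤1+n bound) (inj₂ full)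
          advance {t} {P} {P'} t≤2T pos next (stage ps rest perm bound (inj₁ Pc)) with 2 * card (Y ps) ≤? p * p
          ... | no ¬half = stage ps rest perm (m≤n⇒m≤1+n bound) (inj₂ (≰⇒> ¬half))
          ... | yes half with grow-step ps rest (Good-++ perm good₀) long (pos Pc) half
            where
            long : s ≤ length rest
            long = +-cancelʳ-≤ (4 * T) s (length rest) (begin
              s + 4 * T  ≤⟨ long₀ ⟩
              length ℓ₀  ≡⟨ trans (↭-length perm) (length-++ (flat ps)) ⟩
              length (flat ps) + length rest  ≡⟨ cong (_+ length rest) (length-flat ps) ⟩
              2 * length ps + length rest  ≤⟨ +-monoˡ-≤ (length rest) (*-monoʳ-≤ 2 (≤-trans bound t≤2T)) ⟩
              2 * (2 * T) + length rest  ≡⟨ trans (+-comm _ (length rest)) (cong (λ r → length rest + r) (sym (*-assoc 2 2 T))) ⟩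
              length rest + 4 * T  ∎)
              where open ≤-Reasoning
          ... | a , b , ℓ' , perm' , r = stage ((a , b) ∷ ps) ℓ' perm″ (s≤s bound)
                (inj₁ (subst P' (sym (card-∪ (Y-per ps) (x a) (y a) (x b) (y b))) (next _ _ Pc half (Rich.start r) (Rich.main r))))
            where
            perm″ : ℓ₀ ↭ a ∷ b ∷ flat ps ++ ℓ'
            perm″ = ↭-trans perm (↭-trans (++⁺ˡ (flat ps) perm') (↭-trans (shift a (flat ps) (b ∷ ℓ')) (prep a (shift b (flat ps) ℓ'))))

          -- Quadratic growth: T steps bring the size to a fixed proportion of p².
          phase₁ : ∀ t → t ≤ T → Stage t (λ c → 1 ≤ c × t * t ≤ H * c)
          phase₁ zero    _   = stage [] ℓ₀ ↭-refl z≤n (inj₁ (I-inhabited , z≤n))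
          phase₁ (suc t) t<T = advance (≤-trans (<⇒≤ t<T) (m≤m+n T _)) proj₁
            (λ c G (1≤c , tt≤) half st _ → ≤-trans 1≤c (m≤m+n c G) , start-arith c G t 1≤c tt≤ (<-≤-trans t<T T≤p) st)
            (phase₁ t (<⇒≤ t<T))

          -- Linear growth: T further steps of gain at least n₁ p, which add up to more than p²/2.
          phase₂ : ∀ t → t ≤ T → Stage (t + T) (λ c → (1 ≤ c × T * T ≤ H * c) × t * (n₁ * p) ≤ c)
          phase₂ zero    _   with phase₁ T ≤-refl
          ... | stage ps rest perm bound (inj₁ h) = stage ps rest perm bound (inj₁ (h , z≤n))
          ... | stage ps rest perm bound (inj₂ h) = stage ps rest perm bound (inj₂ h)
          phase₂ (suc t) t<T = advance (+-mono-≤ (<⇒≤ t<T) (≤-reflexive (sym (+-identityʳ T)))) (proj₁ ∘ proj₁)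
            (λ c G ((1≤c , TT≤) , lin) half _ mn → (≤-trans 1≤c (m≤m+n c G) , ≤-trans TT≤ (*-monoʳ-≤ H (m≤m+n c G))) ,
              ≤-trans (+-mono-≤ (linear c G TT≤ (mn half)) lin) (≤-reflexive (+-comm G c)))
            (phase₂ t (<⇒≤ t<T))

        round : Round ℓ₀
        round with phase₂ T ≤-refl
        ... | stage ps rest perm bound size = ps , rest , perm , ≤-trans bound (≤-reflexive (cong (λ t → T + t) (sym (+-identityʳ T)))) , full size
          where
          full : _ → p * p < 2 * card (Y ps)
          full (inj₂ h) = h
          full (inj₁ (_ , h)) = <-≤-trans (*-monoˡ-< p p<2Tn) (≤-trans (≤-reflexive (ring T n₁ p)) (*-monoʳ-≤ 2 h))
            where
            ring : ∀ T n p → 2 * (T * n) * p ≡ 2 * (T * (n * p))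
            ring = ℕ-solve

      module _ (I-+ : ∀ a b c d → I a b ≡ true → I c d ≡ true → I (a +' c) (b +' d) ≡ true) where

        Hit : List (E × E) → ℤ → ℤ → Set
        Hit ps u v = ∃ λ c → Choice ps c × I (u -' Σᶻ x c) (v -' Σᶻ y c) ≡ true

        Cover : List E → Set
        Cover ℓ = ∃₂ λ ps rest → ℓ ↭ flat ps ++ rest × length ps ≤ 4 * T × (∀ u v → Hit ps u v)

        -- The sum of two grown sets contains two copies of `I`; closure under addition (`I-+`)
        -- merges them into one.
        reach : ∀ ps₁ ps₂ → p * p < card (Y ps₁) + card (Y ps₂) → ∀ u v → Hit (ps₁ ++ ps₂) u v
        reach ps₁ ps₂ large u v = from-sum (sum-of-large {Y ps₁} {Y ps₂} (Y-per ps₁) (Y-per ps₂) large u v)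
          where
          ring : ∀ u u' s t → u -' (s +' t) ≡ (u' -' s) +' ((u -' u') -' t)
          ring = ℤ-solve
          shape : ∀ (f : E → ℤ) u u' c₁ c₂ → u -' Σᶻ f (c₁ ++ c₂) ≋ (u' -' Σᶻ f c₁) +' ((u -' u') -' Σᶻ f c₂)
          shape f u u' c₁ c₂ = ≋-reflexive (trans (cong (λ t → u -' t) (Σᶻ-++ f c₁ c₂)) (ring u u' (Σᶻ f c₁) (Σᶻ f c₂)))
          combine-choices : ∀ u' v' → Hit ps₁ u' v' → Hit ps₂ (u -' u') (v -' v') → Hit (ps₁ ++ ps₂) u v
          combine-choices u' v' (c₁ , ch₁ , i₁) (c₂ , ch₂ , i₂) = c₁ ++ c₂ , choice-++ ch₁ ch₂ ,
            trans (I-per (shape x u u' c₁ c₂) (shape y v v' c₁ c₂))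
              (I-+ (u' -' Σᶻ x c₁) (v' -' Σᶻ y c₁) ((u -' u') -' Σᶻ x c₂) ((v -' v') -' Σᶻ y c₂) i₁ i₂)
          from-sum : (∃₂ λ u' v' → Y ps₁ u' v' ≡ true × Y ps₂ (u -' u') (v -' v') ≡ true) → Hit (ps₁ ++ ps₂) u v
          from-sum (u' , v' , in₁ , in₂) = combine-choices u' v' (grown-sound x y I I-per ps₁ u' v' in₁) (grown-sound x y I I-per ps₂ (u -' u') (v -' v') in₂)

        -- Two rounds on disjoint parts of the list, each spending up to 2T pairs and hence 4T
        -- elements.
        cover : ∀ ℓ → Good ℓ → s + 8 * T ≤ length ℓ → Cover ℓ
        cover ℓ good long = second (round ℓ good (≤-trans (+-monoʳ-≤ s (*-monoˡ-≤ T (m≤m+n 4 4))) long))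
          where
          second : Round ℓ → Cover ℓ
          second (ps₁ , rest₁ , perm₁ , len₁ , big₁) = both (round rest₁ (Good-++ perm₁ good) long₁)
            where
            long₁ : s + 4 * T ≤ length rest₁
            long₁ = +-cancelˡ-≤ (2 * (2 * T)) _ _ (begin
              2 * (2 * T) + (s + 4 * T)  ≡⟨ ring s T ⟩
              s + 8 * T  ≤⟨ long ⟩
              length ℓ  ≡⟨ trans (↭-length perm₁) (length-++ (flat ps₁)) ⟩
              length (flat ps₁) + length rest₁  ≡⟨ cong (_+ length rest₁) (length-flat ps₁) ⟩
              2 * length ps₁ + length rest₁  ≤⟨ +-monoˡ-≤ (length rest₁) (*-monoʳ-≤ 2 len₁) ⟩
              2 * (2 * T) + length rest₁  ∎)
              where
              open ≤-Reasoning
              ring : ∀ s T → 2 * (2 * T) + (s + 4 * T) ≡ s + 8 * T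
              ring = ℕ-solve
            both : Round rest₁ → Cover ℓ
            both (ps₂ , rest₂ , perm₂ , len₂ , big₂) = ps₁ ++ ps₂ , rest₂ , perm , len , reach ps₁ ps₂ large
              where
              perm : ℓ ↭ flat (ps₁ ++ ps₂) ++ rest₂
              perm = ↭-trans perm₁ (↭-trans (++⁺ˡ (flat ps₁) perm₂) (↭-trans (↭-sym (++-assoc (flat ps₁) (flat ps₂) rest₂))
                (subst (λ t → (flat ps₁ ++ flat ps₂) ++ rest₂ ↭ t ++ rest₂) (sym (flat-++ ps₁ ps₂)) ↭-refl)))
              len : length (ps₁ ++ ps₂) ≤ 4 * T
              len = ≤-trans (≤-reflexive (length-++ ps₁)) (≤-trans (+-mono-≤ len₁ len₂) (≤-reflexive (sym (*-distribʳ-+ T 2 2))))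
              large : p * p < card (Y ps₁) + card (Y ps₂)
              large = *-cancelˡ-< 2 _ _ (begin-strict
                2 * (p * p)  ≡⟨ cong (λ t → p * p + t) (+-identityʳ (p * p)) ⟩
                p * p + p * p  <⟨ +-mono-< big₁ big₂ ⟩
                2 * card (Y ps₁) + 2 * card (Y ps₂)  ≡⟨ sym (*-distribˡ-+ 2 (card (Y ps₁)) (card (Y ps₂))) ⟩
                2 * (card (Y ps₁) + card (Y ps₂))  ∎)
                where open ≤-Reasoning

-- Few pairs whose choices have every sum, in the plane and along a line.

module Covering (p : ℕ) (pr : Prime p) where
  open Lists
  open Sumsets p pr public

  private
    S₁-point : S₁ (λ u → ⟦ δ u 0ℤ ⟧) ≡ 1
    S₁-point = trans (S₁-cong λ u → sym (*-identityʳ ⟦ δ u 0ℤ ⟧)) (S₁-δ 0ℤ {λ _ → 1} (λ _ → refl))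

    δ-+ : ∀ a c → δ a 0ℤ ≡ true → δ c 0ℤ ≡ true → δ (a +' c) 0ℤ ≡ true
    δ-+ a c h k = δ-true (+-≋ (δ-sound {a} h) (δ-sound {c} k))

    δ-difference : ∀ u s → δ (u -' s) 0ℤ ≡ true → s ≋ u
    δ-difference u s h = lin₁ (-' 1ℤ) (δ-sound h) (ring u s)
      where
      ring : ∀ u s → s -' u ≡ (-' 1ℤ) *' ((u -' s) -' 0ℤ)
      ring = ℤ-solve

  module Covers (n₁ : ℕ) .{{n₁≢0 : NonZero n₁}} (B<p : growth-constant n₁ < p) {E : Set} (x y : E → ℤ) (β : ℕ) where

    private
      B : ℕ
      B = growth-constant n₁
      n₁≤p : n₁ ≤ p
      n₁≤p = ≤-trans (m≤n*m n₁ (14 * (4 * H * n₁ * n₁)) {{m*n≢0 14 (4 * H * n₁ * n₁) {{_}} {{m*n≢0 (4 * H * n₁) n₁ {{m*n≢0 (4 * H) n₁ {{m*n≢0 4 H {{_}} {{H≢0}}}}}}}}}}) (<⇒≤ B<p)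
      module C = Constants n₁ n₁≤p
      instance
        B≢0 : NonZero B
        B≢0 = C.B-nonZero
      open Providers B B<p

    Cover : (ℤ → ℤ → List E → Set) → List E → Set
    Cover Hits ℓ = ∃₂ λ ps rest → ℓ ↭ flat ps ++ rest × length ps ≤ 4 * (p / n₁) × (∀ u v → ∃ λ c → Choice ps c × Hits u v c)

    cover-plane : ∀ ℓ → Light x y β ℓ → suc (key-count B * β) + 8 * (p / n₁) ≤ length ℓ →
                  Cover (λ u v c → Σᶻ x c ≋ u × Σᶻ y c ≋ v) ℓ
    cover-plane ℓ light long = finish (G.cover provide I-+ ℓ light long)
      where
      I : ℤ → ℤ → Bool
      I u v = δ u 0ℤ ∧ δ v 0ℤ
      I-per : PeriodicSet I
      I-per h k = cong₂ _∧_ (δ-≋ˡ h) (δ-≋ˡ k)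
      inhabited : 1 ≤ card I
      inhabited = ≤-reflexive (sym (trans (S₂-cong λ u v → ⟦∧⟧ (δ u 0ℤ) (δ v 0ℤ)) (trans (S₂-product (λ u → ⟦ δ u 0ℤ ⟧) (λ u → ⟦ δ u 0ℤ ⟧)) (cong₂ _*_ S₁-point S₁-point))))
      I-+ : ∀ a b c d → I a b ≡ true → I c d ≡ true → I (a +' c) (b +' d) ≡ true
      I-+ a b c d h k = cong₂ _∧_ (δ-+ a c (proj₁ (∧-split (δ a 0ℤ) _ h)) (proj₁ (∧-split (δ c 0ℤ) _ k))) (δ-+ b d (proj₂ (∧-split (δ a 0ℤ) _ h)) (proj₂ (∧-split (δ c 0ℤ) _ k)))
      module G = Growth B (p / n₁) n₁ (m/n≤m p n₁) C.p<2Tn C.linear x y I I-per inhabited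
                   (Light x y β) (λ {_} {xs} {ys} perm light α γ αγ≢0 e → ≤-trans (count-++ʳ _ {ys = xs} {zs = ys} perm) (light α γ αγ≢0 e)) (suc (key-count B * β))
      provide : ∀ ℓ → Light x y β ℓ → suc (key-count B * β) ≤ length ℓ → ∀ ps M →
                (∀ e e' → e ∈ ℓ → e' ∈ ℓ → lam (G.Y ps) (x e -' x e') (y e -' y e') ≤ M) → Rich B (G.Y ps) M
      provide ℓ light long ps M near = rich-plane (G.Y-per ps) ℓ x y β M long near light
      finish : G.Cover provide I-+ ℓ → Cover (λ u v c → Σᶻ x c ≋ u × Σᶻ y c ≋ v) ℓ
      finish (ps , rest , perm , len , reach) = ps , rest , perm , len , λ u v → hit u v (reach u v)
        where
        hit : ∀ u v → (∃ λ c → Choice ps c × I (u -' Σᶻ x c) (v -' Σᶻ y c) ≡ true) → ∃ λ c → Choice ps c × (Σᶻ x c ≋ u × Σᶻ y c ≋ v)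
        hit u v (c , ch , i) = c , ch , δ-difference u (Σᶻ x c) (proj₁ (∧-split (δ (u -' Σᶻ x c) 0ℤ) _ i)) , δ-difference v (Σᶻ y c) (proj₂ (∧-split (δ (u -' Σᶻ x c) 0ℤ) _ i))

    -- Starting from the axis x ≡ 0 keeps every grown set a union of vertical lines. The planar
    -- growth argument thus also serves in one dimension, with the sum of y left uncontrolled.
    cover-line : ∀ ℓ → (∀ e → count (λ e' → δ (x e) (x e')) ℓ ≤ β) → suc (key-count B * β) + 8 * (p / n₁) ≤ length ℓ →
                 Cover (λ u v c → Σᶻ x c ≋ u) ℓ
    cover-line ℓ light long = finish (G.cover provide I-+ ℓ light long)
      where
      I : ℤ → ℤ → Bool
      I u v = δ u 0ℤ
      I-per : PeriodicSet I
      I-per h k = δ-≋ˡ h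
      inhabited : 1 ≤ card I
      inhabited = ≤-trans (>-nonZero⁻¹ p) (≤-reflexive (sym (trans (S₂-cong λ u v → sym (*-identityʳ ⟦ δ u 0ℤ ⟧))
        (trans (S₂-product (λ u → ⟦ δ u 0ℤ ⟧) (λ _ → 1)) (trans (cong₂ _*_ S₁-point (trans (Σ<-const p 1) (*-identityʳ p))) (*-identityˡ p))))))
      I-+ : ∀ a b c d → I a b ≡ true → I c d ≡ true → I (a +' c) (b +' d) ≡ true
      I-+ a b c d h k = δ-+ a c h k
      module G = Growth B (p / n₁) n₁ (m/n≤m p n₁) C.p<2Tn C.linear x y I I-per inhabited
                   (λ ℓ → ∀ e → count (λ e' → δ (x e) (x e')) ℓ ≤ β) (λ {_} {xs} {ys} perm light e → ≤-trans (count-++ʳ _ {ys = xs} {zs = ys} perm) (light e)) (suc (key-count B * β))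
      provide : ∀ ℓ → (∀ e → count (λ e' → δ (x e) (x e')) ℓ ≤ β) → suc (key-count B * β) ≤ length ℓ → ∀ ps M →
                (∀ e e' → e ∈ ℓ → e' ∈ ℓ → lam (G.Y ps) (x e -' x e') (y e -' y e') ≤ M) → Rich B (G.Y ps) M
      provide ℓ light long ps M near = rich-line (G.Y-per ps) ℓ x y β M long near (grown-vertical x y I (λ _ _ _ → refl) ps) light
      finish : G.Cover provide I-+ ℓ → Cover (λ u v c → Σᶻ x c ≋ u) ℓ
      finish (ps , rest , perm , len , reach) = ps , rest , perm , len , λ u v → hit u v (reach u v)
        where
        hit : ∀ u v → (∃ λ c → Choice ps c × I (u -' Σᶻ x c) (v -' Σᶻ y c) ≡ true) → ∃ λ c → Choice ps c × Σᶻ x c ≋ u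
        hit u v (c , ch , i) = c , ch , δ-difference u (Σᶻ x c) i

-- The Cauchy-Davenport inequality.

module CauchyDavenport (p : ℕ) (pr : Prime p) where
  open Lists
  open Covering p pr public

  PeriodicSet₁ : (ℤ → Bool) → Set
  PeriodicSet₁ f = ∀ {x y} → x ≋ y → f x ≡ f y

  card₁ : (ℤ → Bool) → ℕ
  card₁ f = S₁ λ x → ⟦ f x ⟧

  card₁-shift : ∀ c {f} → PeriodicSet₁ f → card₁ (λ x → f (x +' c)) ≡ card₁ f
  card₁-shift c per = S₁-shift c λ h → cong ⟦_⟧ (per h)

  card₁-mono : ∀ {f g} → (∀ x → f x ≡ true → g x ≡ true) → card₁ f ≤ card₁ g
  card₁-mono h = S₁-mono λ x → ⟦⟧-mono (h x)

  card₁-member : ∀ {f} x → PeriodicSet₁ f → f x ≡ true → 1 ≤ card₁ f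
  card₁-member {f} x per fx = begin
    1  ≡⟨ cong ⟦_⟧ (sym fx) ⟩
    ⟦ f x ⟧  ≡⟨ sym (S₁-δ x {λ z → ⟦ f z ⟧} (λ h → cong ⟦_⟧ (per h))) ⟩
    S₁ (λ z → ⟦ δ z x ⟧ * ⟦ f z ⟧)  ≤⟨ S₁-mono (λ z → ≤-trans (*-monoˡ-≤ ⟦ f z ⟧ (⟦⟧≤1 (δ z x))) (≤-reflexive (*-identityˡ _))) ⟩
    card₁ f  ∎
    where open ≤-Reasoning

  search : ∀ {f} → PeriodicSet₁ f → (∃ λ x → f x ≡ true) ⊎ (∀ x → f x ≡ false)
  search {f} per with card₁ f in eq
  ... | suc _ with Σ<-positive p (λ i → ⟦ f (+ i) ⟧) (subst (0 <_) (sym eq) (s≤s z≤n))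
  ... | i , h = inj₁ (+ i , ⟦⟧-positive _ h)
  search {f} per | zero = inj₂ none
    where
    none : ∀ x → f x ≡ false
    none x with f x in fx
    ... | false = refl
    ... | true  = ⊥-elim (<⇒≢ (card₁-member x per fx) (sym eq))

  card₁-split : ∀ f → card₁ f + card₁ (not ∘ f) ≡ p
  card₁-split f = trans (sym (IsSum.T-+ S₁-isSum (λ x → ⟦ f x ⟧) (λ x → ⟦ not (f x) ⟧)))
    (trans (S₁-cong λ x → split (f x)) (trans (Σ<-const p 1) (*-identityʳ p)))
    where
    split : ∀ b → ⟦ b ⟧ + ⟦ not b ⟧ ≡ 1
    split false = refl
    split true  = refl

  full : ∀ {f} → PeriodicSet₁ f → p ≤ card₁ f → ∀ x → f x ≡ true
  full {f} per h x with f x in fx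
  ... | true  = refl
  ... | false = ⊥-elim (<⇒≱ (≤-trans (≤-reflexive (+-comm 1 (card₁ f)))
      (≤-trans (+-monoʳ-≤ (card₁ f) (card₁-member {not ∘ f} x (λ k → cong not (per k)) (cong not fx))) (≤-reflexive (card₁-split f)))) h)

  full⁻¹ : ∀ {f} → (∀ x → f x ≡ true) → p ≤ card₁ f
  full⁻¹ {f} h = ≤-reflexive (sym (trans (S₁-cong λ x → cong ⟦_⟧ (h x)) (trans (Σ<-const p 1) (*-identityʳ p))))

  ∨-split : ∀ a b → a ∨ b ≡ true → a ≡ true ⊎ b ≡ true
  ∨-split true  b h = inj₁ refl
  ∨-split false b h = inj₂ h

  ∨-introˡ : ∀ {a} b → a ≡ true → a ∨ b ≡ true
  ∨-introˡ b refl = refl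

  ∨-introʳ : ∀ a {b} → b ≡ true → a ∨ b ≡ true
  ∨-introʳ a refl = ∨-zeroʳ a

  -- As p is prime, a nonzero `d` generates all residues, so every x is a₀ plus a multiple of `d`.
  closed-full : ∀ {f} → PeriodicSet₁ f → ∀ {a₀ d} → f a₀ ≡ true → ¬ d ≋ 0ℤ → (∀ a → f a ≡ true → f (a +' d) ≡ true) → ∀ x → f x ≡ true
  closed-full {f} per {a₀} {d} fa₀ d≢0 closed x with ≋-inverse d d≢0
  ... | i , id≋1 = trans (per (≋-sym (lin₂ d (x -' a₀) (rep≋ (i *' (x -' a₀))) id≋1 (ring a₀ d i x (+ rep (i *' (x -' a₀))))))) (multiples (rep (i *' (x -' a₀))))
    where
    ring : ∀ a₀ d i x n → (a₀ +' n *' d) -' x ≡ d *' (n -' i *' (x -' a₀)) +' (x -' a₀) *' (i *' d -' 1ℤ)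
    ring = ℤ-solve
    ring' : ∀ a₀ d n → a₀ +' (1ℤ +' n) *' d ≡ (a₀ +' n *' d) +' d
    ring' = ℤ-solve
    multiples : ∀ n → f (a₀ +' + n *' d) ≡ true
    multiples zero    = trans (cong f (trans (cong (a₀ +'_) (ℤP.*-zeroˡ d)) (ℤP.+-identityʳ a₀))) fa₀
    multiples (suc n) = trans (cong f (trans (cong (λ t → a₀ +' t *' d) (ℤP.pos-+ 1 n)) (ring' a₀ d (+ n)))) (closed _ (multiples n))

  private
    only : ∀ s t → s ∧ not t ≡ false → s ≡ true → t ≡ true
    only true true _ _ = refl

  -- Translate g so that f ∩ g is a nonempty proper part of g, and pass to the pair (f ∪ g , f ∩ g).
  cauchy-davenport : ∀ n {f g C} → PeriodicSet₁ f → PeriodicSet₁ g → PeriodicSet₁ C → card₁ g ≤ n →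
    (∃ λ a → f a ≡ true) → (∃ λ b → g b ≡ true) → (∀ x y → f x ≡ true → g y ≡ true → C (x +' y) ≡ true) →
    p ≤ card₁ C ⊎ card₁ f + card₁ g ≤ suc (card₁ C)
  cauchy-davenport zero per-f per-g per-C g≤n _ (b₀ , gb₀) _ = ⊥-elim (<⇒≱ (card₁-member b₀ per-g gb₀) g≤n)
  cauchy-davenport (suc n) {f} {g} {C} per-f per-g per-C g≤n (a₀ , fa₀) (b₀ , gb₀) sumset = on-second (search {λ z → g z ∧ not (δ z b₀)} second-per)
    where
    Result : Set
    Result = p ≤ card₁ C ⊎ card₁ f + card₁ g ≤ suc (card₁ C)
    second-per : PeriodicSet₁ (λ z → g z ∧ not (δ z b₀))
    second-per h = cong₂ (λ s t → s ∧ not t) (per-g h) (δ-≋ˡ h)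
    on-second : (∃ λ z → (g z ∧ not (δ z b₀)) ≡ true) ⊎ (∀ z → (g z ∧ not (δ z b₀)) ≡ false) → Result
    on-second (inj₂ none) = inj₂ (≤-trans (+-mono-≤ f≤C g≤1) (≤-reflexive (+-comm (card₁ C) 1)))
      where
      f≤C : card₁ f ≤ card₁ C
      f≤C = ≤-trans (card₁-mono {f} {λ x → C (x +' b₀)} (λ x fx → sumset x b₀ fx gb₀)) (≤-reflexive (card₁-shift b₀ per-C))
      g≤1 : card₁ g ≤ 1
      g≤1 = ≤-trans (card₁-mono {g} {λ z → δ z b₀} (λ z gz → only (g z) (δ z b₀) (none z) gz))
        (≤-reflexive (trans (S₁-cong λ u → sym (*-identityʳ ⟦ δ u b₀ ⟧)) (S₁-δ b₀ {λ _ → 1} (λ _ → refl))))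
    on-second (inj₁ (b₁ , h)) = on-exit (search {λ z → f z ∧ not (f (z +' d))} exit-per)
      where
      gb₁ = proj₁ (∧-split (g b₁) (not (δ b₁ b₀)) h)
      d = b₁ -' b₀
      d≢0 : ¬ d ≋ 0ℤ
      d≢0 k with trans (sym (proj₂ (∧-split (g b₁) (not (δ b₁ b₀)) h))) (cong not (δ-true (lin₁ 1ℤ k (ring b₁ b₀))))
        where
        ring : ∀ s t → s -' t ≡ 1ℤ *' ((s -' t) -' 0ℤ)
        ring = ℤ-solve
      ... | ()
      exit-per : PeriodicSet₁ (λ z → f z ∧ not (f (z +' d)))
      exit-per k = cong₂ (λ s t → s ∧ not t) (per-f k) (per-f (+-≋ k ≋-refl))
      on-exit : (∃ λ z → (f z ∧ not (f (z +' d))) ≡ true) ⊎ (∀ z → (f z ∧ not (f (z +' d))) ≡ false) → Result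
      on-exit (inj₂ none) = inj₁ (full⁻¹ λ z → trans (cong C (sym (ring z b₀))) (sumset (z -' b₀) b₀ (f-full (z -' b₀)) gb₀))
        where
        ring : ∀ z b → (z -' b) +' b ≡ z
        ring = ℤ-solve
        f-full : ∀ x → f x ≡ true
        f-full = closed-full per-f fa₀ d≢0 λ a fa → only (f a) (f (a +' d)) (none a) fa
      on-exit (inj₁ (a , k)) = conclude (cauchy-davenport n {f∪} {f∩} {λ z → C (z -' e)} per∪ per∩ (λ k → per-C (sub-≋ k ≋-refl)) smaller (a , ∨-introˡ _ fa) (a , cong₂ _∧_ fa g'a) sums)
        where
        fa = proj₁ (∧-split (f a) (not (f (a +' d))) k)
        -- This translation takes b₀ to a, which lies in `f`, and b₁ to a + d, which does not. The
        -- first makes `f∩` nonempty, the second makes it smaller than `g`.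
        e = a -' b₀
        g' f∪ f∩ : ℤ → Bool
        g' z = g (z -' e)
        f∪ z = f z ∨ g' z
        f∩ z = f z ∧ g' z
        per' : PeriodicSet₁ g'
        per' k = per-g (sub-≋ k ≋-refl)
        per∪ : PeriodicSet₁ f∪
        per∪ k = cong₂ _∨_ (per-f k) (per' k)
        per∩ : PeriodicSet₁ f∩
        per∩ k = cong₂ _∧_ (per-f k) (per' k)
        ring₁ : ∀ a b → a -' (a -' b) ≡ b
        ring₁ = ℤ-solve
        g'a : g' a ≡ true
        g'a = trans (cong g (ring₁ a b₀)) gb₀
        card-g' : card₁ g' ≡ card₁ g
        card-g' = card₁-shift (-' e) per-g
        ring₂ : ∀ a b₀ b₁ → (a +' (b₁ -' b₀)) -' (a -' b₀) ≡ b₁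
        ring₂ = ℤ-solve
        outside : (g' (a +' d) ∧ not (f (a +' d))) ≡ true
        outside = cong₂ _∧_ (trans (cong g (ring₂ a b₀ b₁)) gb₁) (proj₂ (∧-split (f a) (not (f (a +' d))) k))
        smaller : card₁ f∩ ≤ n
        smaller = ≤-pred (≤-trans (begin
          suc (card₁ f∩)  ≤⟨ +-monoˡ-≤ (card₁ f∩) (card₁-member {λ z → g' z ∧ not (f z)} (a +' d) (λ k → cong₂ (λ s t → s ∧ not t) (per' k) (per-f k)) outside) ⟩
          card₁ (λ z → g' z ∧ not (f z)) + card₁ f∩  ≡⟨ sym (IsSum.T-+ S₁-isSum (λ z → ⟦ g' z ∧ not (f z) ⟧) (λ z → ⟦ f∩ z ⟧)) ⟩
          S₁ (λ z → ⟦ g' z ∧ not (f z) ⟧ + ⟦ f z ∧ g' z ⟧)  ≡⟨ S₁-cong (λ z → trans (cong (λ b → ⟦ g' z ∧ not (f z) ⟧ + ⟦ b ⟧) (∧-comm (f z) (g' z))) (⟦∧not⟧ (g' z) (f z))) ⟩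
          card₁ g'  ≡⟨ card-g' ⟩
          card₁ g  ∎) g≤n)
          where open ≤-Reasoning
        ring₃ : ∀ x y e → (x +' y) -' e ≡ x +' (y -' e)
        ring₃ = ℤ-solve
        ring₄ : ∀ x y e → (x +' y) -' e ≡ y +' (x -' e)
        ring₄ = ℤ-solve
        sums : ∀ x y → f∪ x ≡ true → f∩ y ≡ true → C ((x +' y) -' e) ≡ true
        sums x y h k = by-case (∨-split (f x) (g' x) h) (∧-split (f y) (g' y) k)
          where
          by-case : f x ≡ true ⊎ g' x ≡ true → f y ≡ true × g' y ≡ true → C ((x +' y) -' e) ≡ true
          by-case (inj₁ fx)  (_ , g'y) = trans (cong C (ring₃ x y e)) (sumset x (y -' e) fx g'y)
          by-case (inj₂ g'x) (fy , _)  = trans (cong C (ring₄ x y e)) (sumset y (x -' e) fy g'x)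
        card-C : card₁ (λ z → C (z -' e)) ≡ card₁ C
        card-C = card₁-shift (-' e) per-C
        total : card₁ f∪ + card₁ f∩ ≡ card₁ f + card₁ g
        total = trans (sym (IsSum.T-+ S₁-isSum (λ z → ⟦ f∪ z ⟧) (λ z → ⟦ f∩ z ⟧))) (trans (S₁-cong λ z → ⟦∨⟧+⟦∧⟧ (f z) (g' z))
          (trans (IsSum.T-+ S₁-isSum (λ z → ⟦ f z ⟧) (λ z → ⟦ g' z ⟧)) (cong (λ t → card₁ f + t) card-g')))
        conclude : p ≤ card₁ (λ z → C (z -' e)) ⊎ card₁ f∪ + card₁ f∩ ≤ suc (card₁ (λ z → C (z -' e))) → Result
        conclude (inj₁ h) = inj₁ (≤-trans h (≤-reflexive card-C))
        conclude (inj₂ h) = inj₂ (≤-trans (≤-reflexive (sym total)) (≤-trans h (≤-reflexive (cong suc card-C))))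

-- Prescribed sums of exactly t elements of a list.

module Partition (p : ℕ) (pr : Prime p) where
  open Lists
  open CauchyDavenport p pr public

  module SetPartition {E : Set} (b : E → ℤ) where

    value : ℤ → E → Bool
    value z e = δ z (b e)

    has : List E → ℤ → Bool
    has []        z = false
    has (e ∷ col) z = value z e ∨ has col z

    Distinct : List E → Set
    Distinct []        = ⊤
    Distinct (e ∷ col) = has col (b e) ≡ false × Distinct col

    Column : List E → Set
    Column col = Distinct col × 1 ≤ length col

    reach : List (List E) → ℤ → Bool
    some  : List E → List (List E) → ℤ → Bool
    reach []           z = δ z 0ℤ
    reach (col ∷ cols) z = some col cols z
    some []        cols z = false
    some (e ∷ col) cols z = reach cols (z -' b e) ∨ some col cols z

    has-per : ∀ col → PeriodicSet₁ (has col)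
    has-per []        h = refl
    has-per (e ∷ col) h = cong₂ _∨_ (δ-≋ˡ h) (has-per col h)

    reach-per : ∀ cols → PeriodicSet₁ (reach cols)
    some-per  : ∀ col cols → PeriodicSet₁ (some col cols)
    reach-per []           h = δ-≋ˡ h
    reach-per (col ∷ cols) h = some-per col cols h
    some-per []        cols h = refl
    some-per (e ∷ col) cols h = cong₂ _∨_ (reach-per cols (sub-≋ h ≋-refl)) (some-per col cols h)

    some-sum : ∀ col cols x y → reach cols x ≡ true → has col y ≡ true → some col cols (x +' y) ≡ true
    some-sum (e ∷ col) cols x y rx hy = by-case (∨-split (value y e) (has col y) hy)
      where
      ring : ∀ x y b → ((x +' y) -' b) -' x ≡ 1ℤ *' (y -' b)
      ring = ℤ-solve
      by-case : value y e ≡ true ⊎ has col y ≡ true → some (e ∷ col) cols (x +' y) ≡ true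
      by-case (inj₁ h) = ∨-introˡ (some col cols (x +' y)) (trans (reach-per cols (lin₁ 1ℤ (δ-sound {y} {b e} h) (ring x y (b e)))) rx)
      by-case (inj₂ h) = ∨-introʳ (reach cols ((x +' y) -' b e)) (some-sum col cols x y rx h)

    card-has : ∀ col → Distinct col → card₁ (has col) ≡ length col
    card-has []        _ = IsSum.T-zero S₁-isSum
    card-has (e ∷ col) (new , dist) = begin
      S₁ (λ z → ⟦ value z e ∨ has col z ⟧)  ≡⟨ S₁-cong (λ z → disjoint z) ⟩
      S₁ (λ z → ⟦ δ z (b e) ⟧ * 1 + ⟦ has col z ⟧)  ≡⟨ IsSum.T-+ S₁-isSum (λ z → ⟦ δ z (b e) ⟧ * 1) (λ z → ⟦ has col z ⟧) ⟩
      S₁ (λ z → ⟦ δ z (b e) ⟧ * 1) + card₁ (has col)  ≡⟨ cong₂ _+_ (S₁-δ (b e) {λ _ → 1} (λ _ → refl)) (card-has col dist) ⟩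
      suc (length col)  ∎
      where
      open ≡-Reasoning
      disjoint : ∀ z → ⟦ value z e ∨ has col z ⟧ ≡ ⟦ δ z (b e) ⟧ * 1 + ⟦ has col z ⟧
      disjoint z with δ z (b e) in eq
      ... | false = refl
      ... | true  = sym (cong (λ t → 1 + ⟦ t ⟧) (trans (has-per col (δ-sound {z} {b e} eq)) new))

    -- Iterated Cauchy-Davenport: each column adds its length minus 1 until all residues are
    -- reached. Nonemptiness is carried along because each application needs elements of both sets.
    reach-large : ∀ cols → All Column cols → (p ≤ card₁ (reach cols) ⊎ suc (length (concat cols)) ≤ card₁ (reach cols) + length cols) × 1 ≤ card₁ (reach cols)
    reach-large [] [] = inj₂ (≤-trans (card₁-member {λ z → δ z 0ℤ} 0ℤ (reach-per []) (δ-true ≋-refl)) (≤-reflexive (sym (+-identityʳ _)))) , card₁-member {λ z → δ z 0ℤ} 0ℤ (reach-per []) (δ-true ≋-refl)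
    reach-large (col ∷ cols) ((dist , nonempty) ∷ columns) = combined (reach-large cols columns)
      where
      open ≤-Reasoning
      r = card₁ (reach cols)
      r' = card₁ (some col cols)
      Goal : Set
      Goal = (p ≤ r' ⊎ suc (length (col ++ concat cols)) ≤ r' + suc (length cols)) × 1 ≤ r'
      combined : (p ≤ r ⊎ suc (length (concat cols)) ≤ r + length cols) × 1 ≤ r → Goal
      combined (large , pos) = apply large (cauchy-davenport (card₁ (has col)) {reach cols} {has col} {some col cols} (reach-per cols) (has-per col) (some-per col cols) ≤-refl
          (witness (search (reach-per cols)) pos) (witness (search (has-per col)) (≤-trans nonempty (≤-reflexive (sym (card-has col dist))))) (some-sum col cols))
        where
        witness : ∀ {f} → (∃ λ x → f x ≡ true) ⊎ (∀ x → f x ≡ false) → 1 ≤ card₁ f → ∃ λ x → f x ≡ true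
        witness (inj₁ w)    _ = w
        witness {f} (inj₂ none) h = ⊥-elim (<⇒≱ h (≤-reflexive (trans (S₁-cong λ x → cong ⟦_⟧ (none x)) (IsSum.T-zero S₁-isSum))))
        apply : p ≤ r ⊎ suc (length (concat cols)) ≤ r + length cols → p ≤ r' ⊎ r + card₁ (has col) ≤ suc r' → Goal
        apply _ (inj₁ h) = inj₁ h , ≤-trans (>-nonZero⁻¹ p) h
        apply large (inj₂ h) = choose large , ≤-trans pos r≤r'
          where
          h' : r + length col ≤ suc r'
          h' = ≤-trans (+-monoʳ-≤ r (≤-reflexive (sym (card-has col dist)))) h
          r≤r' : r ≤ r'
          r≤r' = ≤-pred (≤-trans (≤-reflexive (+-comm 1 r)) (≤-trans (+-monoʳ-≤ r nonempty) h'))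
          choose : p ≤ r ⊎ suc (length (concat cols)) ≤ r + length cols → p ≤ r' ⊎ suc (length (col ++ concat cols)) ≤ r' + suc (length cols)
          choose (inj₁ k) = inj₁ (≤-trans k r≤r')
          choose (inj₂ k) = inj₂ (≤-trans (≤-reflexive (cong suc (length-++ col))) (by-≤ (suc (length col + length (concat cols))) (r' + suc (length cols)) 0 (+-mono-≤ k h')
              (ring (length col) (length (concat cols)) r' r (length cols))))
            where
            ring : ∀ a c r' r n → suc (a + c) + ((r + n) + suc r') + 0 ≡ (r' + suc n) + (suc c + (r + a))
            ring = ℕ-solve

    Selection : List (List E) → ℤ → Set
    Selection cols z = ∃₂ λ C C' → concat cols ↭ C ++ C' × length C ≡ length cols × Σᶻ b C ≋ z

    reach-sound : ∀ cols z → reach cols z ≡ true → Selection cols z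
    -- `pre` keeps the entries of the column already passed over; they end up in the unchosen part.
    some-sound  : ∀ pre col cols z → some col cols z ≡ true → Selection ((pre ++ col) ∷ cols) z
    reach-sound []           z h = [] , [] , ↭-refl , refl , ≋-sym (δ-sound {z} h)
    reach-sound (col ∷ cols) z h = some-sound [] col cols z h
    some-sound pre (e ∷ col) cols z h = by-case (∨-split (reach cols (z -' b e)) (some col cols z) h)
      where
      extend : Selection cols (z -' b e) → Selection ((pre ++ e ∷ col) ∷ cols) z
      extend (C , C' , perm , len , sum) = e ∷ C , (pre ++ col) ++ C' , perm' , cong suc len , lin₁ 1ℤ sum (ring (b e) (Σᶻ b C) z)
        where
        ring : ∀ b s z → (b +' s) -' z ≡ 1ℤ *' (s -' (z -' b))
        ring = ℤ-solve
        perm' : (pre ++ e ∷ col) ++ concat cols ↭ e ∷ (C ++ ((pre ++ col) ++ C'))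
        perm' = ↭-trans (++⁺ʳ (concat cols) (shift e pre col)) (prep e (↭-trans (++⁺ˡ (pre ++ col) perm) (shifts (pre ++ col) C)))
      by-case : reach cols (z -' b e) ≡ true ⊎ some col cols z ≡ true → Selection ((pre ++ e ∷ col) ∷ cols) z
      by-case (inj₁ k) = extend (reach-sound cols (z -' b e) k)
      by-case (inj₂ k) = subst (λ l → Selection (l ∷ cols) z) (List-++-assoc pre (e ∷ []) col) (some-sound (pre ++ e ∷ []) col cols z k)

    Saturated : List (List E) → ℤ → Set
    Saturated cols z = All (λ col → has col z ≡ true) cols

    record Placed (e : E) (cols : List (List E)) : Set where
      constructor placed
      field
        cols'   : List (List E)
        perm    : concat cols' ↭ e ∷ concat cols
        same    : length cols' ≡ length cols
        columns : All Column cols → All Column cols'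
        keeps   : ∀ z → Saturated cols z → Saturated cols' z

    -- Insertion never loses a value (`keeps`), so an element discarded earlier still has its value
    -- in every column.
    place : ∀ e cols → Saturated cols (b e) ⊎ Placed e cols
    place e []           = inj₁ []
    place e (col ∷ cols) with has col (b e) in eq
    ... | false = inj₂ (placed ((e ∷ col) ∷ cols) ↭-refl refl (λ { ((dist , _) ∷ rest) → ((eq , dist) , s≤s z≤n) ∷ rest }) (λ { z (h ∷ rest) → ∨-introʳ (value z e) h ∷ rest }))
    ... | true with place e cols
    ... | inj₁ sat = inj₁ (eq ∷ sat)
    ... | inj₂ (placed cols' perm same columns keeps) = inj₂ (placed (col ∷ cols')
            (↭-trans (++⁺ˡ col perm) (shift e col (concat cols))) (cong suc same) (λ { (c ∷ rest) → c ∷ columns rest }) (λ { z (h ∷ rest) → h ∷ keeps z rest }))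

    record Filled (cols : List (List E)) (R : List E) : Set where
      constructor filled
      field
        cols'     : List (List E)
        D         : List E
        perm      : concat cols ++ R ↭ concat cols' ++ D
        same      : length cols' ≡ length cols
        columns   : All Column cols'
        discarded : ∀ e → e ∈ D → Saturated cols' (b e)

    fill : ∀ cols → All Column cols → ∀ R → Filled cols R
    fill cols columns [] = filled cols [] ↭-refl refl columns (λ e ())
    fill cols columns (e ∷ R) with fill cols columns R
    ... | filled cols' D perm same columns' discarded with place e cols'
    ... | inj₁ sat = filled cols' (e ∷ D) (↭-trans (shift e (concat cols) R) (↭-trans (prep e perm) (↭-sym (shift e (concat cols') D)))) same columns'
            (λ { _ (here refl) → sat ; e' (there e'∈) → discarded e' e'∈ })
    ... | inj₂ (placed cols″ perm' same' columns″ keeps) = filled cols″ D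
            (↭-trans (shift e (concat cols) R) (↭-trans (prep e perm) (↭-sym (++⁺ʳ D perm')))) (trans same' same) (columns″ columns')
            (λ e' e'∈ → keeps _ (discarded e' e'∈))

    has⇒count : ∀ col z → has col z ≡ true → 1 ≤ count (value z) col
    has⇒count (e ∷ col) z h with value z e
    ... | true  = s≤s z≤n
    ... | false = has⇒count col z h

    saturated-count : ∀ cols z → Saturated cols z → length cols ≤ count (value z) (concat cols)
    saturated-count []           z []        = z≤n
    saturated-count (col ∷ cols) z (h ∷ sat) = ≤-trans (+-mono-≤ (has⇒count col z h) (saturated-count cols z sat)) (≤-reflexive (sym (count-++ (value z) col (concat cols))))

    count-three : ∀ z₀ z₁ z₂ → ¬ z₀ ≋ z₁ → ¬ z₀ ≋ z₂ → ¬ z₁ ≋ z₂ → ∀ es → count (value z₀) es + count (value z₁) es + count (value z₂) es ≤ length es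
    count-three z₀ z₁ z₂ n₀₁ n₀₂ n₁₂ []       = z≤n
    count-three z₀ z₁ z₂ n₀₁ n₀₂ n₁₂ (e ∷ es) = ≤-trans (≤-reflexive (ring ⟦ value z₀ e ⟧ ⟦ value z₁ e ⟧ ⟦ value z₂ e ⟧ _ _ _))
        (+-mono-≤ one (count-three z₀ z₁ z₂ n₀₁ n₀₂ n₁₂ es))
      where
      ring : ∀ a b c x y z → (a + x) + (b + y) + (c + z) ≡ (a + b + c) + (x + y + z)
      ring = ℕ-solve
      meet : ∀ {s t} → value s e ≡ true → value t e ≡ true → s ≋ t
      meet {s} {t} h k = ≋-trans (δ-sound {s} h) (≋-sym (δ-sound {t} k))
      one : ⟦ value z₀ e ⟧ + ⟦ value z₁ e ⟧ + ⟦ value z₂ e ⟧ ≤ 1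
      one with value z₀ e in e₀ | value z₁ e in e₁ | value z₂ e in e₂
      ... | false | false | c     = ⟦⟧≤1 c
      ... | false | true  | false = ≤-refl
      ... | true  | false | false = ≤-refl
      ... | true  | true  | _     = ⊥-elim (n₀₁ (meet e₀ e₁))
      ... | true  | false | true  = ⊥-elim (n₀₂ (meet e₀ e₂))
      ... | false | true  | true  = ⊥-elim (n₁₂ (meet e₁ e₂))

    singletons : List E → List (List E)
    singletons = map (λ e → e ∷ [])

    concat-singletons : ∀ es → concat (singletons es) ≡ es
    concat-singletons []       = refl
    concat-singletons (e ∷ es) = cong (e ∷_) (concat-singletons es)

    columns-singletons : ∀ es → All Column (singletons es)
    columns-singletons []       = []
    columns-singletons (e ∷ es) = ((refl , tt) , ≤-refl) ∷ columns-singletons es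

    ExactSum : ℕ → List E → ℤ → Set
    ExactSum t R z = ∃₂ λ C C' → R ↭ C ++ C' × length C ≡ t × Σᶻ b C ≋ z

    -- Distribute the elements over t columns of pairwise incongruent values.  A value whose copies do not all
    -- fit fills every column, so that either few copies are discarded or all columns have three elements.
    exact-sums : ∀ t d R → p + t + 2 * d ≤ suc (length R) → p ≤ suc (2 * t) → (∀ z → count (value z) R ≤ t + d) →
                 ∀ z → ExactSum t R z
    exact-sums t d R long p≤ light z = from-fill (fill (singletons (take t R)) (columns-singletons (take t R)) (drop t R))
      where
      open ≤-Reasoning
      t≤R : t ≤ length R
      t≤R = ≤-pred (≤-trans (+-monoˡ-≤ t (<⇒≤ 1<p)) (≤-trans (m≤m+n (p + t) (2 * d)) long))
      -- The first t elements start one column each, so that no column is empty; only the others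
      -- have to be placed.
      from-fill : Filled (singletons (take t R)) (drop t R) → ExactSum t R z
      from-fill (filled cols D perm same columns discarded) = conclude (reach-sound cols z (full (reach-per cols) large z))
        where
        cols-t : length cols ≡ t
        cols-t = trans same (trans (length-map _ (take t R)) (trans (length-take t R) (m≤n⇒m⊓n≡m t≤R)))
        R↭ : R ↭ concat cols ++ D
        R↭ = subst (_↭ concat cols ++ D) (trans (cong (_++ drop t R) (concat-singletons (take t R))) (take++drop≡id t R)) perm
        conclude : Selection cols z → ExactSum t R z
        conclude (C , C' , perm' , len , sum) = C , C' ++ D , ↭-trans R↭ (↭-trans (++⁺ʳ D perm') (++-assoc C C' D)) , trans len cols-t , sum
        split-length : length (concat cols) + length D ≡ length R
        split-length = sym (trans (↭-length R↭) (length-++ (concat cols)))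
        sat-t : ∀ z → Saturated cols z → t ≤ count (value z) (concat cols)
        sat-t z sat = ≤-trans (≤-reflexive (sym cols-t)) (saturated-count cols z sat)
        D-light : ∀ e → count (value (b e)) D ≤ d
        D-light e with count (value (b e)) D in eq
        ... | zero  = z≤n
        ... | suc k with ∃-true (value (b e)) D (subst (1 ≤_) (sym eq) (s≤s z≤n))
        ... | e' , e'∈ , v = +-cancelˡ-≤ t (suc k) d (begin
          t + suc k  ≤⟨ +-mono-≤ (sat-t (b e) (transport (discarded e' e'∈))) (≤-reflexive (sym eq)) ⟩
          count (value (b e)) (concat cols) + count (value (b e)) D  ≡⟨ sym (trans (count-↭ (value (b e)) R↭) (count-++ (value (b e)) (concat cols) D)) ⟩
          count (value (b e)) R  ≤⟨ light (b e) ⟩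
          t + d  ∎)
          where
          transport : ∀ {cols} → Saturated cols (b e') → Saturated cols (b e)
          transport []        = []
          transport (_∷_ {col} h sat) = trans (has-per col (δ-sound {b e} v)) h ∷ transport sat
        -- Up to 2d discarded elements are paid for by `long`. More than 2d involve three different
        -- values, since each is discarded at most d times; all three occur in every column, so the
        -- columns hold 3t ≥ p + t - 1 elements.
        enough : p + t ≤ suc (length (concat cols))
        enough with length D ≤? 2 * d
        ... | yes small = +-cancelʳ-≤ (2 * d) _ _ (begin
          p + t + 2 * d  ≤⟨ long ⟩
          suc (length R)  ≡⟨ cong suc (sym split-length) ⟩
          suc (length (concat cols) + length D)  ≤⟨ s≤s (+-monoʳ-≤ (length (concat cols)) small) ⟩
          suc (length (concat cols)) + 2 * d  ∎)
        ... | no  many with independent (λ e e' → value (b e) e') (λ e e' → δ-sym (b e) (b e')) d 2 D D-light (≰⇒> many)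
        ... | f , f∈ , f-good = begin
          p + t  ≤⟨ +-monoˡ-≤ t p≤ ⟩
          suc (2 * t) + t  ≡⟨ ring t ⟩
          suc (t + t + t)  ≤⟨ s≤s (+-mono-≤ (+-mono-≤ (sat i₀) (sat i₁)) (sat i₂)) ⟩
          suc (count (value (b (f i₀))) (concat cols) + count (value (b (f i₁))) (concat cols) + count (value (b (f i₂))) (concat cols))
            ≤⟨ s≤s (count-three (b (f i₀)) (b (f i₁)) (b (f i₂)) (δ-false⁻¹ (f-good i₀ i₁ λ ())) (δ-false⁻¹ (f-good i₀ i₂ λ ())) (δ-false⁻¹ (f-good i₁ i₂ λ ())) (concat cols)) ⟩
          suc (length (concat cols))  ∎
          where
          i₀ i₁ i₂ : Fin 3
          i₀ = zero
          i₁ = suc zero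
          i₂ = suc (suc zero)
          sat : ∀ i → t ≤ count (value (b (f i))) (concat cols)
          sat i = sat-t (b (f i)) (discarded (f i) (f∈ i))
          ring : ∀ t → suc (2 * t) + t ≡ suc (t + t + t)
          ring = ℕ-solve
        large : p ≤ card₁ (reach cols)
        large = by-case (proj₁ (reach-large cols columns))
          where
          by-case : p ≤ card₁ (reach cols) ⊎ suc (length (concat cols)) ≤ card₁ (reach cols) + length cols → p ≤ card₁ (reach cols)
          by-case (inj₁ h) = h
          by-case (inj₂ h) = +-cancelʳ-≤ t p _ (≤-trans enough (≤-trans h (+-monoʳ-≤ (card₁ (reach cols)) (≤-reflexive cols-t))))

-- Zero sums of length p, according to whether some line is heavy.

module ExactLength (p : ℕ) (pr : Prime p) where
  open Lists
  open Partition p pr public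

  private variable
    E : Set

  ++-interchange : ∀ (C C' W W' : List E) → (C ++ C') ++ (W ++ W') ↭ (C ++ W) ++ (C' ++ W')
  ++-interchange C C' W W' = ↭-trans (++-assoc C C' (W ++ W')) (↭-trans (++⁺ˡ C (shifts C' W)) (↭-sym (++-assoc C W (C' ++ W'))))

  choose : ∀ {L : List E} {ps R c W W'} → L ↭ flat ps ++ R → R ↭ W ++ W' → Choice ps c → ∃ λ C' → L ↭ (c ++ W) ++ C'
  choose {c = c} {W} {W'} L↭ R↭ ch with choice-↭ ch
  ... | c' , flat↭ = c' ++ W' , ↭-trans L↭ (↭-trans (++⁺ˡ _ R↭) (↭-trans (++⁺ʳ _ flat↭) (++-interchange c c' W W')))

  choice-All : ∀ {P : E → Set} {ps c} → All P (flat ps) → Choice ps c → All P c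
  choice-All h             []         = []
  choice-All (pa ∷ pb ∷ h) (left ch)  = pa ∷ choice-All h ch
  choice-All (pa ∷ pb ∷ h) (right ch) = pb ∷ choice-All h ch

  take-↭ : ∀ k (R : List E) → R ↭ take k R ++ drop k R
  take-↭ k R = subst (R ↭_) (sym (take++drop≡id k R)) ↭-refl

  length-take-≤ : ∀ k (R : List E) → k ≤ length R → length (take k R) ≡ k
  length-take-≤ k R h = trans (length-take k R) (m≤n⇒m⊓n≡m h)

  select-All : ∀ (f : E → Bool) es → All (λ e → f e ≡ true) (select f es)
  select-All f []       = []
  select-All f (e ∷ es) with f e in eq
  ... | true  = eq ∷ select-All f es
  ... | false = select-All f es

  count-≤-length : ∀ (f : E → Bool) es → count f es ≤ length es
  count-≤-length f es = ≤-trans (m≤n+m _ _) (≤-reflexive (length-count f es))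

  count-select-∧ : ∀ (f g : E → Bool) es → count f (select g es) ≡ count (λ e → g e ∧ f e) es
  count-select-∧ f g []       = refl
  count-select-∧ f g (e ∷ es) with g e
  ... | true  = cong (λ t → ⟦ f e ⟧ + t) (count-select-∧ f g es)
  ... | false = count-select-∧ f g es

  -- `β₀` bounds multiplicities in `A`, and `β₁` separates light lines from heavy ones. By `room₁`,
  -- p elements with all lines light suffice to cover the plane; by `room₀`, more than `β₁` elements
  -- on one line suffice to cover all sums along it.
  module ZeroSum (nᵃ nᵇ : ℕ) .{{nᵃ≢0 : NonZero nᵃ}} .{{nᵇ≢0 : NonZero nᵇ}} (Bᵃ<p : growth-constant nᵃ < p) (Bᵇ<p : growth-constant nᵇ < p)
                 (β₀ β₁ : ℕ)
                 (room₁ : suc (key-count (growth-constant nᵃ) * β₁) + 8 * (p / nᵃ) ≤ p)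
                 (room₀ : key-count (growth-constant nᵇ) * β₀ + 8 * (p / nᵇ) ≤ β₁) (β₁≤p : β₁ ≤ p)
                 {E : Set} (U A : List E) (U≤p : length U ≤ p)
                 (long : 2 * p + 3 * (4 * (p / nᵇ)) + 2 * β₁ ≤ length (U ++ A)) where

    Goal : (E → ℤ) → (E → ℤ) → Set
    Goal x y = ∃₂ λ C C' → U ++ A ↭ C ++ C' × length C ≡ p × Σᶻ x C ≋ 0ℤ × Σᶻ y C ≋ 0ℤ

    private
      8T≤β₁ : 8 * (p / nᵇ) ≤ β₁
      8T≤β₁ = ≤-trans (m≤n+m (8 * (p / nᵇ)) (key-count (growth-constant nᵇ) * β₀)) room₀

      4T≤β₁ : 4 * (p / nᵇ) ≤ β₁
      4T≤β₁ = ≤-trans (*-monoˡ-≤ (p / nᵇ) (m≤m+n 4 4)) 8T≤β₁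

      cancel : ∀ {s t} → s ≋ -' t → s +' t ≋ 0ℤ
      cancel {s} {t} h = lin₁ 1ℤ h (ring s t)
        where
        ring : ∀ s t → (s +' t) -' 0ℤ ≡ 1ℤ *' (s -' (-' t))
        ring = ℤ-solve

      Σ-cancel : ∀ (f : E → ℤ) c W → Σᶻ f c ≋ -' Σᶻ f W → Σᶻ f (c ++ W) ≋ 0ℤ
      Σ-cancel f c W h = ≋-trans (≋-reflexive (Σᶻ-++ f c W)) (cancel h)

      Σ-line : ∀ (y : E → ℤ) v es → All (λ e → δ v (y e) ≡ true) es → Σᶻ y es ≋ + length es *' v
      Σ-line y v []       []       = ≋-reflexive (sym (ℤP.*-zeroˡ v))
      Σ-line y v (e ∷ es) (h ∷ hs) = lin₂ (-' 1ℤ) 1ℤ (δ-sound {v} h) (Σ-line y v es hs)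
        (trans (cong (λ n → (y e +' Σᶻ y es) -' n *' v) (ℤP.pos-+ 1 (length es))) (ring v (y e) (Σᶻ y es) (+ length es)))
        where
        ring : ∀ v y s n → (y +' s) -' (1ℤ +' n) *' v ≡ (-' 1ℤ) *' (v -' y) +' 1ℤ *' (s -' n *' v)
        ring = ℤ-solve

      A-length : ∀ {ps R} → U ++ A ↭ flat ps ++ R → length (U ++ A) ≡ 2 * length ps + length R
      A-length {ps} {R} h = trans (↭-length h) (trans (length-++ (flat ps)) (cong (_+ length R) (length-flat ps)))

    Multiplicity : (E → ℤ) → (E → ℤ) → Set
    Multiplicity x y = ∀ e → count (λ e' → δ (x e) (x e') ∧ δ (y e) (y e')) A ≤ β₀

    module Heavy (x y : E → ℤ) (mult : Multiplicity x y) where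

      on : ℤ → E → Bool
      on v e = δ v (y e)

      record LineCover (v : ℤ) : Set where
        constructor line-cover
        field
          ps      : List (E × E)
          rest    : List E
          perm    : select (on v) A ↭ flat ps ++ rest
          bound   : length ps ≤ 4 * (p / nᵇ)
          hits    : ∀ u → ∃ λ c → Choice ps c × Σᶻ x c ≋ u

        on-line : All (λ e → on v e ≡ true) (flat ps)
        on-line = ++⁻ˡ (flat ps) (All-resp-↭ perm (select-All (on v) A))

        ps≤p : length ps ≤ p
        ps≤p = ≤-trans bound (≤-trans 4T≤β₁ β₁≤p)

      -- Elements of the line with congruent x are copies of the same point, so the bound on
      -- multiplicities is the lightness that `cover-line` needs.
      line : ∀ v → β₁ < count (on v) A → LineCover v
      line v heavy = convert (Covers.cover-line nᵇ Bᵇ<p x y β₀ ℓ light enough)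
        where
        ℓ : List E
        ℓ = select (on v) A
        light : ∀ e → count (λ e' → δ (x e) (x e')) ℓ ≤ β₀
        light e with count (λ e' → δ (x e) (x e')) ℓ in eq
        ... | zero  = z≤n
        ... | suc k with ∃-true (λ e' → δ (x e) (x e')) ℓ (subst (1 ≤_) (sym eq) (s≤s z≤n))
        ... | e₁ , e₁∈ , same = ≤-trans (≤-reflexive (trans (sym eq) (count-select-∧ (λ e' → δ (x e) (x e')) (on v) A)))
                (≤-trans (count-mono A λ e' h → cong₂ _∧_ (δ-true (≋-trans (≋-sym (δ-sound {x e} same)) (δ-sound {x e} (proj₂ (∧-split (on v e') _ h)))))
                                                          (δ-true (≋-trans (≋-sym (δ-sound {v} (proj₁ (∈-select (on v) A e₁∈)))) (δ-sound {v} (proj₁ (∧-split (on v e') _ h))))))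
                  (mult e₁))
        enough : suc (key-count (growth-constant nᵇ) * β₀) + 8 * (p / nᵇ) ≤ length ℓ
        enough = ≤-trans (s≤s room₀) (≤-trans heavy (≤-reflexive (sym (length-select (on v) A))))
        convert : Covers.Cover nᵇ Bᵇ<p x y β₀ (λ u _ c → Σᶻ x c ≋ u) ℓ → LineCover v
        convert (ps , rest , perm , bound , hits) = line-cover ps rest perm bound λ u → hits u 0ℤ

      module FromLine {v : ℤ} (lc : LineCover v) where
        open LineCover lc

        h t : ℕ
        h = length ps
        t = p ∸ h

        h+t : h + t ≡ p
        h+t = m+[n∸m]≡n ps≤p

        -- Every choice from the pairs has y-sum h v. Hence `W` only has to cancel h v in y, and the
        -- choice is then free to correct the x-sum.
        combine-with : ∀ {R W W'} → U ++ A ↭ flat ps ++ R → R ↭ W ++ W' → length W ≡ t → Σᶻ y W ≋ -' (+ h *' v) → Goal x y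
        combine-with {R} {W} {W'} UA↭ R↭ len sum = pick (hits (-' Σᶻ x W))
          where
          pick : (∃ λ c → Choice ps c × Σᶻ x c ≋ -' Σᶻ x W) → Goal x y
          pick (c , ch , sx) = c ++ W , proj₁ (choose UA↭ R↭ ch) , proj₂ (choose UA↭ R↭ ch) ,
            trans (length-++ c) (trans (cong₂ _+_ (length-choice ch) len) h+t) , Σ-cancel x c W sx ,
            Σ-cancel y c W (≋-trans (Σ-line y v c (choice-All on-line ch)) (≋-trans (≋-reflexive (cong (λ n → + n *' v) (length-choice ch))) (lin₁ 1ℤ sum (ring (+ h *' v) (Σᶻ y W)))))
            where
            ring : ∀ s w → s -' (-' w) ≡ 1ℤ *' (w -' (-' s))
            ring = ℤ-solve

        others : List E
        others = select (not ∘ on v) A ++ U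

        UA↭ : U ++ A ↭ flat ps ++ (rest ++ others)
        UA↭ = ↭-trans (++-comm U A) (↭-trans (++⁺ʳ U (↭-trans (select-↭ (on v) A) (++⁺ʳ _ perm)))
          (↭-trans (++-assoc (flat ps ++ rest) (select (not ∘ on v) A) U) (++-assoc (flat ps) rest others)))

      -- With all p elements on the line, the y-sum is p v ≋ 0. As |U| ≤ p, more than `β₁` of the
      -- points belong to `A` and supply the pairs; since h ≤ `β₁`, at least p - h others remain on
      -- the line.
      full-line : ∀ v → p + β₁ < count (on v) (U ++ A) → Goal x y
      full-line v crowded = from (line v heavy)
        where
        open ≤-Reasoning
        heavy : β₁ < count (on v) A
        heavy = +-cancelˡ-< p β₁ _ (begin-strict
          p + β₁  <⟨ crowded ⟩
          count (on v) (U ++ A)  ≡⟨ count-++ (on v) U A ⟩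
          count (on v) U + count (on v) A  ≤⟨ +-monoˡ-≤ _ (≤-trans (count-≤-length (on v) U) U≤p) ⟩
          p + count (on v) A  ∎)
        from : LineCover v → Goal x y
        from lc = combine-with {W = take t L} {W' = drop t L ++ (select (not ∘ on v) A ++ select (not ∘ on v) U)} UA↭ (↭-trans R↭ (↭-trans (++⁺ʳ _ (take-↭ t L)) (++-assoc (take t L) (drop t L) _))) (length-take-≤ t L t≤L)
            (lin₂ 1ℤ (-' v) sum-W p≋0' (ring (Σᶻ y (take t L)) (+ t) (+ h) v))
          where
          open LineCover lc
          open FromLine lc
          L : List E
          L = rest ++ select (on v) U
          R↭ : rest ++ others ↭ L ++ (select (not ∘ on v) A ++ select (not ∘ on v) U)
          R↭ = ↭-trans (++⁺ˡ rest (↭-trans (++⁺ˡ (select (not ∘ on v) A) (select-↭ (on v) U)) (shifts (select (not ∘ on v) A) (select (on v) U))))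
            (↭-sym (++-assoc rest (select (on v) U) _))
          on-L : All (λ e → on v e ≡ true) L
          on-L = ++⁺ (++⁻ʳ (flat ps) (All-resp-↭ perm (select-All (on v) A))) (select-All (on v) U)
          on-W : All (λ e → on v e ≡ true) (take t L)
          on-W = ++⁻ˡ (take t L) (All-resp-↭ (take-↭ t L) on-L)
          t≤L : t ≤ length L
          t≤L = +-cancelˡ-≤ (2 * h) t (length L) (begin
            2 * h + t  ≡⟨ trans (cong (λ s → h + s + t) (+-identityʳ h)) (trans (+-assoc h h t) (trans (cong (λ s → h + s) h+t) (+-comm h p))) ⟩
            p + h  ≤⟨ +-monoʳ-≤ p (≤-trans bound 4T≤β₁) ⟩
            p + β₁  ≤⟨ <⇒≤ crowded ⟩
            count (on v) (U ++ A)  ≡⟨ trans (count-++ (on v) U A) (+-comm _ (count (on v) A)) ⟩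
            count (on v) A + count (on v) U  ≡⟨ sym (cong₂ _+_ (length-select (on v) A) (length-select (on v) U)) ⟩
            length (select (on v) A) + length (select (on v) U)  ≡⟨ cong (_+ length (select (on v) U)) (trans (↭-length perm) (trans (length-++ (flat ps)) (cong (_+ length rest) (length-flat ps)))) ⟩
            2 * h + length rest + length (select (on v) U) ≡⟨ trans (+-assoc (2 * h) _ _) (cong (λ s → 2 * h + s) (sym (length-++ rest))) ⟩
            2 * h + length L  ∎)
          sum-W : Σᶻ y (take t L) ≋ + t *' v
          sum-W = ≋-trans (Σ-line y v (take t L) on-W) (≋-reflexive (cong (λ n → + n *' v) (length-take-≤ t L t≤L)))
          p≋0' : 0ℤ ≋ + t +' + h
          p≋0' = ≋-sym (≋-trans (≋-reflexive (trans (sym (ℤP.pos-+ t h)) (cong +_ (trans (+-comm t h) h+t)))) p≋0)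
          ring : ∀ s t h v → s -' (-' (h *' v)) ≡ 1ℤ *' (s -' t *' v) +' (-' v) *' (0ℤ -' (t +' h))
          ring = ℤ-solve

      -- If no line y ≡ const is crowded, `exact-sums` applies with d = h + β₁: every value occurs
      -- at most p + β₁ = t + d times. It asks for p + t + 2d elements besides the 2h in the pairs,
      -- in total 2p + 3h + 2β₁, which is the origin of `long`.
      heavy-line : ∀ v → β₁ < count (on v) A → Goal x y
      heavy-line v heavy with anyFin? (λ i → p + β₁ <? count (on (+ toℕ {p} i)) (U ++ A))
      ... | yes (i , crowded) = full-line (+ toℕ i) crowded
      ... | no  none = from (line v heavy)
        where
        open ≤-Reasoning
        sparse : ∀ z → count (on z) (U ++ A) ≤ p + β₁
        sparse z = ≤-trans (count-mono (U ++ A) λ e h → δ-true (≋-trans at-rep (δ-sound {z} h))) (≮⇒≥ λ crowded → none (fromℕ< (rep<p z) , crowded))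
          where
          at-rep : + toℕ (fromℕ< (rep<p z)) ≋ z
          at-rep = ≋-trans (≋-reflexive (cong +_ (toℕ-fromℕ< (rep<p z)))) (rep≋ z)
        from : LineCover v → Goal x y
        from lc = conclude (SetPartition.exact-sums y t (h + β₁) (rest ++ others) enough half light (-' (+ h *' v)))
          where
          open LineCover lc
          open FromLine lc
          R = rest ++ others
          3h≤ : 3 * h ≤ 3 * (4 * (p / nᵇ))
          3h≤ = *-monoʳ-≤ 3 bound
          enough : p + t + 2 * (h + β₁) ≤ suc (length R)
          enough = m≤n⇒m≤1+n (+-cancelˡ-≤ (2 * h) _ _ (begin
            2 * h + (p + t + 2 * (h + β₁))  ≡⟨ ring₁ h p t β₁ ⟩
            (h + t) + p + 3 * h + 2 * β₁  ≡⟨ cong (λ s → s + p + 3 * h + 2 * β₁) h+t ⟩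
            p + p + 3 * h + 2 * β₁  ≤⟨ +-monoˡ-≤ (2 * β₁) (+-monoʳ-≤ (p + p) 3h≤) ⟩
            p + p + 3 * (4 * (p / nᵇ)) + 2 * β₁  ≡⟨ cong (λ s → p + s + 3 * (4 * (p / nᵇ)) + 2 * β₁) (sym (+-identityʳ p)) ⟩
            2 * p + 3 * (4 * (p / nᵇ)) + 2 * β₁  ≤⟨ long ⟩
            length (U ++ A)  ≡⟨ A-length {ps} {R} UA↭ ⟩
            2 * h + length R  ∎))
            where
            ring₁ : ∀ h p t β → 2 * h + (p + t + 2 * (h + β)) ≡ (h + t) + p + 3 * h + 2 * β
            ring₁ = ℕ-solve
          half : p ≤ suc (2 * t)
          half = m≤n⇒m≤1+n (+-cancelˡ-≤ (2 * h) _ _ (begin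
            2 * h + p  ≤⟨ +-monoˡ-≤ p (*-monoʳ-≤ 2 bound) ⟩
            2 * (4 * (p / nᵇ)) + p  ≡⟨ cong (_+ p) (sym (*-assoc 2 4 (p / nᵇ))) ⟩
            8 * (p / nᵇ) + p  ≤⟨ +-monoˡ-≤ p (≤-trans 8T≤β₁ β₁≤p) ⟩
            p + p  ≡⟨ cong (λ s → p + s) (sym (+-identityʳ p)) ⟩
            2 * p  ≡⟨ cong (2 *_) (sym h+t) ⟩
            2 * (h + t)  ≡⟨ *-distribˡ-+ 2 h t ⟩
            2 * h + 2 * t  ∎))
          light : ∀ z → count (SetPartition.value y z) R ≤ t + (h + β₁)
          light z = ≤-trans (count-++ʳ (on z) {ys = flat ps} {zs = R} UA↭) (≤-trans (sparse z) (≤-reflexive (trans (cong (_+ β₁) (sym (trans (+-comm t h) h+t))) (+-assoc t h β₁))))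
          conclude : SetPartition.ExactSum y t R (-' (+ h *' v)) → Goal x y
          conclude (W , W' , R↭ , len , sum) = combine-with {W = W} {W' = W'} UA↭ R↭ len sum

    light-plane : ∀ x y → Light x y β₁ A → Goal x y
    light-plane x y light = from (Covers.cover-plane nᵃ Bᵃ<p x y β₁ A light (≤-trans room₁ p≤A))
      where
      open ≤-Reasoning
      p+p≤ : p + p ≤ length (U ++ A)
      p+p≤ = ≤-trans (≤-reflexive (cong (λ s → p + s) (sym (+-identityʳ p)))) (≤-trans (m≤m+n (2 * p) _) (≤-trans (m≤m+n _ (2 * β₁)) long))
      p≤A : p ≤ length A
      p≤A = +-cancelˡ-≤ p _ _ (≤-trans p+p≤ (≤-trans (≤-reflexive (length-++ U)) (+-monoˡ-≤ (length A) U≤p)))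
      from : Covers.Cover nᵃ Bᵃ<p x y β₁ (λ u v c → Σᶻ x c ≋ u × Σᶻ y c ≋ v) A → Goal x y
      from (ps , rest , perm , bound , hits) = pick (hits (-' Σᶻ x W) (-' Σᶻ y W))
        where
        h = length ps
        t = p ∸ h
        R = rest ++ U
        W = take t R
        h≤p : h ≤ p
        h≤p = ≤-trans bound (≤-trans (*-monoˡ-≤ (p / nᵃ) (m≤m+n 4 4)) (≤-trans (m≤n+m (8 * (p / nᵃ)) (suc (key-count (growth-constant nᵃ) * β₁))) room₁))
        h+t : h + t ≡ p
        h+t = m+[n∸m]≡n h≤p
        UA↭ : U ++ A ↭ flat ps ++ R
        UA↭ = ↭-trans (++-comm U A) (↭-trans (++⁺ʳ U perm) (++-assoc (flat ps) rest U))
        t≤R : t ≤ length R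
        t≤R = +-cancelˡ-≤ (2 * h) t (length R) (begin
          2 * h + t  ≡⟨ trans (cong (λ s → h + s + t) (+-identityʳ h)) (trans (+-assoc h h t) (cong (λ s → h + s) h+t)) ⟩
          h + p  ≤⟨ +-monoˡ-≤ p h≤p ⟩
          p + p  ≤⟨ p+p≤ ⟩
          length (U ++ A)  ≡⟨ A-length {ps} {R} UA↭ ⟩
          2 * h + length R  ∎)
        pick : (∃ λ c → Choice ps c × (Σᶻ x c ≋ -' Σᶻ x W × Σᶻ y c ≋ -' Σᶻ y W)) → Goal x y
        pick (c , ch , sx , sy) = c ++ W , proj₁ (choose UA↭ (take-↭ t R) ch) , proj₂ (choose UA↭ (take-↭ t R) ch) ,
          trans (length-++ c) (trans (cong₂ _+_ (length-choice ch) (length-take-≤ t R t≤R)) h+t) , Σ-cancel x c W sx , Σ-cancel y c W sy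

    -- A heavy line is sought among the finitely many forms and values modulo p. The form found
    -- becomes the second coordinate, next to y if α is invertible and to x otherwise; this
    -- invertible change of coordinates preserves multiplicities and zero sums.
    zero-sum : ∀ x y → Multiplicity x y → Goal x y
    zero-sum x y mult with anyFin? (λ i → anyFin? λ j → anyFin? λ k → ¬? ((+ toℕ {p} i ≋? 0ℤ) ×-dec (+ toℕ {p} j ≋? 0ℤ)) ×-dec
                                  (β₁ <? count (λ e → δ (+ toℕ {p} k) (+ toℕ i *' x e +' + toℕ j *' y e)) A))
    ... | no none = light-plane x y light
      where
      light : Light x y β₁ A
      light α γ αγ≢0 e = ≤-trans (count-mono A λ e' h → δ-true (same e' (δ-sound {α *' x e +' γ *' y e} h))) (≮⇒≥ λ heavy → none (i , j , k , (λ (a , c) → αγ≢0 (≋-trans (≋-sym (at α)) a , ≋-trans (≋-sym (at γ)) c)) , heavy))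
        where
        res : ℤ → Fin p
        res z = fromℕ< (rep<p z)
        at : ∀ z → + toℕ (res z) ≋ z
        at z = ≋-trans (≋-reflexive (cong +_ (toℕ-fromℕ< (rep<p z)))) (rep≋ z)
        i = res α
        j = res γ
        k = res (α *' x e +' γ *' y e)
        ring : ∀ α γ α' γ' x y → (α *' x +' γ *' y) -' (α' *' x +' γ' *' y) ≡ (-' x) *' (α' -' α) +' (-' y) *' (γ' -' γ)
        ring = ℤ-solve
        same : ∀ e' → α *' x e +' γ *' y e ≋ α *' x e' +' γ *' y e' → + toℕ k ≋ + toℕ i *' x e' +' + toℕ j *' y e'
        same e' h = ≋-trans (at _) (≋-trans h (lin₂ (-' x e') (-' y e') (at α) (at γ) (ring α γ (+ toℕ i) (+ toℕ j) (x e') (y e'))))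
    ... | yes (i , j , k , αγ≢0 , heavy) = by-case (α ≋? 0ℤ)
      where
      α γ v : ℤ
      α = + toℕ i
      γ = + toℕ j
      v = + toℕ k
      φ : E → ℤ
      φ e = α *' x e +' γ *' y e
      Σφ : ∀ C → Σᶻ φ C ≡ α *' Σᶻ x C +' γ *' Σᶻ y C
      Σφ []      = ring₀ α γ
        where
        ring₀ : ∀ α γ → 0ℤ ≡ α *' 0ℤ +' γ *' 0ℤ
        ring₀ = ℤ-solve
      Σφ (e ∷ C) = trans (cong (φ e +'_) (Σφ C)) (ring α γ (x e) (y e) (Σᶻ x C) (Σᶻ y C))
        where
        ring : ∀ α γ x y s t → (α *' x +' γ *' y) +' (α *' s +' γ *' t) ≡ α *' (x +' s) +' γ *' (y +' t)
        ring = ℤ-solve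
      ring-diff⁻¹ : ∀ s t → s -' t ≡ 1ℤ *' ((s -' t) -' 0ℤ)
      ring-diff⁻¹ = ℤ-solve
      from-diff : ∀ {s t} → s -' t ≋ 0ℤ → s ≋ t
      from-diff {s} {t} h = lin₁ 1ℤ h (ring-diff⁻¹ s t)
      by-case : Dec (α ≋ 0ℤ) → Goal x y
      by-case (no α≢0) = back (Heavy.heavy-line y φ mult' v heavy)
        where
        ring₁ : ∀ α γ x y x' y' → α *' (x -' x') -' 0ℤ ≡ 1ℤ *' ((α *' x +' γ *' y) -' (α *' x' +' γ *' y')) +' (-' γ) *' (y -' y')
        ring₁ = ℤ-solve
        mult' : Multiplicity y φ
        mult' e = ≤-trans (count-mono A λ e' h → let (hy , hφ) = ∧-split (δ (y e) (y e')) _ h in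
            cong₂ _∧_ (δ-true (from-diff (≋-cancel α≢0 (lin₂ 1ℤ (-' γ) (δ-sound {φ e} hφ) (δ-sound {y e} hy) (ring₁ α γ (x e) (y e) (x e') (y e')))))) hy) (mult e)
        ring₂ : ∀ α γ s t → α *' s -' 0ℤ ≡ 1ℤ *' ((α *' s +' γ *' t) -' 0ℤ) +' (-' γ) *' (t -' 0ℤ)
        ring₂ = ℤ-solve
        back : Goal y φ → Goal x y
        back (C , C' , perm , len , sy , sφ) = C , C' , perm , len ,
          ≋-cancel α≢0 (lin₂ 1ℤ (-' γ) (≋-trans (≋-reflexive (sym (Σφ C))) sφ) sy (ring₂ α γ (Σᶻ x C) (Σᶻ y C))) , sy
      by-case (yes α≋0) = back (Heavy.heavy-line x φ mult' v heavy)
        where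
        γ≢0 : ¬ γ ≋ 0ℤ
        γ≢0 h = αγ≢0 (α≋0 , h)
        ring₁ : ∀ α γ x y x' y' → γ *' (y -' y') -' 0ℤ ≡ 1ℤ *' ((α *' x +' γ *' y) -' (α *' x' +' γ *' y')) +' (-' α) *' (x -' x')
        ring₁ = ℤ-solve
        mult' : Multiplicity x φ
        mult' e = ≤-trans (count-mono A λ e' h → let (hx , hφ) = ∧-split (δ (x e) (x e')) _ h in
            cong₂ _∧_ hx (δ-true (from-diff (≋-cancel γ≢0 (lin₂ 1ℤ (-' α) (δ-sound {φ e} hφ) (δ-sound {x e} hx) (ring₁ α γ (x e) (y e) (x e') (y e'))))))) (mult e)
        ring₂ : ∀ α γ s t → γ *' t -' 0ℤ ≡ 1ℤ *' ((α *' s +' γ *' t) -' 0ℤ) +' (-' α) *' (s -' 0ℤ)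
        ring₂ = ℤ-solve
        back : Goal x φ → Goal x y
        back (C , C' , perm , len , sx , sφ) = C , C' , perm , len , sx ,
          ≋-cancel γ≢0 (lin₂ 1ℤ (-' α) (≋-trans (≋-reflexive (sym (Σφ C))) sφ) sx (ring₂ α γ (Σᶻ x C) (Σᶻ y C)))

-- Rational bounds, choice of the parameters, and both parts of the theorem.

module Reduction where
  import Data.Fin as Fin
  open import Data.Fin.Properties using (toℕ-injective)
  open import Data.Integer using (+<+) renaming (_<_ to _<'_)
  open import Data.List using (replicate)
  open import Data.List.Properties using (length-replicate)
  open import Data.List.Relation.Binary.Sublist.Propositional.Properties using (length-mono-≤)
  open import Data.Nat.Divisibility using (divides) renaming (_∣_ to _∣ℕ_)
  open import Data.Nat.ListAction using (sum)
  open import Data.Product.Properties using (≡-dec)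
  open import Data.Rational as ℚ using (ℚ; 0ℚ; mkℚ; toℚᵘ; fromℚᵘ; ↧ₙ_)
  import Data.Rational.Properties as ℚP
  open import Data.Rational.Unnormalised as ℚᵘ using (mkℚᵘ)
  import Data.Rational.Unnormalised.Properties as ℚᵘP
  open import Defs
  open Lists

  -- Of ε = n/d only ε ≥ 1/d is kept, so that the denominator serves as the `m` of `Parameters`.
  clear-denominators : ∀ r a → toℚᵘ r ≡ mkℚᵘ (+ a) 0 → ∀ ε → 0ℚ ℚ.< ε → ∀ p L →
                       (r ℚ.+ ε) ℚ.* ℕ→ℚ p ℚ.< ℕ→ℚ L → (a * ↧ₙ ε + 1) * p ≤ ↧ₙ ε * L
  clear-denominators r a r≡ ε@(mkℚ n d-1 _) ε>0 p L h = positive-numerator n (ℚP.drop-*<* ε>0) (ℚᵘP.drop-*<* unnormalised)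
    where
    unnormalised : (mkℚᵘ (+ a) 0 ℚᵘ.+ mkℚᵘ n d-1) ℚᵘ.* mkℚᵘ (+ p) 0 ℚᵘ.< mkℚᵘ (+ L) 0
    unnormalised = ℚᵘP.<-respʳ-≃ (ℚP.toℚᵘ-fromℚᵘ (mkℚᵘ (+ L) 0)) (ℚᵘP.<-respˡ-≃
      (ℚᵘP.≃-trans (ℚP.toℚᵘ-homo-* (r ℚ.+ ε) (ℕ→ℚ p)) (ℚᵘP.*-cong (ℚᵘP.≃-trans (ℚP.toℚᵘ-homo-+ r ε) (ℚᵘP.+-cong (ℚᵘP.≃-reflexive r≡) ℚᵘP.≃-refl)) (ℚP.toℚᵘ-fromℚᵘ (mkℚᵘ (+ p) 0))))
      (ℚP.toℚᵘ-mono-< h))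
    positive-numerator : ∀ n → + 0 *' + suc d-1 <' n *' 1ℤ →
      ((+ a *' + suc d-1 +' n *' 1ℤ) *' + p) *' 1ℤ <' + L *' + (suc (d-1 + 0 * suc d-1) * 1) → (a * suc d-1 + 1) * p ≤ suc d-1 * L
    positive-numerator (+ zero)   (+<+ ())
    positive-numerator (+ suc n)  _ k = ≤-trans (*-monoˡ-≤ p (+-monoʳ-≤ (a * suc d-1) (s≤s (z≤n {n}))))
      (<⇒≤ (ℤP.drop‿+<+ (subst₂ _<'_ lhs rhs k)))
      where
      lhs : ((+ a *' + suc d-1 +' + suc n *' 1ℤ) *' + p) *' 1ℤ ≡ + ((a * suc d-1 + suc n) * p)
      lhs = trans (ℤP.*-identityʳ _) (trans (cong (_*' + p) (cong₂ _+'_ (sym (ℤP.pos-* a (suc d-1))) (ℤP.*-identityʳ (+ suc n)))) (sym (ℤP.pos-* (a * suc d-1 + suc n) p)))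
      rhs : + L *' + (suc (d-1 + 0 * suc d-1) * 1) ≡ + (suc d-1 * L)
      rhs = trans (sym (ℤP.pos-* L _)) (cong +_ (trans (cong (L *_) (trans (*-identityʳ _) (cong suc (+-identityʳ d-1)))) (*-comm L (suc d-1))))
    positive-numerator -[1+ n ] ()

  unit-fraction : ℕ → ℚ
  unit-fraction D = fromℚᵘ (mkℚᵘ (+ 1) D)

  unit-fraction>0 : ∀ D → 0ℚ ℚ.< unit-fraction D
  unit-fraction>0 D = ℚP.toℚᵘ-cancel-< (ℚᵘP.<-respʳ-≃ (ℚᵘP.≃-sym (ℚP.toℚᵘ-fromℚᵘ (mkℚᵘ (+ 1) D))) (ℚᵘ.*<* (+<+ (s≤s z≤n))))

  below-unit-fraction : ∀ D p k → ℕ→ℚ k ℚ.< unit-fraction D ℚ.* ℕ→ℚ p → k * suc D ≤ p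
  below-unit-fraction D p k h = <⇒≤ (ℤP.drop‿+<+ (subst₂ _<'_ lhs rhs (ℚᵘP.drop-*<* unnormalised)))
    where
    unnormalised : mkℚᵘ (+ k) 0 ℚᵘ.< mkℚᵘ (+ 1) D ℚᵘ.* mkℚᵘ (+ p) 0
    unnormalised = ℚᵘP.<-respˡ-≃ (ℚP.toℚᵘ-fromℚᵘ (mkℚᵘ (+ k) 0)) (ℚᵘP.<-respʳ-≃
      (ℚᵘP.≃-trans (ℚP.toℚᵘ-homo-* (unit-fraction D) (ℕ→ℚ p)) (ℚᵘP.*-cong (ℚP.toℚᵘ-fromℚᵘ (mkℚᵘ (+ 1) D)) (ℚP.toℚᵘ-fromℚᵘ (mkℚᵘ (+ p) 0))))
      (ℚP.toℚᵘ-mono-< h))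
    lhs : + k *' + suc (D * 1) ≡ + (k * suc D)
    lhs = trans (sym (ℤP.pos-* k (suc (D * 1)))) (cong (λ t → + (k * suc t)) (*-identityʳ D))
    rhs : (1ℤ *' + p) *' 1ℤ ≡ + p
    rhs = trans (ℤP.*-identityʳ _) (ℤP.*-identityˡ (+ p))

  module Parameters (m : ℕ) .{{m≢0 : NonZero m}} where
    opaque
      -- 8 (p / 16) is at most p/2, which leaves half of `room₁` to the other terms.
      nᵃ : ℕ
      nᵃ = 16

      -- With β₁ = p / K, both β₁ and its multiple by `key-count` are at most p/(4m); the first is
      -- for `long`, the second for `room₁`.
      K : ℕ
      K = 4 * m * suc (key-count (growth-constant nᵃ))

      -- 8 (p / nᵇ) takes at most p/(2K), half of what `room₀` allows; `D` gives the other half to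
      -- the term with β₀.
      nᵇ : ℕ
      nᵇ = 16 * K

      D : ℕ
      D = 2 * K * key-count (growth-constant nᵇ)

      -- Exceeds both growth constants; 4m ≤ p absorbs the additive 1 in `room₁` and `long`.
      p₀ : ℕ
      p₀ = suc (growth-constant nᵃ) + suc (growth-constant nᵇ) + 4 * m

      nᵃ≢0 : NonZero nᵃ
      nᵃ≢0 = _

      K≢0 : NonZero K
      K≢0 = m*n≢0 (4 * m) (suc (key-count (growth-constant nᵃ))) {{m*n≢0 4 m}}

      nᵇ≢0 : NonZero nᵇ
      nᵇ≢0 = m*n≢0 16 K {{_}} {{K≢0}}

    instance
      nᵃ-nonZero : NonZero nᵃ
      nᵃ-nonZero = nᵃ≢0
      K-nonZero : NonZero K
      K-nonZero = K≢0
      nᵇ-nonZero : NonZero nᵇ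
      nᵇ-nonZero = nᵇ≢0

    module Bounds (p : ℕ) (p₀≤p : p₀ ≤ p) where

      β₀ β₁ : ℕ
      β₀ = p / suc D
      β₁ = p / K

      β₁≤p : β₁ ≤ p
      β₁≤p = m/n≤m p K

      opaque
        unfolding p₀

        Bᵃ<p : growth-constant nᵃ < p
        Bᵃ<p = ≤-trans (≤-trans (m≤m+n _ (suc (growth-constant nᵇ))) (m≤m+n _ (4 * m))) p₀≤p

        Bᵇ<p : growth-constant nᵇ < p
        Bᵇ<p = ≤-trans (≤-trans (m≤n+m _ (suc (growth-constant nᵃ))) (m≤m+n _ (4 * m))) p₀≤p

        4m≤p : 4 * m ≤ p
        4m≤p = ≤-trans (m≤n+m (4 * m) (suc (growth-constant nᵃ) + suc (growth-constant nᵇ))) p₀≤p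

        room₁ : suc (key-count (growth-constant nᵃ) * β₁) + 8 * (p / nᵃ) ≤ p
        room₁ = *-cancelˡ-≤ 4 (arith p m (key-count (growth-constant nᵃ)) β₁ (p / nᵃ) (>-nonZero⁻¹ m) 4m≤p (m/n*n≤m p K) (m/n*n≤m p nᵃ))
          where
          arith : ∀ p m N β T → 1 ≤ m → 4 * m ≤ p → β * (4 * m * suc N) ≤ p → T * 16 ≤ p → 4 * (suc (N * β) + 8 * T) ≤ 4 * p
          arith p (suc m) N β T _ h₁ h₂ h₃ = by-≤ (4 * (suc (N * β) + 8 * T)) (4 * p) (4 * m + 4 * β + 4 * m * (β * suc N)) (+-mono-≤ (+-mono-≤ h₁ h₂) (*-monoʳ-≤ 2 h₃)) (ring p m N β T)
            where
            ring : ∀ p m N β T → 4 * (suc (N * β) + 8 * T) + (p + p + 2 * p) + (4 * m + 4 * β + 4 * m * (β * suc N)) ≡ 4 * p + (4 * suc m + β * (4 * suc m * suc N) + 2 * (T * 16))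
            ring = ℕ-solve

        room₀ : key-count (growth-constant nᵇ) * β₀ + 8 * (p / nᵇ) ≤ β₁
        room₀ = ≤-trans (≤-reflexive (sym (m*n/n≡m (key-count (growth-constant nᵇ) * β₀ + 8 * (p / nᵇ)) K)))
            (/-monoˡ-≤ K (*-cancelˡ-≤ 2 (arith p K (key-count (growth-constant nᵇ)) β₀ (p / nᵇ) (m/n*n≤m p (suc D)) (m/n*n≤m p nᵇ))))
          where
          arith : ∀ p K N β T → β * suc (2 * K * N) ≤ p → T * (16 * K) ≤ p → 2 * ((N * β + 8 * T) * K) ≤ 2 * p
          arith p K N β T h₁ h₂ = by-≤ (2 * ((N * β + 8 * T) * K)) (2 * p) β (+-mono-≤ h₁ h₂) (ring p K N β T)
            where
            ring : ∀ p K N β T → 2 * ((N * β + 8 * T) * K) + (p + p) + β ≡ 2 * p + (β * suc (2 * K * N) + T * (16 * K))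
            ring = ℕ-solve

        -- The surplus p/m over 2p has to pay for 1 + 12 (p / nᵇ) + 2β₁. Multiplied by m, these
        -- terms are at most p/4, p/4 and p/2. The `suc` makes up for padding with p - 1 zeros and
        -- not p.
        long : ∀ L → (2 * m + 1) * p ≤ m * L → suc (2 * p + 3 * (4 * (p / nᵇ)) + 2 * β₁) ≤ L
        long L h = *-cancelˡ-≤ m (≤-trans (*-cancelˡ-≤ 4 (arith p m (key-count (growth-constant nᵃ)) β₁ (p / nᵇ) 4m≤p (m/n*n≤m p K) (m/n*n≤m p nᵇ))) h)
          where
          arith : ∀ p m N β T → 4 * m ≤ p → β * (4 * m * suc N) ≤ p → T * (16 * (4 * m * suc N)) ≤ p →
                  4 * (m * suc (2 * p + 3 * (4 * T) + 2 * β)) ≤ 4 * ((2 * m + 1) * p)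
          arith p m N β T h₁ h₂ h₃ = by-≤ (4 * (m * suc (2 * p + 3 * (4 * T) + 2 * β))) (4 * ((2 * m + 1) * p)) (8 * (m * (N * β)) + 16 * (m * T) + 64 * (m * (N * T)))
              (+-mono-≤ (+-mono-≤ h₁ (*-monoʳ-≤ 2 h₂)) h₃) (ring p m N β T)
            where
            ring : ∀ p m N β T → 4 * (m * suc (2 * p + 3 * (4 * T) + 2 * β)) + (p + 2 * p + p) + (8 * (m * (N * β)) + 16 * (m * T) + 64 * (m * (N * T))) ≡
                   4 * ((2 * m + 1) * p) + (4 * m + 2 * (β * (4 * m * suc N)) + T * (16 * (4 * m * suc N)))
            ring = ℕ-solve

  module Assemble (m : ℕ) .{{m≢0 : NonZero m}} (p : ℕ) (pr : Prime p) (p₀≤p : Parameters.p₀ m ≤ p) where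
    open Parameters m
    open Bounds p p₀≤p
    open ExactLength p pr

    x y : Zp² p → ℤ
    x e = + toℕ (proj₁ e)
    y e = + toℕ (proj₂ e)

    Σᶻ-sum : ∀ (f : Zp² p → ℕ) C → Σᶻ (λ e → + f e) C ≡ + sum (map f C)
    Σᶻ-sum f []      = refl
    Σᶻ-sum f (e ∷ C) = trans (cong (+ f e +'_) (Σᶻ-sum f C)) (sym (ℤP.pos-+ (f e) _))

    ≋0⇒∣ : ∀ s → + s ≋ 0ℤ → p ∣ℕ s
    ≋0⇒∣ s (mk≋ k e) = divides ∣ k ∣ (trans (cong ∣_∣ (trans (sym (ℤP.+-identityʳ (+ s))) e)) (ℤP.abs-* k (+ p)))

    sum-zero : ∀ C → Σᶻ x C ≋ 0ℤ → Σᶻ y C ≋ 0ℤ → SumZero C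
    sum-zero C sx sy = ≋0⇒∣ _ (≋-trans (≋-reflexive (sym (Σᶻ-sum (toℕ ∘ proj₁) C))) sx) , ≋0⇒∣ _ (≋-trans (≋-reflexive (sym (Σᶻ-sum (toℕ ∘ proj₂) C))) sy)

    count≤mult : ∀ e A → count (λ e' → δ (x e) (x e') ∧ δ (y e) (y e')) A ≤ mult e A
    count≤mult e [] = z≤n
    count≤mult e (e' ∷ A) with ≡-dec Fin._≟_ Fin._≟_ e e'
    ... | yes _   = +-mono-≤ (⟦⟧≤1 _) (count≤mult e A)
    ... | no e≢e' = ≤-trans (≤-reflexive (cong (λ b → ⟦ b ⟧ + count (λ e' → δ (x e) (x e') ∧ δ (y e) (y e')) A) (differ _ refl))) (count≤mult e A)
      where
      δ⇒≡ : ∀ {i j : Fin p} → δ (+ toℕ i) (+ toℕ j) ≡ true → i ≡ j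
      δ⇒≡ {i} {j} h = toℕ-injective (≋⇒≡ (toℕ<n i) (toℕ<n j) (δ-sound {+ toℕ i} h))
      differ : ∀ b → δ (x e) (x e') ∧ δ (y e) (y e') ≡ b → δ (x e) (x e') ∧ δ (y e) (y e') ≡ false
      differ false h = h
      differ true  h = ⊥-elim (e≢e' (cong₂ _,_ (δ⇒≡ (proj₁ (∧-split (δ (x e) (x e')) _ h))) (δ⇒≡ (proj₂ (∧-split (δ (x e) (x e')) _ h)))))

    ZeroSumIn : Multiset p → Set
    ZeroSumIn L = Σ (Multiset p) λ B → B ⊆ L × length B ≡ p × Σᶻ x B ≋ 0ℤ × Σᶻ y B ≋ 0ℤ

    exact : ∀ U A → length U ≤ p → (2 * m + 1) * p ≤ m * suc (length U + length A) → (∀ e → mult e A * suc D ≤ p) →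
            ZeroSumIn (U ++ A)
    exact U A U≤p large few = extract (ExactLength.ZeroSum.zero-sum p pr nᵃ nᵇ Bᵃ<p Bᵇ<p β₀ β₁ room₁ room₀ β₁≤p
        U A U≤p (≤-trans (≤-pred (long (suc (length U + length A)) large)) (≤-reflexive (sym (length-++ U)))) x y
        (λ e → ≤-trans (count≤mult e A) (≤-trans (≤-reflexive (sym (m*n/n≡m (mult e A) (suc D)))) (/-monoˡ-≤ (suc D) (few e)))))
      where
      extract : (∃₂ λ C C' → U ++ A ↭ C ++ C' × length C ≡ p × Σᶻ x C ≋ 0ℤ × Σᶻ y C ≋ 0ℤ) →
                ZeroSumIn (U ++ A)
      extract (C , C' , perm , len , sx , sy) = reorder (⊆-resp-↭ perm (prefix-⊆ C C'))
        where
        reorder : (∃ λ B → B ⊆ U ++ A × B ↭ C) → ZeroSumIn (U ++ A)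
        reorder (B , B⊆ , B↭C) = B , B⊆ , trans (↭-length B↭C) len , ≋-trans (≋-reflexive (Σᶻ-↭ x B↭C)) sx , ≋-trans (≋-reflexive (Σᶻ-↭ y B↭C)) sy

    part₂ : ∀ A → (∀ e → mult e A * suc D ≤ p) → (2 * m + 1) * p ≤ m * length A → Σ (Multiset p) λ B → B ⊆ A × length B ≡ p × SumZero B
    part₂ A few large = finish (exact [] A z≤n (≤-trans large (*-monoʳ-≤ m (n≤1+n (length A)))) few)
      where
      finish : ZeroSumIn A → Σ (Multiset p) λ B → B ⊆ A × length B ≡ p × SumZero B
      finish (B , B⊆ , len , sx , sy) = B , B⊆ , len , sum-zero B sx sy

    part₁ : ∀ A → (∀ e → mult e A * suc D ≤ p) → (1 * m + 1) * p ≤ m * length A → Σ (Multiset p) λ B → B ⊆ A × B ≢ [] × length B ≤ p × SumZero B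
    part₁ A few large = split (exact zeros A zeros≤p large' few)
      where
      origin : Zp² p
      origin = fromℕ< (>-nonZero⁻¹ p) , fromℕ< (>-nonZero⁻¹ p)
      zeros : Multiset p
      -- With p zeros, the zero sum found could consist of zeros alone; with p - 1 it must use an
      -- element of `A`.
      zeros = replicate (pred p) origin
      suc-zeros : suc (length zeros) ≡ p
      suc-zeros = trans (cong suc (length-replicate (pred p))) (suc-pred p)
      zeros≤p : length zeros ≤ p
      zeros≤p = <⇒≤ (≤-reflexive suc-zeros)
      large' : (2 * m + 1) * p ≤ m * suc (length zeros + length A)
      large' = ≤-trans (≤-reflexive (ring m p)) (≤-trans (+-monoʳ-≤ (m * p) large) (≤-reflexive (trans (sym (*-distribˡ-+ m p (length A))) (cong (λ t → m * (t + length A)) (sym suc-zeros)))))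
        where
        ring : ∀ m p → (2 * m + 1) * p ≡ m * p + (1 * m + 1) * p
        ring = ℕ-solve
      x-origin : x origin ≡ 0ℤ
      x-origin = cong +_ (toℕ-fromℕ< (>-nonZero⁻¹ p))
      drop-zeros : ∀ (f : Zp² p → ℤ) → f origin ≡ 0ℤ → ∀ n {us} vs → us ⊆ replicate n origin → Σᶻ f (us ++ vs) ≡ Σᶻ f vs
      drop-zeros f f0 zero    vs []       = refl
      drop-zeros f f0 (suc n) vs (_ ∷ʳ h) = drop-zeros f f0 n vs h
      drop-zeros f f0 (suc n) vs (refl ∷ h) = trans (cong₂ _+'_ f0 (drop-zeros f f0 n vs h)) (ℤP.+-identityˡ _)
      split : ZeroSumIn (zeros ++ A) → Σ (Multiset p) λ B → B ⊆ A × B ≢ [] × length B ≤ p × SumZero B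
      split (B , B⊆ , len , sx , sy) = remainder (split-⊆ zeros B⊆)
        where
        remainder : (∃₂ λ us vs → B ≡ us ++ vs × us ⊆ zeros × vs ⊆ A) → Σ (Multiset p) λ B → B ⊆ A × B ≢ [] × length B ≤ p × SumZero B
        remainder (us , vs , refl , us⊆ , vs⊆) = vs , vs⊆ , nonempty vs lens , ≤-trans (m≤n+m (length vs) (length us)) (≤-reflexive lens) ,
            sum-zero vs (≋-trans (≋-reflexive (sym (drop-zeros x x-origin (pred p) vs us⊆))) sx) (≋-trans (≋-reflexive (sym (drop-zeros y x-origin (pred p) vs us⊆))) sy)
          where
          lens : length us + length vs ≡ p
          lens = trans (sym (length-++ us)) len
          nonempty : ∀ vs → length us + length vs ≡ p → vs ≢ []
          nonempty .[] lens refl = <⇒≱ (≤-trans (s≤s (length-mono-≤ us⊆)) (≤-reflexive suc-zeros)) (≤-reflexive (trans (sym lens) (+-identityʳ (length us))))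

open import Defs
open import Data.Nat using (ℕ; _≤_)
open import Data.Nat.Primality using (Prime)
open import Data.Product using (Σ; _×_)
open import Data.List using (List; []; length)
open import Data.List.Relation.Binary.Sublist.Propositional using (_⊆_)
open import Data.Rational using (ℚ; 0ℚ; 1ℚ; _+_; _*_; _<_)
open import Relation.Binary.PropositionalEquality using (_≡_; _≢_)
open Reduction using (unit-fraction; unit-fraction>0; below-unit-fraction; clear-denominators; module Parameters; module Assemble)
open import Data.Product using (_,_)
open import Data.Rational using (↧ₙ_)
open import Relation.Binary.PropositionalEquality using (refl)

theorem4 : (ε : ℚ) → 0ℚ < ε →
    Σ ℚ λ δ → 0ℚ < δ × Σ ℕ λ p₀ →
    (p : ℕ) → Prime p → p₀ ≤ p →
    (A : Multiset p) →
    ((x : Zp² p) → ℕ→ℚ (mult x A) < δ * ℕ→ℚ p) →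
    (((1ℚ + ε) * ℕ→ℚ p < ℕ→ℚ (length A) →
    Σ (Multiset p) λ B → B ⊆ A × B ≢ [] × length B ≤ p × SumZero B)
    × ((1ℚ + 1ℚ + ε) * ℕ→ℚ p < ℕ→ℚ (length A) →
    Σ (Multiset p) λ B → B ⊆ A × length B ≡ p × SumZero B))
theorem4 ε ε>0 = unit-fraction D , unit-fraction>0 D , p₀ , λ p pr p₀≤p A few →
    (λ large → Assemble.part₁ (↧ₙ ε) p pr p₀≤p A (λ e → below-unit-fraction D p (mult e A) (few e))
      (clear-denominators 1ℚ 1 refl ε ε>0 p (length A) large)) ,
    (λ large → Assemble.part₂ (↧ₙ ε) p pr p₀≤p A (λ e → below-unit-fraction D p (mult e A) (few e))
      (clear-denominators (1ℚ + 1ℚ) 2 refl ε ε>0 p (length A) large))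
  where
  open Parameters (↧ₙ ε)
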